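{- For $n\geq 1$, with $P_0(x,y,q)=1$ and $P_1(x,y,q)=yq$, $$P_{n+1}(x,y,q)=qyP_n(x,y,q)+qx\sum_{k=0}^{n-1}\binom{n}{k}P_k(x,y,q)\,2^{n-k}A_{n-k}(x).$$ Moreover, $$P_{n+1}(x,y,q)=(2nx+qy)P_n(x,y,q)+2x(1-x)\frac{\partial}{\partial x}P_n(x,y,q)+2x(1-y)\frac{\partial}{\partial y}P_n(x,y,q).$$ Furthermore, $$\sum_{n\ge0}P_n(x,y,q)\frac{z^n}{n!}=e^{qz(y-1)}\left(\sqrt{\frac{x-1}{x-e^{2z(x-1)}}}\right)^q.$$
   Context: $A_m(x)=\sum_{\pi\in\mathfrak{S}_m}x^{{\rm des}(\pi)}$ where ${\rm des}(\pi)=\#\{i\in[m-1]:\pi(i)>\pi(i+1)\}$. Let $[n]_2=\{1,1,\ldots,n,n\}$. A Stirling permutation of order $k$ is a permutation of $[k]_2$ such that for each $i$ every entry between the two occurrences of $i$ is greater than $i$; $\mathcal{Q}_k$ denotes their set. For a word $\omega$, ${\rm red}(\omega)$ replaces each occurrence of the $i$th smallest distinct value by $i$. A Stirling permutation of the second kind of order $n$ is a permutation $\sigma$ of $[n]_2$ written as a nonempty disjoint union of cycles in standard cycle form such that: (i) the two copies of each $i\in[n]$ lie in the same cycle; (ii) each cycle is written with one of its smallest entries first and cycles are in increasing order of smallest entries; (iii) for each cycle $(c_1,\ldots,c_{2k})$, ${\rm red}(c_1\cdots c_{2k})\in\mathcal{Q}_k$. $\mathcal{Q}_n^2$ is the set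 of these. For a cycle $(c_1,\ldots,c_{2k})$ with $k\ge2$, an entry $c_i$ with $2\le i\le 2k-1$ is a cycle ascent plateau if $c_{i-1}<c_i=c_{i+1}$; ${\rm cap}(\sigma)$ is their total number in $\sigma$, ${\rm cyc}(\sigma)$ is the number of cycles, and ${\rm fix}(\sigma)=\#\{k\in[n]:(kk)\text{ is a cycle of }\sigma\}$. $P_n(x,y,q)=\sum_{\sigma\in\mathcal{Q}_n^2}x^{{\rm cap}(\sigma)}y^{{\rm fix}(\sigma)}q^{{\rm cyc}(\sigma)}$ for $n\ge1$. -}

module Defs where

open import Data.Nat as ℕ using (ℕ; zero; suc; _∸_; _!)
open import Data.Nat.Combinatorics using (_C_)
open import Data.Integer using (+_)
open import Data.Rational as ℚ using (ℚ; 0ℚ; 1ℚ)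
open import Data.Fin as Fin using (Fin)
open import Data.List using (List; []; _∷_; _++_; map; upTo; length; lookup; filter; deduplicate; foldr; concat)
open import Data.List.Relation.Unary.All using (All)
open import Data.List.Relation.Unary.Unique.Propositional using (Unique)
open import Data.List.Membership.Propositional using (_∈_)
open import Data.List.Relation.Binary.Permutation.Propositional using (_↭_)
open import Data.Product using (Σ; ∃; ∃-syntax; _×_)
open import Relation.Nullary using (yes; no)
open import Relation.Binary.PropositionalEquality using (_≡_; _≢_)

ℕ→ℚ : ℕ → ℚ
ℕ→ℚ n = + n ℚ./ 1

-- reciprocal, with the (never used) convention 1/0 = 0
recip : ℚ → ℚ
recip p with p ℚ.≟ 0ℚ
... | yes _ = 0ℚ
... | no p≢0 = ℚ.1/_ p {{ℚ.≢-nonZero p≢0}}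

sumTo : ℕ → (ℕ → ℚ) → ℚ
sumTo zero f = f 0
sumTo (suc n) f = sumTo n f ℚ.+ f (suc n)

sumLt : ℕ → (ℕ → ℚ) → ℚ
sumLt zero f = 0ℚ
sumLt (suc n) f = sumLt n f ℚ.+ f n

-- Formal power series in the four variables x, y, q, z over ℚ.
-- f a b c d is the coefficient of x^a y^b q^c z^d.

Series : Set
Series = ℕ → ℕ → ℕ → ℕ → ℚ

infix 4 _≈_
_≈_ : Series → Series → Set
f ≈ g = ∀ a b c d → f a b c d ≡ g a b c d

mono : ℕ → ℕ → ℕ → ℕ → Series
mono i j k l a b c d with i ℕ.≟ a | j ℕ.≟ b | k ℕ.≟ c | l ℕ.≟ d
... | yes _ | yes _ | yes _ | yes _ = 1ℚ
... | _ | _ | _ | _ = 0ℚ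

zeroS oneS X Y Qv Z : Series
zeroS _ _ _ _ = 0ℚ
oneS = mono 0 0 0 0
X = mono 1 0 0 0
Y = mono 0 1 0 0
Qv = mono 0 0 1 0
Z = mono 0 0 0 1

infixl 6 _+S_ _-S_
infixl 7 _*S_ _·S_

_+S_ _-S_ _*S_ : Series → Series → Series
(f +S g) a b c d = f a b c d ℚ.+ g a b c d
(f -S g) a b c d = f a b c d ℚ.- g a b c d
(f *S g) a b c d =
  sumTo a λ i → sumTo b λ j → sumTo c λ k → sumTo d λ l →
    f i j k l ℚ.* g (a ∸ i) (b ∸ j) (c ∸ k) (d ∸ l)

_·S_ : ℚ → Series → Series
(r ·S f) a b c d = r ℚ.* f a b c d

constS : ℚ → Series
constS r = r ·S oneS

powS : Series → ℕ → Series
powS f zero = oneS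
powS f (suc m) = f *S powS f m

deg : ℕ → ℕ → ℕ → ℕ → ℕ
deg a b c d = a ℕ.+ b ℕ.+ c ℕ.+ d

-- exp H = Σ_m H^m / m!, for H with zero constant term
-- (the terms with m > total degree vanish, so the sum is truncated there)
expS : Series → Series
expS H a b c d = sumTo (deg a b c d) λ m → recip (ℕ→ℚ (m !)) ℚ.* powS H m a b c d

-- log G = - Σ_{m≥1} (1 - G)^m / m, for G with constant term 1
logS : Series → Series
logS G a b c d =
  ℚ.- (sumTo (deg a b c d) λ m → recip (ℕ→ℚ (suc m)) ℚ.* powS (oneS -S G) (suc m) a b c d)

-- multiplicative inverse of a series G with nonzero constant term g₀:
-- G⁻¹ = g₀⁻¹ Σ_m (1 - g₀⁻¹ G)^m
invS : Series → Series
invS G a b c d =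
  recip g₀ ℚ.* (sumTo (deg a b c d) λ m → powS (oneS -S (recip g₀ ·S G)) m a b c d)
  where g₀ = G 0 0 0 0

∂x ∂y : Series → Series
∂x f a b c d = ℕ→ℚ (suc a) ℚ.* f (suc a) b c d
∂y f a b c d = ℕ→ℚ (suc b) ℚ.* f a (suc b) c d

ΣS< : ℕ → (ℕ → Series) → Series
ΣS< n F a b c d = sumLt n λ k → F k a b c d

Enumerates : {A : Set} → (A → Set) → List A → Set
Enumerates P L = Unique L × (∀ a → a ∈ L → P a) × (∀ a → P a → a ∈ L)

range : ℕ → List ℕ
range m = map suc (upTo m)

IsPerm : ℕ → List ℕ → Set
IsPerm m π = π ↭ range m

descentAt : ℕ → ℕ → ℕ
descentAt a b with b ℕ.<? a
... | yes _ = 1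
... | no _ = 0

des : List ℕ → ℕ
des (a ∷ b ∷ r) = descentAt a b ℕ.+ des (b ∷ r)
des _ = 0

-- A_m(x), given the list of all permutations of [m]
Eulerian : List (List ℕ) → Series
Eulerian perms = foldr (λ π acc → mono (des π) 0 0 0 +S acc) zeroS perms

doubled : ℕ → List ℕ
doubled zero = []
doubled (suc k) = doubled k ++ (suc k ∷ suc k ∷ [])

IsStirling : ℕ → List ℕ → Set
IsStirling k w =
  w ↭ doubled k ×
  (∀ (i j l : Fin (length w)) → i Fin.< j → j Fin.< l →
     lookup w i ≡ lookup w l → lookup w i ℕ.< lookup w j)

-- red(ω): the i-th smallest distinct value is replaced by i
red : List ℕ → List ℕ
red ω = map (λ v → suc (length (deduplicate ℕ._≟_ (filter (ℕ._<? v) ω)))) ω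

firstEntry : List ℕ → ℕ
firstEntry [] = 0
firstEntry (h ∷ _) = h

HeadIsMin : List ℕ → Set
HeadIsMin c = ∃[ h ] ∃[ t ] (c ≡ h ∷ t × All (h ℕ.≤_) t)

-- σ ∈ 𝒬_n^2, σ given as the list of its cycles in standard cycle form
IsQ2 : ℕ → List (List ℕ) → Set
IsQ2 n σ =
  0 ℕ.< length σ ×
  concat σ ↭ doubled n ×
  (∀ (i j : Fin (length σ)) (v : ℕ) → v ∈ lookup σ i → v ∈ lookup σ j → i ≡ j) ×
  All HeadIsMin σ ×
  (∀ (i j : Fin (length σ)) → i Fin.< j → firstEntry (lookup σ i) ℕ.< firstEntry (lookup σ j)) ×
  All (λ c → IsStirling (length c ℕ./ 2) (red c)) σ

plateauAt : ℕ → ℕ → ℕ → ℕ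
plateauAt a b c with a ℕ.<? b | b ℕ.≟ c
... | yes _ | yes _ = 1
... | _ | _ = 0

capC : List ℕ → ℕ
capC (a ∷ b ∷ c ∷ r) = plateauAt a b c ℕ.+ capC (b ∷ c ∷ r)
capC _ = 0

cap : List (List ℕ) → ℕ
cap σ = foldr (λ c acc → capC c ℕ.+ acc) 0 σ

isFixC : List ℕ → ℕ
isFixC (a ∷ b ∷ []) with a ℕ.≟ b
... | yes _ = 1
... | no _ = 0
isFixC _ = 0

fix : List (List ℕ) → ℕ
fix σ = foldr (λ c acc → isFixC c ℕ.+ acc) 0 σ

cyc : List (List ℕ) → ℕ
cyc = length

weightSum : List (List (List ℕ)) → Series
weightSum L = foldr (λ σ acc → mono (cap σ) (fix σ) (cyc σ) 0 +S acc) zeroS L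

-- P_n(x,y,q), given for each n the list Q2 n of all elements of 𝒬_n^2 (used for n ≥ 1)
P : (ℕ → List (List (List ℕ))) → ℕ → Series
P Q2 zero = oneS
P Q2 (suc n) = weightSum (Q2 (suc n))

EGF : (ℕ → List (List (List ℕ))) → Series
EGF Q2 a b c n = recip (ℕ→ℚ (n !)) ℚ.* P Q2 n a b c 0

-- e^{qz(y-1)} ( sqrt((x-1)/(x - e^{2z(x-1)})) )^q,
-- where F^q for a series F with constant term 1 means exp(q · log F), so that
-- (sqrt F)^q = exp((q/2) · log F)
closedForm : Series
closedForm =
  expS (Qv *S Z *S (Y -S oneS)) *S
  expS ((recip (ℕ→ℚ 2) ·S Qv) *S
        logS ((X -S oneS) *S invS (X -S expS (ℕ→ℚ 2 ·S Z *S (X -S oneS)))))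

{-# OPTIONS --safe #-}

-- Inserting two copies of n + 1 into an element of 𝒬_n^2, either as a new cycle or after one of
-- the 2n entries of an existing cycle, gives every element of 𝒬_{n+1}^2 exactly once. With the
-- weight x^cap y^fix q^cyc this is P_{n+1} = (2nx + qy) P_n + L P_n for the derivation
-- L = 2x(1 - x) ∂/∂x + 2x(1 - y) ∂/∂y, and inserting m + 1 into a permutation of [m] gives, for
-- B_m = 2^m A_m, likewise B_{m+1} = (2 + 2mx) B_m + L B_m. The convolution formula follows by
-- induction on n, applying L to it.
--
-- For the generating function F, the recurrence says Δ F = qy F with the derivation
-- Δ = (1 - 2xz) ∂/∂z - L, which determines F from its value 1 at z = 0. The closed form satisfies
-- the same equation: Δ sends 2z(x - 1) to 2(x - 1), hence U = (x - 1) / (x - e^{2z(x-1)}) to 2U,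
-- and it sends qz(y - 1) + (q/2) log U to q(y - 1) + q = qy.
module Submission where

open import Algebra.Bundles using (CommutativeRing)
open import Algebra.Solver.Ring.AlmostCommutativeRing using
  (_-Raw-AlmostCommutative⟶_; fromCommutativeRing)
open import Data.Empty using (⊥)
open import Data.List using
  (List; []; _∷_; _++_; map; concat; foldr; length; filter; upTo; [_]; lookup; deduplicate)
open import Data.List.Membership.Propositional using (_∈_; _∉_)
open import Data.List.Membership.Propositional.Properties using
  (∈-map⁻; ∈-map⁺; ∈-∃++; ∈-concat⁺′; ∈-concat⁻′; ∈-lookup; ∈-filter⁺; ∈-filter⁻; ∈-deduplicate⁺;
   ∈-deduplicate⁻; ∈-++⁺ˡ; ∈-++⁺ʳ; ∈-++⁻)
open import Data.List.Membership.Propositional.Properties.WithK using (unique∧set⇒bag)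
open import Data.List.Properties using
  (length-++; map-++; filter-all; filter-accept; filter-reject; filter-none; filter-++; upTo-∷ʳ;
   ∷-injectiveˡ; ∷-injectiveʳ; length-map; length-upTo; map-cong; map-cong-local; map-upTo;
   map-∘; ++-identityʳ; concat-++)
open import Data.List.Relation.Binary.BagAndSetEquality using (∼bag⇒↭)
open import Data.List.Relation.Binary.Disjoint.Propositional using (Disjoint)
open import Data.List.Relation.Binary.Permutation.Propositional as Perm using
  (_↭_; ↭-sym; ↭-trans; ↭-refl; ↭-reflexive; prep)
open import Data.List.Relation.Unary.All as All using (All; []; _∷_)
open import Data.List.Relation.Unary.AllPairs as AllPairs using (AllPairs; []; _∷_)
open import Data.List.Relation.Unary.Any using (here; there; index)
open import Data.List.Relation.Unary.Unique.Propositional using (Unique)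
open import Data.Nat as ℕ using (ℕ; zero; suc; _!; _∸_; _<_; z≤n; s≤s; _≤_; _<?_; z<s)
open import Data.Product using (_,_; _×_; ∃-syntax; proj₁; proj₂)
open import Data.Rational as ℚ using (ℚ; 0ℚ; 1ℚ)
open import Data.Sum using (inj₁; inj₂; _⊎_)
open import Function using (_∘_; mk⇔)
open import Level using (0ℓ)
open import Relation.Nullary using (yes; no; contradiction; ¬_; ¬?; Dec)
import Algebra.Solver.Ring
import Data.Fin.Properties as Fin
import Data.Integer.Properties as ℤ
import Data.List.Relation.Unary.All.Properties as All
import Data.List.Relation.Unary.AllPairs.Properties as AllPairs
import Data.List.Relation.Unary.Unique.Propositional.Properties as Unique
import Data.Maybe as Maybe
import Data.Nat.Properties as ℕ
import Data.Rational.Properties as ℚ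
import Data.Rational.Unnormalised as ℚᵘ
import Data.Rational.Unnormalised.Properties as ℚᵘ
import Relation.Binary.PropositionalEquality as ≡

-- The shape of `L` is dictated by the insertions. In a cycle with k ascent plateaus, 2k of the gaps
-- after an entry belong to a plateau and preserve their number, every other gap raises it by one.
-- So a cycle of length l and weight x^k contributes l x^(k+1) + 2k(1 - x) x^k, and the correction
-- is 2x(1 - x) times the derivative of x^k. A cycle `a a` trades its factor y for x in both gaps,
-- which accounts for 2x(1 - y). The factor 2^m in B_m doubles the Eulerian correction x(1 - x), so
-- that one derivation serves both sequences; the coefficients 2kx and 2(n - k)x then add up to 2nx
-- in every term of the convolution, which is why `L` acts well on the whole sum. For the closed
-- form, the obstacle is that exp, log and the inverse are sums whose cut-off depends on the
-- coefficient asked for, so that no ring law applies to them directly. Up to a given total degree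
-- they agree with finite sums, and `Δ` may be applied to these because it costs at most one degree
-- of agreement.

module Rationals where
  open import Defs
  open import Data.Integer as ℤ using (ℤ; +_)
  open import Relation.Binary.PropositionalEquality

  -- Normalising `+ n / 1` involves a gcd; in the unnormalised rationals the equation is a mere
  -- cross-multiplication.
  ℕ→ℚ-+ : ∀ m n → ℕ→ℚ (m ℕ.+ n) ≡ ℕ→ℚ m ℚ.+ ℕ→ℚ n
  ℕ→ℚ-+ m n = ℚ.toℚᵘ-injective (begin
    ℚ.toℚᵘ (ℕ→ℚ (m ℕ.+ n))                   ≈⟨ ℚ.toℚᵘ-fromℚᵘ (ℚᵘ.mkℚᵘ (+ (m ℕ.+ n)) 0) ⟩
    ℚᵘ.mkℚᵘ (+ (m ℕ.+ n)) 0                   ≈⟨ ℚᵘ.*≡* (cong (ℤ._* + 1) (sym (cong₂ ℤ._+_ (ℤ.*-identityʳ (+ m)) (ℤ.*-identityʳ (+ n))))) ⟩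
    ℚᵘ.mkℚᵘ (+ m) 0 ℚᵘ.+ ℚᵘ.mkℚᵘ (+ n) 0      ≈⟨ ℚᵘ.+-cong (ℚ.toℚᵘ-fromℚᵘ (ℚᵘ.mkℚᵘ (+ m) 0)) (ℚ.toℚᵘ-fromℚᵘ (ℚᵘ.mkℚᵘ (+ n) 0)) ⟨
    ℚ.toℚᵘ (ℕ→ℚ m) ℚᵘ.+ ℚ.toℚᵘ (ℕ→ℚ n)        ≈⟨ ℚ.toℚᵘ-homo-+ (ℕ→ℚ m) (ℕ→ℚ n) ⟨
    ℚ.toℚᵘ (ℕ→ℚ m ℚ.+ ℕ→ℚ n)                  ∎)
    where open ℚᵘ.≃-Reasoning

  ℕ→ℚ-* : ∀ m n → ℕ→ℚ (m ℕ.* n) ≡ ℕ→ℚ m ℚ.* ℕ→ℚ n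
  ℕ→ℚ-* zero    n = sym (ℚ.*-zeroˡ (ℕ→ℚ n))
  ℕ→ℚ-* (suc m) n = begin
    ℕ→ℚ (n ℕ.+ m ℕ.* n)                    ≡⟨ ℕ→ℚ-+ n (m ℕ.* n) ⟩
    ℕ→ℚ n ℚ.+ ℕ→ℚ (m ℕ.* n)                ≡⟨ cong₂ ℚ._+_ (ℚ.*-identityˡ (ℕ→ℚ n)) (sym (ℕ→ℚ-* m n)) ⟨
    1ℚ ℚ.* ℕ→ℚ n ℚ.+ ℕ→ℚ m ℚ.* ℕ→ℚ n       ≡⟨ ℚ.*-distribʳ-+ (ℕ→ℚ n) 1ℚ (ℕ→ℚ m) ⟨
    (1ℚ ℚ.+ ℕ→ℚ m) ℚ.* ℕ→ℚ n               ≡⟨ cong (ℚ._* ℕ→ℚ n) (ℕ→ℚ-+ 1 m) ⟨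
    ℕ→ℚ (suc m) ℚ.* ℕ→ℚ n                  ∎
    where open ≡-Reasoning

  ℕ→ℚ-suc≢0 : ∀ n → ℕ→ℚ (suc n) ≢ 0ℚ
  ℕ→ℚ-suc≢0 n eq with ℚᵘ.≃-trans (ℚᵘ.≃-sym (ℚ.toℚᵘ-fromℚᵘ (ℚᵘ.mkℚᵘ (+ suc n) 0))) (ℚᵘ.≃-reflexive (cong ℚ.toℚᵘ eq))
  ... | ℚᵘ.*≡* ()

  recip-inverse : ∀ p → p ≢ 0ℚ → recip p ℚ.* p ≡ 1ℚ
  recip-inverse p p≢0 with p ℚ.≟ 0ℚ
  ... | yes p≡0  = contradiction p≡0 p≢0
  ... | no p≢0′ = ℚ.*-inverseˡ p {{ℚ.≢-nonZero p≢0′}}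

  !≢0 : ∀ n → ℕ→ℚ (n !) ≢ 0ℚ
  !≢0 n p with n ! | ℕ.≢-nonZero⁻¹ (n !) {{n ℕ.!≢0}}
  ... | zero  | 0≢0 = 0≢0 refl
  ... | suc m | _   = ℕ→ℚ-suc≢0 m p

  -- This is the cancellation in d/dz of z^(n+1)/(n+1)!, to which the derivatives of the exponential
  -- series and of the generating function both come down.
  recip-! : ∀ n → recip (ℕ→ℚ (suc n !)) ℚ.* ℕ→ℚ (suc n) ≡ recip (ℕ→ℚ (n !))
  recip-! n = begin
    u ℚ.* ℕ→ℚ (suc n)                                ≡⟨ ℚ.*-identityʳ _ ⟨
    u ℚ.* ℕ→ℚ (suc n) ℚ.* 1ℚ                         ≡⟨ cong (u ℚ.* ℕ→ℚ (suc n) ℚ.*_) (trans (ℚ.*-comm (ℕ→ℚ (n !)) v) (recip-inverse _ (!≢0 n))) ⟨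
    u ℚ.* ℕ→ℚ (suc n) ℚ.* (ℕ→ℚ (n !) ℚ.* v)          ≡⟨ ℚ.*-assoc (u ℚ.* ℕ→ℚ (suc n)) (ℕ→ℚ (n !)) v ⟨
    u ℚ.* ℕ→ℚ (suc n) ℚ.* ℕ→ℚ (n !) ℚ.* v            ≡⟨ cong (ℚ._* v) (trans (ℚ.*-assoc u _ _) (cong (u ℚ.*_) (sym (ℕ→ℚ-* (suc n) (n !))))) ⟩
    u ℚ.* ℕ→ℚ (suc n !) ℚ.* v                        ≡⟨ cong (ℚ._* v) (recip-inverse _ (!≢0 (suc n))) ⟩
    1ℚ ℚ.* v                                         ≡⟨ ℚ.*-identityˡ v ⟩
    v                                                ∎
    where
    open ≡-Reasoning
    u = recip (ℕ→ℚ (suc n !))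
    v = recip (ℕ→ℚ (n !))

-- Finite sums and derivations in a commutative ring over the rationals.

module RationalAlgebras where
  open import Defs using (ℕ→ℚ)
  open Rationals
  open import Relation.Nullary.Decidable using (dec⇒maybe)
  open ≡ using (_≡_)

  ℚ-coefficients = CommutativeRing.rawRing ℚ.+-*-commutativeRing

  -- The ring stays abstract so that the insertion arguments see only ring laws and never the
  -- coefficients of a series, while the ring solver is available with rational constants.
  module ℚ-Algebra (R : CommutativeRing 0ℓ 0ℓ)
    (κ : ℚ-coefficients -Raw-AlmostCommutative⟶ fromCommutativeRing R) where

    open CommutativeRing R public
    open _-Raw-AlmostCommutative⟶_ κ public renaming (⟦_⟧ to ⟪_⟫)
    open import Relation.Binary.Reasoning.Setoid setoid public
    open import Algebra.Properties.CommutativeSemigroup +-commutativeSemigroup using (x∙yz≈y∙xz; interchange)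

    module Solver = Algebra.Solver.Ring ℚ-coefficients (fromCommutativeRing R) κ
      (λ p q → Maybe.map (λ p≡q → reflexive (≡.cong ⟪_⟫ p≡q)) (dec⇒maybe (p ℚ.≟ q)))
    open Solver public using (solve; _:=_; con; _:+_; _:*_; :-_; _:-_)

    ι : ℕ → Carrier
    ι n = ⟪ ℕ→ℚ n ⟫

    -- In the solver `1′` denotes `⟪ 1ℚ ⟫`, which is only equivalent to `1#`; this is why many calls
    -- of the solver are surrounded by conversions with `1-homo`.
    1′ 2′ : ∀ {n} → Solver.Polynomial n
    1′ = con 1ℚ
    2′ = con (ℕ→ℚ 2)

    ι-+ : ∀ m n → ι (m ℕ.+ n) ≈ ι m + ι n
    ι-+ m n = trans (reflexive (≡.cong ⟪_⟫ (ℕ→ℚ-+ m n))) (+-homo _ _)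

    ι-* : ∀ m n → ι (m ℕ.* n) ≈ ι m * ι n
    ι-* m n = trans (reflexive (≡.cong ⟪_⟫ (ℕ→ℚ-* m n))) (*-homo _ _)

    ι-suc : ∀ n → ι (suc n) ≈ ⟪ 1ℚ ⟫ + ι n
    ι-suc = ι-+ 1

    ≡⇒≈ : {A : Set} (f : A → Carrier) {a b : A} → a ≡ b → f a ≈ f b
    ≡⇒≈ f p = reflexive (≡.cong f p)

    ∑ : {A : Set} → List A → (A → Carrier) → Carrier
    ∑ xs f = foldr (λ a acc → f a + acc) 0# xs

    ∑-cong : {A : Set} {f g : A → Carrier} (xs : List A) → (∀ a → a ∈ xs → f a ≈ g a) → ∑ xs f ≈ ∑ xs g
    ∑-cong []       f≗g = refl
    ∑-cong (a ∷ xs) f≗g = +-cong (f≗g a (here ≡.refl)) (∑-cong xs (λ b b∈ → f≗g b (there b∈)))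

    ∑-map : {A B : Set} (g : A → B) (f : B → Carrier) (xs : List A) → ∑ (map g xs) f ≈ ∑ xs (λ a → f (g a))
    ∑-map g f []       = refl
    ∑-map g f (a ∷ xs) = +-congˡ (∑-map g f xs)

    ∑-++ : {A : Set} (f : A → Carrier) (xs ys : List A) → ∑ (xs ++ ys) f ≈ ∑ xs f + ∑ ys f
    ∑-++ f []       ys = sym (+-identityˡ _)
    ∑-++ f (a ∷ xs) ys = trans (+-congˡ (∑-++ f xs ys)) (sym (+-assoc _ _ _))

    ∑-concat : {A : Set} (f : A → Carrier) (xss : List (List A)) → ∑ (concat xss) f ≈ ∑ xss (λ xs → ∑ xs f)
    ∑-concat f []         = refl
    ∑-concat f (xs ∷ xss) = trans (∑-++ f xs (concat xss)) (+-congˡ (∑-concat f xss))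

    ∑-↭ : {A : Set} (f : A → Carrier) {xs ys : List A} → xs ↭ ys → ∑ xs f ≈ ∑ ys f
    ∑-↭ f Perm.refl         = refl
    ∑-↭ f (Perm.prep a p)   = +-congˡ (∑-↭ f p)
    ∑-↭ f (Perm.swap a b p) = trans (+-congˡ (+-congˡ (∑-↭ f p))) (x∙yz≈y∙xz _ _ _)
    ∑-↭ f (Perm.trans p q)  = trans (∑-↭ f p) (∑-↭ f q)

    ∑-*ˡ : {A : Set} (r : Carrier) (f : A → Carrier) (xs : List A) → ∑ xs (λ a → r * f a) ≈ r * ∑ xs f
    ∑-*ˡ r f []       = sym (zeroʳ r)
    ∑-*ˡ r f (a ∷ xs) = trans (+-congˡ (∑-*ˡ r f xs)) (sym (distribˡ _ _ _))

    pow : Carrier → ℕ → Carrier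
    pow x zero    = 1#
    pow x (suc n) = x * pow x n

    +-moveʳ : ∀ {x y z} → x + y ≈ z → x ≈ z - y
    +-moveʳ {x} {y} {z} x+y≈z = trans (solve 2 (λ x y → x := x :+ y :- y) refl x y) (+-congʳ x+y≈z)

    ∑-+ : {A : Set} (f g : A → Carrier) (xs : List A) → ∑ xs (λ a → f a + g a) ≈ ∑ xs f + ∑ xs g
    ∑-+ f g []       = sym (+-identityˡ 0#)
    ∑-+ f g (a ∷ xs) = trans (+-congˡ (∑-+ f g xs)) (interchange _ _ _ _)

    ∑< : ℕ → (ℕ → Carrier) → Carrier
    ∑< zero    f = 0#
    ∑< (suc n) f = ∑< n f + f n

    ∑<-cong : ∀ n {f g : ℕ → Carrier} → (∀ k → k ℕ.< n → f k ≈ g k) → ∑< n f ≈ ∑< n g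
    ∑<-cong zero    f≗g = refl
    ∑<-cong (suc n) f≗g = +-cong (∑<-cong n (λ k k<n → f≗g k (ℕ.m<n⇒m<1+n k<n))) (f≗g n (ℕ.n<1+n n))

    ∑<-+ : ∀ n (f g : ℕ → Carrier) → ∑< n (λ k → f k + g k) ≈ ∑< n f + ∑< n g
    ∑<-+ zero    f g = sym (+-identityˡ 0#)
    ∑<-+ (suc n) f g = trans (+-congʳ (∑<-+ n f g)) (interchange _ _ _ _)

    ∑<-*ˡ : ∀ n r (f : ℕ → Carrier) → ∑< n (λ k → r * f k) ≈ r * ∑< n f
    ∑<-*ˡ zero    r f = sym (zeroʳ r)
    ∑<-*ˡ (suc n) r f = trans (+-congʳ (∑<-*ˡ n r f)) (sym (distribˡ _ _ _))

    ∑<-head : ∀ n (f : ℕ → Carrier) → ∑< (suc n) f ≈ f 0 + ∑< n (λ k → f (suc k))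
    ∑<-head zero    f = +-comm _ _
    ∑<-head (suc n) f = trans (+-congʳ (∑<-head n f)) (+-assoc _ _ _)

    record IsDerivation (D : Carrier → Carrier) : Set where
      field
        D-cong  : ∀ {x y} → x ≈ y → D x ≈ D y
        D-+     : ∀ x y → D (x + y) ≈ D x + D y
        leibniz : ∀ x y → D (x * y) ≈ D x * y + x * D y
        D-con   : ∀ r → D ⟪ r ⟫ ≈ 0#

      D-con* : ∀ r x → D (⟪ r ⟫ * x) ≈ ⟪ r ⟫ * D x
      D-con* r x = begin
        D (⟪ r ⟫ * x)                ≈⟨ leibniz _ _ ⟩
        D ⟪ r ⟫ * x + ⟪ r ⟫ * D x    ≈⟨ +-congʳ (*-congʳ (D-con r)) ⟩
        0# * x + ⟪ r ⟫ * D x         ≈⟨ +-congʳ (zeroˡ x) ⟩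
        0# + ⟪ r ⟫ * D x             ≈⟨ +-identityˡ _ ⟩
        ⟪ r ⟫ * D x                  ∎

      D-1 : D 1# ≈ 0#
      D-1 = trans (D-cong (sym 1-homo)) (D-con 1ℚ)

      D-0 : D 0# ≈ 0#
      D-0 = trans (D-cong (sym 0-homo)) (D-con 0ℚ)

      D-neg : ∀ x → D (- x) ≈ - D x
      D-neg x = begin
        D (- x)              ≈⟨ D-cong (solve 1 (λ x → :- x := con (ℚ.- 1ℚ) :* x) refl x) ⟩
        D (⟪ ℚ.- 1ℚ ⟫ * x)   ≈⟨ D-con* (ℚ.- 1ℚ) x ⟩
        ⟪ ℚ.- 1ℚ ⟫ * D x     ≈⟨ solve 1 (λ x → con (ℚ.- 1ℚ) :* x := :- x) refl (D x) ⟩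
        - D x                ∎

      D-minus : ∀ x y → D (x - y) ≈ D x - D y
      D-minus x y = trans (D-+ x (- y)) (+-congˡ (D-neg y))

      D-∑ : {A : Set} (f : A → Carrier) (xs : List A) → D (∑ xs f) ≈ ∑ xs (λ a → D (f a))
      D-∑ f []       = D-0
      D-∑ f (a ∷ xs) = trans (D-+ _ _) (+-congˡ (D-∑ f xs))

      D-∑< : ∀ n (f : ℕ → Carrier) → D (∑< n f) ≈ ∑< n (λ k → D (f k))
      D-∑< zero    f = D-0
      D-∑< (suc n) f = trans (D-+ _ _) (+-congʳ (D-∑< n f))

      D-pow : ∀ n x → D (pow x (suc n)) ≈ ι (suc n) * pow x n * D x
      D-pow zero x = begin
        D (x * 1#)                 ≈⟨ D-cong (*-identityʳ x) ⟩
        D x                        ≈⟨ *-identityˡ (D x) ⟨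
        1# * D x                   ≈⟨ *-congʳ (trans (*-congʳ 1-homo) (*-identityˡ 1#)) ⟨
        ι 1 * 1# * D x             ∎
      D-pow (suc n) x = begin
        D (x * pow x (suc n))
          ≈⟨ leibniz _ _ ⟩
        D x * pow x (suc n) + x * D (pow x (suc n))
          ≈⟨ +-congˡ (*-congˡ (D-pow n x)) ⟩
        D x * (x * pow x n) + x * (ι (suc n) * pow x n * D x)
          ≈⟨ solve 4 (λ x d p i → d :* (x :* p) :+ x :* (i :* p :* d) := (1′ :+ i) :* (x :* p) :* d) refl _ _ _ _ ⟩
        (⟪ 1ℚ ⟫ + ι (suc n)) * (x * pow x n) * D x
          ≈⟨ *-congʳ (*-congʳ (ι-suc (suc n))) ⟨
        ι (suc (suc n)) * pow x (suc n) * D x ∎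

      -- Here `e` is the logarithmic derivative of `x`. Working with it avoids the exponent n - 1,
      -- so the rule is uniform in n and returns a multiple of `pow x n` itself.
      D-pow-log : ∀ {x e} → D x ≈ x * e → ∀ n → D (pow x n) ≈ ι n * e * pow x n
      D-pow-log {x} {e} Dx zero    = trans D-1 (sym (trans (*-congʳ (trans (*-congʳ 0-homo) (zeroˡ e))) (zeroˡ 1#)))
      D-pow-log {x} {e} Dx (suc n) = begin
        D (pow x (suc n))                  ≈⟨ D-pow n x ⟩
        ι (suc n) * pow x n * D x          ≈⟨ *-congˡ Dx ⟩
        ι (suc n) * pow x n * (x * e)      ≈⟨ solve 4 (λ i p x e → i :* p :* (x :* e) := i :* e :* (x :* p)) refl _ _ _ _ ⟩
        ι (suc n) * e * pow x (suc n)      ∎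

-- Iterated power series in one variable.

module PowerSeries where
  open import Defs renaming (_≈_ to _≈S_)
  open ≡ using (_≡_)

  sumTo-cong : ∀ n {f g : ℕ → ℚ} → (∀ i → i ℕ.≤ n → f i ≡ g i) → sumTo n f ≡ sumTo n g
  sumTo-cong zero    f≗g = f≗g 0 ℕ.z≤n
  sumTo-cong (suc n) f≗g = ≡.cong₂ ℚ._+_ (sumTo-cong n (λ i i≤n → f≗g i (ℕ.m≤n⇒m≤1+n i≤n))) (f≗g (suc n) ℕ.≤-refl)
    where import Data.Nat.Properties as ℕ

  sumTo-head : ∀ n (f : ℕ → ℚ) → sumTo (suc n) f ≡ f 0 ℚ.+ sumTo n (f ∘ suc)
  sumTo-head zero    f = ≡.refl
  sumTo-head (suc n) f = ≡.trans (≡.cong (ℚ._+ f (suc (suc n))) (sumTo-head n f)) (ℚ.+-assoc (f 0) _ _)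

  -- Multiplication in four variables is a fourfold sum. Adjoining one variable at a time reduces
  -- its ring laws to those of a single convolution over an arbitrary ring.
  module PowerSeriesOver (R : CommutativeRing 0ℓ 0ℓ) where
    open CommutativeRing R
    open import Relation.Binary.Reasoning.Setoid setoid
    open import Algebra.Properties.CommutativeSemigroup +-commutativeSemigroup using (interchange; x∙yz≈y∙xz)

    -- Peeling off the leading coefficient of the first factor avoids truncated subtraction and
    -- makes the ring laws inductions on the index; `conv-sumTo` recovers the usual sum.
    conv : (ℕ → Carrier) → (ℕ → Carrier) → ℕ → Carrier
    conv f g zero    = f 0 * g 0
    conv f g (suc n) = f 0 * g (suc n) + conv (f ∘ suc) g n

    constant : Carrier → ℕ → Carrier
    constant r zero    = r
    constant r (suc _) = 0#

    conv-cong : ∀ n {f f′ g g′} → (∀ i → f i ≈ f′ i) → (∀ i → g i ≈ g′ i) → conv f g n ≈ conv f′ g′ n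
    conv-cong zero    p q = *-cong (p 0) (q 0)
    conv-cong (suc n) p q = +-cong (*-cong (p 0) (q (suc n))) (conv-cong n (p ∘ suc) q)

    -- The left side peels off `f 0`, the right side `g 0`, so both have to be peeled off before the
    -- sides can meet. The hypothesis is used at n + 1 to change the side that is peeled, and at n
    -- for the remainder.
    conv-comm : ∀ n f g → conv f g n ≈ conv g f n
    conv-comm zero          f g = *-comm _ _
    conv-comm (suc zero)    f g = begin
      f 0 * g 1 + f 1 * g 0  ≈⟨ +-cong (*-comm _ _) (*-comm _ _) ⟩
      g 1 * f 0 + g 0 * f 1  ≈⟨ +-comm _ _ ⟩
      g 0 * f 1 + g 1 * f 0  ∎
    conv-comm (suc (suc n)) f g = begin
      f 0 * g (2 ℕ.+ n) + conv (f ∘ suc) g (suc n)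
        ≈⟨ +-cong (*-comm _ _) (conv-comm (suc n) (f ∘ suc) g) ⟩
      g (2 ℕ.+ n) * f 0 + (g 0 * f (2 ℕ.+ n) + conv (g ∘ suc) (f ∘ suc) n)
        ≈⟨ x∙yz≈y∙xz _ _ _ ⟩
      g 0 * f (2 ℕ.+ n) + (g (2 ℕ.+ n) * f 0 + conv (g ∘ suc) (f ∘ suc) n)
        ≈⟨ +-congˡ (+-cong (*-comm _ _) (conv-comm n (g ∘ suc) (f ∘ suc))) ⟩
      g 0 * f (2 ℕ.+ n) + conv f (g ∘ suc) (suc n)
        ≈⟨ +-congˡ (conv-comm (suc n) f (g ∘ suc)) ⟩
      g 0 * f (2 ℕ.+ n) + conv (g ∘ suc) f (suc n) ∎

    conv-distribʳ : ∀ n f g h → conv (λ i → g i + h i) f n ≈ conv g f n + conv h f n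
    conv-distribʳ zero    f g h = distribʳ _ _ _
    conv-distribʳ (suc n) f g h = trans (+-cong (distribʳ _ _ _) (conv-distribʳ n f (g ∘ suc) (h ∘ suc))) (interchange _ _ _ _)

    conv-scale : ∀ n r g h → conv (λ i → r * g i) h n ≈ r * conv g h n
    conv-scale zero    r g h = *-assoc _ _ _
    conv-scale (suc n) r g h = trans (+-cong (*-assoc _ _ _) (conv-scale n r (g ∘ suc) h)) (sym (distribˡ _ _ _))

    conv-assoc : ∀ n f g h → conv (conv f g) h n ≈ conv f (conv g h) n
    conv-assoc zero    f g h = *-assoc _ _ _
    conv-assoc (suc n) f g h = begin
      f 0 * g 0 * h (suc n) + conv (λ i → f 0 * g (suc i) + conv (f ∘ suc) g i) h n
        ≈⟨ +-cong (*-assoc _ _ _) (conv-distribʳ n h _ _) ⟩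
      f 0 * (g 0 * h (suc n)) + (conv (λ i → f 0 * g (suc i)) h n + conv (conv (f ∘ suc) g) h n)
        ≈⟨ +-congˡ (+-cong (conv-scale n (f 0) (g ∘ suc) h) (conv-assoc n (f ∘ suc) g h)) ⟩
      f 0 * (g 0 * h (suc n)) + (f 0 * conv (g ∘ suc) h n + conv (f ∘ suc) (conv g h) n)
        ≈⟨ +-assoc _ _ _ ⟨
      f 0 * (g 0 * h (suc n)) + f 0 * conv (g ∘ suc) h n + conv (f ∘ suc) (conv g h) n
        ≈⟨ +-congʳ (distribˡ _ _ _) ⟨
      f 0 * conv g h (suc n) + conv (f ∘ suc) (conv g h) n ∎

    conv-zeroˡ : ∀ n g → conv (λ _ → 0#) g n ≈ 0#
    conv-zeroˡ zero    g = zeroˡ _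
    conv-zeroˡ (suc n) g = trans (+-cong (zeroˡ _) (conv-zeroˡ n g)) (+-identityʳ 0#)

    conv-constantˡ : ∀ n r g → conv (constant r) g n ≈ r * g n
    conv-constantˡ zero    r g = refl
    conv-constantˡ (suc n) r g = trans (+-congˡ (conv-zeroˡ n g)) (+-identityʳ _)

    conv-identityˡ : ∀ n g → conv (constant 1#) g n ≈ g n
    conv-identityˡ n g = trans (conv-constantˡ n 1# g) (*-identityˡ (g n))

    variable-series : ℕ → Carrier
    variable-series zero          = 0#
    variable-series (suc zero)    = 1#
    variable-series (suc (suc _)) = 0#

    conv-variable-zero : ∀ g → conv variable-series g 0 ≈ 0#
    conv-variable-zero g = zeroˡ _

    conv-variable-suc : ∀ n g → conv variable-series g (suc n) ≈ g n
    conv-variable-suc n g = trans (+-cong (zeroˡ _) (trans (conv-cong n tail (λ _ → refl)) (conv-identityˡ n g))) (+-identityˡ _)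
      where
      tail : ∀ i → variable-series (suc i) ≈ constant 1# i
      tail zero    = refl
      tail (suc _) = refl

    powerSeriesRing : CommutativeRing 0ℓ 0ℓ
    powerSeriesRing = record
      { Carrier = ℕ → Carrier
      ; _≈_ = λ f g → ∀ n → f n ≈ g n
      ; _+_ = λ f g n → f n + g n
      ; _*_ = conv
      ; -_ = λ f n → - f n
      ; 0# = λ _ → 0#
      ; 1# = constant 1#
      ; isCommutativeRing = record
        { isRing = record
          { +-isAbelianGroup = record
            { isGroup = record
              { isMonoid = record
                { isSemigroup = record
                  { isMagma = record
                    { isEquivalence = record
                      { refl = λ n → refl
                      ; sym = λ p n → sym (p n)
                      ; trans = λ p q n → trans (p n) (q n) }
                    ; ∙-cong = λ p q n → +-cong (p n) (q n) }
                  ; assoc = λ f g h n → +-assoc (f n) (g n) (h n) }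
                ; identity = (λ f n → +-identityˡ (f n)) , (λ f n → +-identityʳ (f n)) }
              ; inverse = (λ f n → -‿inverseˡ (f n)) , (λ f n → -‿inverseʳ (f n))
              ; ⁻¹-cong = λ p n → -‿cong (p n) }
            ; comm = λ f g n → +-comm (f n) (g n) }
          ; *-cong = λ p q n → conv-cong n p q
          ; *-assoc = λ f g h n → conv-assoc n f g h
          ; *-identity = (λ f n → conv-identityˡ n f) , (λ f n → trans (conv-comm n f _) (conv-identityˡ n f))
          ; distrib = (λ f g h n → trans (conv-comm n f _)
                        (trans (conv-distribʳ n f g h) (+-cong (conv-comm n g f) (conv-comm n h f))))
                    , (λ f g h n → conv-distribʳ n f g h) }
        ; *-comm = λ f g n → conv-comm n f g } }

    module _ (φ : Carrier → ℚ) (φ-+ : ∀ r s → φ (r + s) ≡ φ r ℚ.+ φ s) where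

      -- The map `φ` reads off the remaining exponents down to ℚ, which lets one statement serve at
      -- each of the four levels.
      conv-sumTo : ∀ n f g → φ (conv f g n) ≡ sumTo n (λ i → φ (f i * g (n ∸ i)))
      conv-sumTo zero    f g = ≡.refl
      conv-sumTo (suc n) f g = ≡.trans (φ-+ _ _)
        (≡.trans (≡.cong (φ (f 0 * g (suc n)) ℚ.+_) (conv-sumTo n (f ∘ suc) g))
          (≡.sym (sumTo-head n (λ i → φ (f i * g (suc n ∸ i))))))

  module PS₁ = PowerSeriesOver ℚ.+-*-commutativeRing
  module PS₂ = PowerSeriesOver PS₁.powerSeriesRing
  module PS₃ = PowerSeriesOver PS₂.powerSeriesRing
  module PS₄ = PowerSeriesOver PS₃.powerSeriesRing

  conv-*S : ∀ f g → PS₄.conv f g ≈S f *S g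
  conv-*S f g a b c d = ≡.trans (PS₄.conv-sumTo (λ r → r b c d) (λ _ _ → ≡.refl) a f g)
    (sumTo-cong a λ i _ → ≡.trans (PS₃.conv-sumTo (λ r → r c d) (λ _ _ → ≡.refl) b (f i) (g (a ∸ i)))
    (sumTo-cong b λ j _ → ≡.trans (PS₂.conv-sumTo (λ r → r d) (λ _ _ → ≡.refl) c (f i j) (g (a ∸ i) (b ∸ j)))
    (sumTo-cong c λ k _ → PS₁.conv-sumTo (λ r → r) (λ _ _ → ≡.refl) d (f i j k) (g (a ∸ i) (b ∸ j) (c ∸ k)))))

-- The commutative ring of series in x, y, q, z.

module SeriesRing where
  open import Defs renaming (_≈_ to _≈S_)
  open PowerSeries
  open RationalAlgebras
  open ≡ using (_≡_)

  -- The record keeps f and g recoverable by unification, which fails for the bare pointwise equality.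
  infix 4 _≋_
  record _≋_ (f g : Series) : Set where
    constructor pointwise
    field at : f ≈S g
  open _≋_ public

  -S_ : Series → Series
  (-S f) a b c d = ℚ.- f a b c d

  private
    module 𝔸 = CommutativeRing PS₄.powerSeriesRing

    oneS-constant : oneS ≈S 𝔸.1#
    oneS-constant zero    zero    zero    zero    = ≡.refl
    oneS-constant zero    zero    zero    (suc _) = ≡.refl
    oneS-constant zero    zero    (suc _) d       = ≡.refl
    oneS-constant zero    (suc _) c       d       = ≡.refl
    oneS-constant (suc _) b       c       d       = ≡.refl

    infixr 4 _∙_
    _∙_ : ∀ {f g h} → f ≈S g → g ≈S h → f ≈S h
    (p ∙ q) a b c d = ≡.trans (p a b c d) (q a b c d)

    inv : ∀ {f g} → f ≈S g → g ≈S f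
    inv p a b c d = ≡.sym (p a b c d)

    _⟨*⟩_ : ∀ {f f′ g g′} → f ≈S f′ → g ≈S g′ → PS₄.conv f g ≈S PS₄.conv f′ g′
    _⟨*⟩_ {f} {f′} {g} {g′} p q = 𝔸.*-cong {f} {f′} {g} {g′} p q

    rf : ∀ {f} → f ≈S f
    rf _ _ _ _ = ≡.refl

    tofrom : ∀ f g → f *S g ≈S PS₄.conv f g
    tofrom f g = inv (conv-*S f g)

    cong* : ∀ {f f′ g g′} → f ≈S f′ → g ≈S g′ → f *S g ≈S f′ *S g′
    cong* {f} {f′} {g} {g′} p q = tofrom f g ∙ (p ⟨*⟩ q) ∙ conv-*S f′ g′

    assoc* : ∀ f g h → f *S g *S h ≈S f *S (g *S h)
    assoc* f g h = cong* (tofrom f g) (rf {h}) ∙ tofrom (PS₄.conv f g) h ∙ 𝔸.*-assoc f g h ∙ conv-*S f (PS₄.conv g h) ∙ cong* (rf {f}) (conv-*S g h)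

    comm* : ∀ f g → f *S g ≈S g *S f
    comm* f g = tofrom f g ∙ 𝔸.*-comm f g ∙ conv-*S g f

    one* : ∀ f → oneS *S f ≈S f
    one* f = cong* oneS-constant (rf {f}) ∙ tofrom 𝔸.1# f ∙ 𝔸.*-identityˡ f

    distr* : ∀ f g h → (g +S h) *S f ≈S g *S f +S h *S f
    distr* f g h = tofrom (g +S h) f ∙ 𝔸.distribʳ f g h ∙ λ a b c d → ≡.cong₂ ℚ._+_ (conv-*S g f a b c d) (conv-*S h f a b c d)

  seriesRing : CommutativeRing 0ℓ 0ℓ
  seriesRing = record
    { Carrier = Series
    ; _≈_ = _≋_
    ; _+_ = _+S_
    ; _*_ = _*S_
    ; -_ = -S_
    ; 0# = zeroS
    ; 1# = oneS
    ; isCommutativeRing = record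
      { isRing = record
        { +-isAbelianGroup = record
          { isGroup = record
            { isMonoid = record
              { isSemigroup = record
                { isMagma = record
                  { isEquivalence = record
                    { refl = pointwise rf
                    ; sym = λ p → pointwise (inv (at p))
                    ; trans = λ p q → pointwise (at p ∙ at q) }
                  ; ∙-cong = λ p q → pointwise λ a b c d → ≡.cong₂ ℚ._+_ (at p a b c d) (at q a b c d) }
                ; assoc = λ f g h → pointwise (𝔸.+-assoc f g h) }
              ; identity = (λ f → pointwise (𝔸.+-identityˡ f)) , (λ f → pointwise (𝔸.+-identityʳ f)) }
            ; inverse = (λ f → pointwise (𝔸.-‿inverseˡ f)) , (λ f → pointwise (𝔸.-‿inverseʳ f))
            ; ⁻¹-cong = λ p → pointwise λ a b c d → ≡.cong ℚ.-_ (at p a b c d) }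
          ; comm = λ f g → pointwise (𝔸.+-comm f g) }
        ; *-cong = λ p q → pointwise (cong* (at p) (at q))
        ; *-assoc = λ f g h → pointwise (assoc* f g h)
        ; *-identity = (λ f → pointwise (one* f)) , (λ f → pointwise (comm* f oneS ∙ one* f))
        ; distrib = (λ f g h → pointwise (comm* f (g +S h) ∙ distr* f g h ∙
                      λ a b c d → ≡.cong₂ ℚ._+_ (comm* g f a b c d) (comm* h f a b c d)))
                  , (λ f g h → pointwise (distr* f g h)) }
      ; *-comm = λ f g → pointwise (comm* f g) } }

  sumTo-*ˡ : ∀ n r (f : ℕ → ℚ) → sumTo n (λ i → r ℚ.* f i) ≡ r ℚ.* sumTo n f
  sumTo-*ˡ zero    r f = ≡.refl
  sumTo-*ˡ (suc n) r f = ≡.trans (≡.cong (ℚ._+ r ℚ.* f (suc n)) (sumTo-*ˡ n r f)) (≡.sym (ℚ.*-distribˡ-+ r _ _))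

  ·S-*S : ∀ r f g → (r ·S f) *S g ≈S r ·S (f *S g)
  ·S-*S r f g a b c d =
    ≡.trans (sumTo-cong a λ i _ →
      ≡.trans (sumTo-cong b λ j _ →
        ≡.trans (sumTo-cong c λ k _ →
          ≡.trans (sumTo-cong d λ l _ → ℚ.*-assoc r (f i j k l) _)
                  (sumTo-*ˡ d r _))
                (sumTo-*ˡ c r _))
              (sumTo-*ˡ b r _))
            (sumTo-*ˡ a r _)

  -- Scalar multiples are opaque to the ring solver; as products with a constant series they become
  -- accessible to it and to derivations.
  constS-* : ∀ r f → constS r *S f ≋ r ·S f
  constS-* r f = pointwise λ a b c d → ≡.trans (·S-*S r oneS f a b c d) (≡.cong (r ℚ.*_) (one* f a b c d))

  constant-homomorphism : ℚ-coefficients -Raw-AlmostCommutative⟶ fromCommutativeRing seriesRing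
  constant-homomorphism = record
    { ⟦_⟧    = constS
    ; +-homo = λ p q → pointwise λ a b c d → ℚ.*-distribʳ-+ (oneS a b c d) p q
    ; *-homo = λ p q → CommutativeRing.sym seriesRing (CommutativeRing.trans seriesRing (constS-* p (constS q))
                 (pointwise λ a b c d → ≡.sym (ℚ.*-assoc p q (oneS a b c d))))
    ; -‿homo = λ p → pointwise λ a b c d → ≡.sym (ℚ.neg-distribˡ-* p _)
    ; 0-homo = pointwise λ a b c d → ℚ.*-zeroˡ (oneS a b c d)
    ; 1-homo = pointwise λ a b c d → ℚ.*-identityˡ (oneS a b c d) }

  module SA = ℚ-Algebra seriesRing constant-homomorphism

-- Insertion of letters into words and lists of cycles.

module Words where
  open import Defs using (capC; isFixC; plateauAt; descentAt)
  open import Relation.Binary.PropositionalEquality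
  open import Data.Nat using (_+_)

  -- The front is left out because a cycle starts with its smallest entry, so a new largest letter
  -- cannot go there. Permutations get the front back in `insertAnywhere`.
  insertAfter : List ℕ → List ℕ → List (List ℕ)
  insertAfter u []      = []
  insertAfter u (a ∷ w) = (a ∷ u ++ w) ∷ map (a ∷_) (insertAfter u w)

  insertAnywhere : List ℕ → List ℕ → List (List ℕ)
  insertAnywhere u w = (u ++ w) ∷ insertAfter u w

  plateauAt-≮ : ∀ {a b} c → b ℕ.≤ a → plateauAt a b c ≡ 0
  plateauAt-≮ {a} {b} c b≤a with a ℕ.<? b | b ℕ.≟ c
  ... | yes a<b | _ = contradiction a<b (ℕ.≤⇒≯ b≤a)
  ... | no _    | _ = refl

  plateauAt-≢ : ∀ a {b c} → b ≢ c → plateauAt a b c ≡ 0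
  plateauAt-≢ a {b} {c} b≢c with a ℕ.<? b | b ℕ.≟ c
  ... | yes _ | yes b≡c = contradiction b≡c b≢c
  ... | yes _ | no _    = refl
  ... | no _  | _       = refl

  plateauAt-yes : ∀ {a b} → a < b → plateauAt a b b ≡ 1
  plateauAt-yes {a} {b} a<b with a ℕ.<? b | b ℕ.≟ b
  ... | yes _ | yes _  = refl
  ... | yes _ | no b≢b = contradiction refl b≢b
  ... | no a≮b | _     = contradiction a<b a≮b

  data Plateau (a b c : ℕ) : Set where
    plateau    : a < b → b ≡ c → plateauAt a b c ≡ 1 → Plateau a b c
    no-plateau : plateauAt a b c ≡ 0 → Plateau a b c

  plateau? : ∀ a b c → Plateau a b c
  plateau? a b c with a ℕ.<? b | b ℕ.≟ c
  ... | yes a<b | yes refl = plateau a<b refl (plateauAt-yes a<b)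
  ... | yes _   | no b≢c   = no-plateau (plateauAt-≢ a b≢c)
  ... | no a≮b  | _        = no-plateau (plateauAt-≮ c (ℕ.≮⇒≥ a≮b))

  capC-∷-≥ : ∀ m w → All (_< m) w → capC (m ∷ w) ≡ capC w
  capC-∷-≥ m []          _         = refl
  capC-∷-≥ m (_ ∷ [])    _         = refl
  capC-∷-≥ m (a ∷ b ∷ w) (a<m ∷ _) = cong (_+ capC (a ∷ b ∷ w)) (plateauAt-≮ b (ℕ.<⇒≤ a<m))

  capC-mm : ∀ m w → All (_< m) w → capC (m ∷ m ∷ w) ≡ capC w
  capC-mm m []      _  = refl
  capC-mm m (a ∷ w) w< = trans (cong (_+ capC (m ∷ a ∷ w)) (plateauAt-≮ a ℕ.≤-refl)) (capC-∷-≥ m (a ∷ w) w<)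

  capC-amm : ∀ {a m} w → a < m → All (_< m) w → capC (a ∷ m ∷ m ∷ w) ≡ suc (capC w)
  capC-amm w a<m w< = cong₂ _+_ (plateauAt-yes a<m) (capC-mm _ w w<)

  capC-abmm : ∀ a {b m} w → b < m → All (_< m) w → capC (a ∷ b ∷ m ∷ m ∷ w) ≡ suc (capC w)
  capC-abmm a w b<m w< = cong₂ _+_ (plateauAt-≢ a (ℕ.<⇒≢ b<m)) (capC-amm w b<m w<)

  capC-repeat : ∀ {b c} w → b ≡ c → capC (b ∷ c ∷ w) ≡ capC (c ∷ w)
  capC-repeat     []      _    = refl
  capC-repeat {b} (c ∷ w) refl = cong (_+ capC (b ∷ c ∷ w)) (plateauAt-≮ c ℕ.≤-refl)

  descentAt-yes : ∀ {a b} → b < a → descentAt a b ≡ 1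
  descentAt-yes {a} {b} b<a with b ℕ.<? a
  ... | yes _  = refl
  ... | no b≮a = contradiction b<a b≮a

  descentAt-no : ∀ {a b} → a ℕ.≤ b → descentAt a b ≡ 0
  descentAt-no {a} {b} a≤b with b ℕ.<? a
  ... | yes b<a = contradiction b<a (ℕ.≤⇒≯ a≤b)
  ... | no _    = refl

  length-insertAfter : ∀ u w {v} → v ∈ insertAfter u w → length v ≡ length u + length w
  length-insertAfter u (a ∷ w) (here refl) = trans (cong suc (length-++ u)) (sym (ℕ.+-suc (length u) (length w)))
  length-insertAfter u (a ∷ w) (there v∈) with ∈-map⁻ (a ∷_) v∈
  ... | v′ , v′∈ , refl = trans (cong suc (length-insertAfter u w v′∈)) (sym (ℕ.+-suc (length u) (length w)))

  isFixC-length≢2 : ∀ w → length w ≢ 2 → isFixC w ≡ 0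
  isFixC-length≢2 []              _  = refl
  isFixC-length≢2 (_ ∷ [])        _  = refl
  isFixC-length≢2 (_ ∷ _ ∷ [])    ≢2 = contradiction refl ≢2
  isFixC-length≢2 (_ ∷ _ ∷ _ ∷ _) _  = refl

  isFixC-yes : ∀ a → isFixC (a ∷ a ∷ []) ≡ 1
  isFixC-yes a with a ℕ.≟ a
  ... | yes _  = refl
  ... | no a≢a = contradiction refl a≢a

  data CycleShape : List ℕ → Set where
    fixed     : ∀ a → CycleShape (a ∷ a ∷ [])
    not-fixed : ∀ {w} → isFixC w ≡ 0 → CycleShape w

  cycleShape : ∀ w → CycleShape w
  cycleShape []              = not-fixed refl
  cycleShape (_ ∷ [])        = not-fixed refl
  cycleShape (a ∷ b ∷ []) with a ℕ.≟ b in eq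
  ... | yes refl = fixed a
  ... | no _     = not-fixed (lemma eq)
    where
    lemma : ∀ {a≢b} → (a ℕ.≟ b) ≡ no a≢b → isFixC (a ∷ b ∷ []) ≡ 0
    lemma eq rewrite eq = refl
  cycleShape (_ ∷ _ ∷ _ ∷ _) = not-fixed refl

  modifyCycle : ℕ → List (List ℕ) → List (List (List ℕ))
  modifyCycle m []      = []
  modifyCycle m (c ∷ σ) = map (_∷ σ) (insertAfter (m ∷ m ∷ []) c) ++ map (c ∷_) (modifyCycle m σ)

  -- A new cycle has the largest first entry, so the standard order of cycles puts it at the end.
  extend : ℕ → List (List ℕ) → List (List (List ℕ))
  extend m σ = (σ ++ (m ∷ m ∷ []) ∷ []) ∷ modifyCycle m σ

-- The change of plateaus and descents under insertion.

module InsertionStatistics where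
  open import Defs using (capC; des)
  open RationalAlgebras
  open Words
  open ≡ using (_≡_)

  module InsertionSums (R : CommutativeRing 0ℓ 0ℓ)
    (κ : ℚ-coefficients -Raw-AlmostCommutative⟶ fromCommutativeRing R) where
    open ℚ-Algebra R κ

    -- Insertion never touches the front letter. Hence a plateau or descent formed with letters
    -- placed before it is the same for all words of the sum and can be evaluated in advance.
    ∑-insertAfter-∷ : ∀ u c w {F G : List ℕ → Carrier} → (∀ v → F (c ∷ v) ≈ G (c ∷ v)) →
      ∑ (insertAfter u (c ∷ w)) F ≈ ∑ (insertAfter u (c ∷ w)) G
    ∑-insertAfter-∷ u c w F≗G = +-cong (F≗G _) (trans (∑-map (c ∷_) _ (insertAfter u w))
      (trans (∑-cong (insertAfter u w) (λ v _ → F≗G v)) (sym (∑-map (c ∷_) _ (insertAfter u w)))))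

    -- With k plateaus, |w| - 2k gaps raise the number and 2k preserve it; the negative term stands
    -- on the left. The claim is made for every `f` because a plateau at the front shifts `f` to
    -- `f ∘ suc` in the induction.
    CapInsertion : ℕ → List ℕ → Set
    CapInsertion m w = ∀ (f : ℕ → Carrier) →
      ∑ (insertAfter (m ∷ m ∷ []) w) (λ v → f (capC v)) + ι 2 * ι (capC w) * f (suc (capC w))
        ≈ ι (length w) * f (suc (capC w)) + ι 2 * ι (capC w) * f (capC w)

    cap-step : ∀ {m a b c} w → Plateau a b c → All (_< m) (a ∷ b ∷ c ∷ w) →
      CapInsertion m (b ∷ c ∷ w) → CapInsertion m (a ∷ b ∷ c ∷ w)
    cap-step {m} {a} {b} {c} w (no-plateau p) (a<m ∷ b<m ∷ w<m) IH f = begin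
      f (capC (a ∷ m ∷ m ∷ b ∷ c ∷ w)) + (f (capC (a ∷ b ∷ m ∷ m ∷ c ∷ w)) + _) + ι 2 * ι (capC (a ∷ b ∷ c ∷ w)) * f (suc (capC (a ∷ b ∷ c ∷ w)))
        ≈⟨ +-cong (+-cong first (+-cong second rest)) (≡⇒≈ (λ k → ι 2 * ι k * f (suc k)) k≡) ⟩
      f (suc k) + (T + S) + ι 2 * ι k * f (suc k)
        ≈⟨ +-assoc _ _ _ ⟩
      f (suc k) + (T + S + ι 2 * ι k * f (suc k))
        ≈⟨ +-congˡ (trans (+-congʳ (+-congˡ (sym (∑-map (b ∷_) _ (insertAfter mm (c ∷ w)))))) (IH f)) ⟩
      f (suc k) + (ι n * f (suc k) + ι 2 * ι k * f k)
        ≈⟨ solve 3 (λ u i v → u :+ (i :* u :+ v) := (1′ :+ i) :* u :+ v) refl (f (suc k)) (ι n) _ ⟩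
      (⟪ 1ℚ ⟫ + ι n) * f (suc k) + ι 2 * ι k * f k
        ≈⟨ +-cong (*-congʳ (ι-suc n)) refl ⟨
      ι (suc n) * f (suc k) + ι 2 * ι k * f k
        ≈⟨ ≡⇒≈ (λ k → ι (suc n) * f (suc k) + ι 2 * ι k * f k) k≡ ⟨
      ι (suc n) * f (suc (capC (a ∷ b ∷ c ∷ w))) + ι 2 * ι (capC (a ∷ b ∷ c ∷ w)) * f (capC (a ∷ b ∷ c ∷ w)) ∎
      where
      mm = m ∷ m ∷ []
      k = capC (b ∷ c ∷ w)
      n = length (b ∷ c ∷ w)
      S = ∑ (insertAfter mm (c ∷ w)) (λ v → f (capC (b ∷ v)))
      T = f (capC (b ∷ m ∷ m ∷ c ∷ w))
      k≡ : capC (a ∷ b ∷ c ∷ w) ≡ k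
      k≡ = ≡.cong (ℕ._+ k) p
      first : f (capC (a ∷ m ∷ m ∷ b ∷ c ∷ w)) ≈ f (suc k)
      first = ≡⇒≈ f (capC-amm (b ∷ c ∷ w) a<m (b<m ∷ w<m))
      second : f (capC (a ∷ b ∷ m ∷ m ∷ c ∷ w)) ≈ T
      second = ≡⇒≈ f (≡.cong (ℕ._+ capC (b ∷ m ∷ m ∷ c ∷ w)) (plateauAt-≢ a (ℕ.<⇒≢ b<m)))
      rest : ∑ (map (a ∷_) (map (b ∷_) (insertAfter mm (c ∷ w)))) (λ v → f (capC v)) ≈ S
      rest = trans (∑-map (a ∷_) _ (map (b ∷_) (insertAfter mm (c ∷ w))))
        (trans (∑-map (b ∷_) _ (insertAfter mm (c ∷ w)))
          (∑-insertAfter-∷ mm c w (λ v → ≡⇒≈ f (≡.cong (ℕ._+ capC (b ∷ c ∷ v)) p))))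
    cap-step {m} {a} {b} {c} w (plateau a<b b≡c p) (a<m ∷ b<m ∷ w<m) IH f = begin
      f (capC (a ∷ m ∷ m ∷ b ∷ c ∷ w)) + (f (capC (a ∷ b ∷ m ∷ m ∷ c ∷ w)) + _) + ι 2 * ι (capC (a ∷ b ∷ c ∷ w)) * f (suc (capC (a ∷ b ∷ c ∷ w)))
        ≈⟨ +-cong (+-cong first (+-cong second rest)) (trans (≡⇒≈ (λ k → ι 2 * ι k * f (suc k)) k≡) (*-congʳ (*-congˡ (ι-suc k)))) ⟩
      A + (A + S) + ι 2 * (⟪ 1ℚ ⟫ + ι k) * B
        -- The hypothesis for `f ∘ suc` presumes that the plateau at the front survives. The
        -- insertion after `b` breaks it, with value `A` instead of `B`, and the insertion after `a`
        -- adds another `A`.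
        ≈⟨ solve 4 (λ A B S K → A :+ (A :+ S) :+ 2′ :* (1′ :+ K) :* B := B :+ S :+ 2′ :* K :* B :+ (2′ :* A :+ B)) refl A B S (ι k) ⟩
      B + S + ι 2 * ι k * B + (ι 2 * A + B)
        ≈⟨ +-congʳ (+-congʳ (+-cong (≡⇒≈ (λ k → f (suc k)) (≡.sym capC-bmm)) (sym (∑-map (b ∷_) _ (insertAfter mm (c ∷ w)))))) ⟩
      ∑ (insertAfter mm (b ∷ c ∷ w)) (λ v → f (suc (capC v))) + ι 2 * ι k * B + (ι 2 * A + B)
        ≈⟨ +-congʳ (IH (λ k → f (suc k))) ⟩
      ι n * B + ι 2 * ι k * A + (ι 2 * A + B)
        ≈⟨ solve 4 (λ A B N K → N :* B :+ 2′ :* K :* A :+ (2′ :* A :+ B) := (1′ :+ N) :* B :+ 2′ :* (1′ :+ K) :* A) refl A B (ι n) (ι k) ⟩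
      (⟪ 1ℚ ⟫ + ι n) * B + ι 2 * (⟪ 1ℚ ⟫ + ι k) * A
        ≈⟨ +-cong (*-congʳ (ι-suc n)) (*-congʳ (*-congˡ (ι-suc k))) ⟨
      ι (suc n) * B + ι 2 * ι (suc k) * A
        ≈⟨ ≡⇒≈ (λ k → ι (suc n) * f (suc k) + ι 2 * ι k * f k) k≡ ⟨
      ι (suc n) * f (suc (capC (a ∷ b ∷ c ∷ w))) + ι 2 * ι (capC (a ∷ b ∷ c ∷ w)) * f (capC (a ∷ b ∷ c ∷ w)) ∎
      where
      mm = m ∷ m ∷ []
      k = capC (b ∷ c ∷ w)
      n = length (b ∷ c ∷ w)
      S = ∑ (insertAfter mm (c ∷ w)) (λ v → f (suc (capC (b ∷ v))))
      A = f (suc k)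
      B = f (suc (suc k))
      k≡ : capC (a ∷ b ∷ c ∷ w) ≡ suc k
      k≡ = ≡.cong (ℕ._+ k) p
      capC-bmm : capC (b ∷ m ∷ m ∷ c ∷ w) ≡ suc k
      capC-bmm = ≡.trans (capC-amm (c ∷ w) b<m w<m) (≡.cong suc (≡.sym (capC-repeat w b≡c)))
      first : f (capC (a ∷ m ∷ m ∷ b ∷ c ∷ w)) ≈ A
      first = ≡⇒≈ f (capC-amm (b ∷ c ∷ w) a<m (b<m ∷ w<m))
      second : f (capC (a ∷ b ∷ m ∷ m ∷ c ∷ w)) ≈ A
      second = ≡⇒≈ f (≡.trans (≡.cong (ℕ._+ capC (b ∷ m ∷ m ∷ c ∷ w)) (plateauAt-≢ a (ℕ.<⇒≢ b<m))) capC-bmm)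
      rest : ∑ (map (a ∷_) (map (b ∷_) (insertAfter mm (c ∷ w)))) (λ v → f (capC v)) ≈ S
      rest = trans (∑-map (a ∷_) _ (map (b ∷_) (insertAfter mm (c ∷ w))))
        (trans (∑-map (b ∷_) _ (insertAfter mm (c ∷ w)))
          (∑-insertAfter-∷ mm c w (λ v → ≡⇒≈ f (≡.cong (ℕ._+ capC (b ∷ c ∷ v)) p))))

    -- An insertion into either gap of an ascent plateau a < b = b preserves the number of plateaus,
    -- any other insertion creates one.
    ∑-capC-insertAfter : ∀ m w → All (_< m) w → CapInsertion m w
    ∑-capC-insertAfter m []           _              f =
      +-cong (sym (trans (*-congʳ 0-homo) (zeroˡ _))) (trans (*-congʳ *ι0) (trans (zeroˡ _) (sym (trans (*-congʳ *ι0) (zeroˡ _)))))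
      where
      *ι0 : ι 2 * ι 0 ≈ 0#
      *ι0 = trans (*-congˡ 0-homo) (zeroʳ _)
    ∑-capC-insertAfter m (a ∷ [])     (a<m ∷ [])     f = begin
      f (capC (a ∷ m ∷ m ∷ [])) + 0# + ι 2 * ι 0 * f 1
        ≈⟨ +-cong (+-cong (≡⇒≈ f (capC-amm [] a<m [])) (sym 0-homo)) refl ⟩
      f 1 + ι 0 + ι 2 * ι 0 * f 1
        ≈⟨ solve 2 (λ u v → u :+ con 0ℚ :+ 2′ :* con 0ℚ :* u := 1′ :* u :+ 2′ :* con 0ℚ :* v) refl (f 1) (f 0) ⟩
      ι 1 * f 1 + ι 2 * ι 0 * f 0 ∎
    ∑-capC-insertAfter m (a ∷ b ∷ []) (a<m ∷ b<m ∷ []) f = begin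
      f (capC (a ∷ m ∷ m ∷ b ∷ [])) + (f (capC (a ∷ b ∷ m ∷ m ∷ [])) + 0#) + ι 2 * ι 0 * f 1
        ≈⟨ +-cong (+-cong (≡⇒≈ f (capC-amm (b ∷ []) a<m (b<m ∷ []))) (+-cong (≡⇒≈ f (capC-abmm a [] b<m [])) (sym 0-homo))) refl ⟩
      f 1 + (f 1 + ι 0) + ι 2 * ι 0 * f 1
        ≈⟨ solve 2 (λ u v → u :+ (u :+ con 0ℚ) :+ 2′ :* con 0ℚ :* u := 2′ :* u :+ 2′ :* con 0ℚ :* v) refl (f 1) (f 0) ⟩
      ι 2 * f 1 + ι 2 * ι 0 * f 0 ∎
    ∑-capC-insertAfter m (a ∷ b ∷ c ∷ w) (a<m ∷ w<m) =
      cap-step w (plateau? a b c) (a<m ∷ w<m) (∑-capC-insertAfter m (b ∷ c ∷ w) w<m)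

    -- With k descents, k + 1 of the gaps preserve their number. Since k is a parameter, each
    -- inductive step works with the evaluated number of descents, and `subst` restores `des`
    -- afterwards.
    DesInsertion : ℕ → List ℕ → ℕ → Set
    DesInsertion m w k = ∀ (f : ℕ → Carrier) →
      ∑ (insertAfter (m ∷ []) w) (λ v → f (des v)) + ι (suc k) * f (suc k)
        ≈ ι (length w) * f (suc k) + ι (suc k) * f k

    des-step-≤ : ∀ {m a b} w → a ℕ.≤ b → All (_< m) (a ∷ b ∷ w) →
      DesInsertion m (b ∷ w) (des (b ∷ w)) → DesInsertion m (a ∷ b ∷ w) (des (b ∷ w))
    des-step-≤ {m} {a} {b} w a≤b (a<m ∷ b<m ∷ w<m) IH f = begin
      f (des (a ∷ m ∷ b ∷ w)) + ∑ (map (a ∷_) (insertAfter (m ∷ []) (b ∷ w))) (λ v → f (des v)) + K * B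
        ≈⟨ +-congʳ (+-cong first (trans (∑-map (a ∷_) _ (insertAfter (m ∷ []) (b ∷ w))) (∑-insertAfter-∷ (m ∷ []) b w same))) ⟩
      B + S + K * B
        ≈⟨ +-assoc _ _ _ ⟩
      B + (S + K * B)
        ≈⟨ +-congˡ (IH f) ⟩
      B + (ι n * B + K * A)
        ≈⟨ solve 3 (λ B N V → B :+ (N :* B :+ V) := (1′ :+ N) :* B :+ V) refl B (ι n) (K * A) ⟩
      (⟪ 1ℚ ⟫ + ι n) * B + K * A
        ≈⟨ +-congʳ (*-congʳ (ι-suc n)) ⟨
      ι (suc n) * B + K * A ∎
      where
      n = length (b ∷ w)
      k = des (b ∷ w)
      K = ι (suc k)
      A = f k
      B = f (suc k)
      S = ∑ (insertAfter (m ∷ []) (b ∷ w)) (λ v → f (des v))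
      first : f (des (a ∷ m ∷ b ∷ w)) ≈ B
      first = ≡⇒≈ f (≡.cong₂ ℕ._+_ (descentAt-no (ℕ.<⇒≤ a<m)) (≡.cong (ℕ._+ k) (descentAt-yes b<m)))
      same : ∀ v → f (des (a ∷ b ∷ v)) ≈ f (des (b ∷ v))
      same v = ≡⇒≈ f (≡.cong (ℕ._+ des (b ∷ v)) (descentAt-no a≤b))
    -- Between a and b the new maximum m replaces the descent a > b by m > b, so the number stays.
    -- Every later insertion keeps the descent at the front, whence the hypothesis with `f` shifted
    -- by one.
    des-step-> : ∀ {m a b} w → b < a → All (_< m) (a ∷ b ∷ w) →
      DesInsertion m (b ∷ w) (des (b ∷ w)) → DesInsertion m (a ∷ b ∷ w) (suc (des (b ∷ w)))
    des-step-> {m} {a} {b} w b<a (a<m ∷ b<m ∷ w<m) IH f = begin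
      f (des (a ∷ m ∷ b ∷ w)) + ∑ (map (a ∷_) (insertAfter (m ∷ []) (b ∷ w))) (λ v → f (des v)) + ι (suc (suc k)) * B
        ≈⟨ +-cong (+-cong first (trans (∑-map (a ∷_) _ (insertAfter (m ∷ []) (b ∷ w))) (∑-insertAfter-∷ (m ∷ []) b w same))) (*-congʳ (ι-suc (suc k))) ⟩
      A + S + (⟪ 1ℚ ⟫ + K) * B
        ≈⟨ solve 4 (λ A B S K → A :+ S :+ (1′ :+ K) :* B := S :+ K :* B :+ (A :+ B)) refl A B S K ⟩
      S + K * B + (A + B)
        ≈⟨ +-congʳ (IH (λ k → f (suc k))) ⟩
      ι n * B + K * A + (A + B)
        ≈⟨ solve 4 (λ A B N K → N :* B :+ K :* A :+ (A :+ B) := (1′ :+ N) :* B :+ (1′ :+ K) :* A) refl A B (ι n) K ⟩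
      (⟪ 1ℚ ⟫ + ι n) * B + (⟪ 1ℚ ⟫ + K) * A
        ≈⟨ +-cong (*-congʳ (ι-suc n)) (*-congʳ (ι-suc (suc k))) ⟨
      ι (suc n) * B + ι (suc (suc k)) * A ∎
      where
      n = length (b ∷ w)
      k = des (b ∷ w)
      K = ι (suc k)
      A = f (suc k)
      B = f (suc (suc k))
      S = ∑ (insertAfter (m ∷ []) (b ∷ w)) (λ v → f (suc (des v)))
      first : f (des (a ∷ m ∷ b ∷ w)) ≈ A
      first = ≡⇒≈ f (≡.cong₂ ℕ._+_ (descentAt-no (ℕ.<⇒≤ a<m)) (≡.cong (ℕ._+ k) (descentAt-yes b<m)))
      same : ∀ v → f (des (a ∷ b ∷ v)) ≈ f (suc (des (b ∷ v)))
      same v = ≡⇒≈ f (≡.cong (ℕ._+ des (b ∷ v)) (descentAt-yes b<a))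

    -- An insertion after a descent top or at the end of a word preserves the number of descents.
    ∑-des-insertAfter : ∀ m a w → All (_< m) (a ∷ w) → DesInsertion m (a ∷ w) (des (a ∷ w))
    ∑-des-insertAfter m a []      (a<m ∷ [])        f = begin
      f (des (a ∷ m ∷ [])) + 0# + ι 1 * f 1
        ≈⟨ +-congʳ (+-cong (≡⇒≈ f (≡.cong (ℕ._+ 0) (descentAt-no (ℕ.<⇒≤ a<m)))) (sym 0-homo)) ⟩
      f 0 + ι 0 + ι 1 * f 1      ≈⟨ solve 2 (λ u v → v :+ con 0ℚ :+ 1′ :* u := 1′ :* u :+ 1′ :* v) refl (f 1) (f 0) ⟩
      ι 1 * f 1 + ι 1 * f 0      ∎
    ∑-des-insertAfter m a (b ∷ w) (a<m ∷ w<m) with ℕ.≤-<-connex a b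
    ... | inj₁ a≤b = ≡.subst (DesInsertion m (a ∷ b ∷ w)) (≡.cong (ℕ._+ des (b ∷ w)) (≡.sym (descentAt-no a≤b)))
                       (des-step-≤ w a≤b (a<m ∷ w<m) (∑-des-insertAfter m b w w<m))
    ... | inj₂ b<a = ≡.subst (DesInsertion m (a ∷ b ∷ w)) (≡.cong (ℕ._+ des (b ∷ w)) (≡.sym (descentAt-yes b<a)))
                       (des-step-> w b<a (a<m ∷ w<m) (∑-des-insertAfter m b w w<m))

    -- In front of a nonempty word the maximum creates a descent, which raises the coefficient |w|
    -- to |w| + 1. For the empty word the front is also the end, and the number of descents stays 0.
    ∑-des-insertAnywhere : ∀ m w → All (_< m) w → ∀ (f : ℕ → Carrier) →
      ∑ (insertAnywhere (m ∷ []) w) (λ v → f (des v)) + ι (suc (des w)) * f (suc (des w))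
        ≈ ι (suc (length w)) * f (suc (des w)) + ι (suc (des w)) * f (des w)
    ∑-des-insertAnywhere m []      _           f = begin
      f 0 + 0# + ι 1 * f 1       ≈⟨ +-congʳ (+-congˡ (sym 0-homo)) ⟩
      f 0 + ι 0 + ι 1 * f 1      ≈⟨ solve 2 (λ u v → v :+ con 0ℚ :+ 1′ :* u := 1′ :* u :+ 1′ :* v) refl (f 1) (f 0) ⟩
      ι 1 * f 1 + ι 1 * f 0      ∎
    ∑-des-insertAnywhere m (a ∷ w) (a<m ∷ w<m) f = begin
      f (des (m ∷ a ∷ w)) + S + K * B
        ≈⟨ +-congʳ (+-congʳ (≡⇒≈ f (≡.cong (ℕ._+ des (a ∷ w)) (descentAt-yes a<m)))) ⟩
      B + S + K * B
        ≈⟨ +-assoc _ _ _ ⟩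
      B + (S + K * B)
        ≈⟨ +-congˡ (∑-des-insertAfter m a w (a<m ∷ w<m) f) ⟩
      B + (ι n * B + K * A)
        ≈⟨ solve 3 (λ B N V → B :+ (N :* B :+ V) := (1′ :+ N) :* B :+ V) refl B (ι n) (K * A) ⟩
      (⟪ 1ℚ ⟫ + ι n) * B + K * A
        ≈⟨ +-congʳ (*-congʳ (ι-suc n)) ⟨
      ι (suc n) * B + K * A ∎
      where
      n = length (a ∷ w)
      K = ι (suc (des (a ∷ w)))
      A = f (des (a ∷ w))
      B = f (suc (des (a ∷ w)))
      S = ∑ (insertAfter (m ∷ []) (a ∷ w)) (λ v → f (des v))

-- Weighted recurrences and the binomial convolution.

module WeightRecurrences where
  open import Defs using (capC; isFixC; des)
  open RationalAlgebras
  open Words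
  open InsertionStatistics
  open import Data.Nat.Combinatorics using (_C_; nCk+nC[k+1]≡[n+1]C[k+1]; nCn≡1)
  open import Data.List.Relation.Unary.All.Properties using (++⁻)
  open ≡ using (_≡_)

  module Recurrences (R : CommutativeRing 0ℓ 0ℓ)
    (κ : ℚ-coefficients -Raw-AlmostCommutative⟶ fromCommutativeRing R) where
    open ℚ-Algebra R κ
    open InsertionSums R κ

    -- L stands for 2x(1 - x) ∂/∂x + 2x(1 - y) ∂/∂y.
    module Weighted (x y q : Carrier) (L : Carrier → Carrier) (isDerivation : IsDerivation L)
      (L-x : L x ≈ ι 2 * x * (1# - x)) (L-y : L y ≈ ι 2 * x * (1# - y)) (L-q : L q ≈ 0#) where

      open IsDerivation isDerivation

      weightC : List ℕ → Carrier
      weightC c = pow x (capC c) * (pow y (isFixC c) * q)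

      weight : List (List ℕ) → Carrier
      weight σ = foldr (λ c acc → weightC c * acc) 1# σ

      L-pow-x : ∀ n → L (pow x n) ≈ ι n * (ι 2 * (1# - x)) * pow x n
      L-pow-x = D-pow-log (trans L-x (solve 2 (λ x o → 2′ :* x :* (o :- x) := x :* (2′ :* (o :- x))) refl x 1#))

      private
        mm : ℕ → List ℕ
        mm m = m ∷ m ∷ []

      -- An insertion makes a cycle `a a` too long to be fixed, and no insertion creates a fixed
      -- cycle. So the y-part of `L` concerns fixed cycles alone; any other cycle has a weight
      -- depending only on its number of plateaus, before and after the insertion.
      ∑-weightC : ∀ m w → All (_< m) w → CycleShape w →
        ∑ (insertAfter (mm m) w) weightC ≈ ι (length w) * x * weightC w + L (weightC w)
      ∑-weightC m _ (a<m ∷ _) (fixed a) = begin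
        weightC (a ∷ m ∷ m ∷ a ∷ []) + (weightC (a ∷ a ∷ m ∷ m ∷ []) + 0#)
          ≈⟨ +-cong (*-congʳ (≡⇒≈ (pow x) (capC-amm (a ∷ []) a<m (a<m ∷ []))))
                    (+-congʳ (*-congʳ (≡⇒≈ (pow x) (capC-abmm a [] a<m [])))) ⟩
        x * 1# * (1# * q) + (x * 1# * (1# * q) + 0#)
          ≈⟨ +-cong (*-cong (*-identityʳ x) (*-identityˡ q)) (trans (+-identityʳ _) (*-cong (*-identityʳ x) (*-identityˡ q))) ⟩
        x * q + x * q
          -- The summand `y :* con 0ℚ` is put in for the term y * L q that the Leibniz rule
          -- requires.
          ≈⟨ solve 4 (λ x y q z → x :* q :+ x :* q := 2′ :* x :* (y :* q) :+ (2′ :* x :* (1′ :- y) :* q :+ y :* con 0ℚ)) refl x y q 0# ⟩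
        ι 2 * x * (y * q) + (ι 2 * x * (⟪ 1ℚ ⟫ - y) * q + y * ⟪ 0ℚ ⟫)
          ≈⟨ +-congˡ (+-cong (*-congʳ (*-congˡ (+-congʳ 1-homo))) (*-congˡ 0-homo)) ⟩
        ι 2 * x * (y * q) + (ι 2 * x * (1# - y) * q + y * 0#)
          ≈⟨ +-congˡ (+-cong (*-congʳ L-y) (*-congˡ L-q)) ⟨
        ι 2 * x * (y * q) + (L y * q + y * L q)
          ≈⟨ +-congˡ (leibniz y q) ⟨
        ι 2 * x * (y * q) + L (y * q)
          ≈⟨ +-cong (*-congˡ weight-fixed) (D-cong weight-fixed) ⟨
        ι 2 * x * weightC (a ∷ a ∷ []) + L (weightC (a ∷ a ∷ [])) ∎
        where
        weight-fixed : weightC (a ∷ a ∷ []) ≈ y * q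
        weight-fixed = trans (*-identityˡ _) (*-congʳ (trans (≡⇒≈ (pow y) (isFixC-yes a)) (*-identityʳ y)))
      ∑-weightC m w w<m (not-fixed f≡0) = begin
        ∑ (insertAfter (mm m) w) weightC
          ≈⟨ ∑-cong (insertAfter (mm m) w) (λ v v∈ → *-congˡ (no-fix v (insertion-not-fixed w f≡0 v∈))) ⟩
        ∑ (insertAfter (mm m) w) (λ v → pow x (capC v) * q)
          ≈⟨ +-moveʳ (∑-capC-insertAfter m w w<m (λ k → pow x k * q)) ⟩
        ι (length w) * (x * p * q) + ι 2 * ι k * (p * q) - ι 2 * ι k * (x * p * q)
          ≈⟨ solve 5 (λ n x p q k → n :* (x :* p :* q) :+ 2′ :* k :* (p :* q) :- 2′ :* k :* (x :* p :* q)
                                 := n :* x :* (p :* q) :+ (k :* (2′ :* (1′ :- x)) :* p :* q :+ p :* con 0ℚ)) refl (ι (length w)) x p q (ι k) ⟩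
        ι (length w) * x * (p * q) + (ι k * (ι 2 * (⟪ 1ℚ ⟫ - x)) * p * q + p * ⟪ 0ℚ ⟫)
          ≈⟨ +-congˡ (+-cong (*-congʳ (*-congʳ (*-congˡ (*-congˡ (+-congʳ 1-homo))))) (*-congˡ 0-homo)) ⟩
        ι (length w) * x * (p * q) + (ι k * (ι 2 * (1# - x)) * p * q + p * 0#)
          ≈⟨ +-congˡ (+-cong (*-congʳ (L-pow-x k)) (*-congˡ L-q)) ⟨
        ι (length w) * x * (p * q) + (L p * q + p * L q)
          ≈⟨ +-congˡ (leibniz p q) ⟨
        ι (length w) * x * (p * q) + L (p * q)
          ≈⟨ +-cong (*-congˡ (*-congˡ (no-fix w f≡0))) (D-cong (*-congˡ (no-fix w f≡0))) ⟨
        ι (length w) * x * weightC w + L (weightC w) ∎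
        where
        k = capC w
        p = pow x k
        no-fix : ∀ v → isFixC v ≡ 0 → pow y (isFixC v) * q ≈ q
        no-fix v f≡0 = trans (*-congʳ (≡⇒≈ (pow y) f≡0)) (*-identityˡ q)
        insertion-not-fixed : ∀ w → isFixC w ≡ 0 → ∀ {v} → v ∈ insertAfter (mm m) w → isFixC v ≡ 0
        insertion-not-fixed (a ∷ w) _ {v} v∈ =
          isFixC-length≢2 v (λ eq → case (≡.trans (≡.sym (length-insertAfter (mm m) (a ∷ w) v∈)) eq))
          where
          case : ∀ {n} → 3 ℕ.+ n ≡ 2 → _
          case ()

      -- An insertion changes exactly one cycle and leaves the others alone, which is the pattern of
      -- the Leibniz rule for the product of the cycle weights; the terms with a length add up.
      ∑-weight-modifyCycle : ∀ m σ → All (_< m) (concat σ) →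
        ∑ (modifyCycle m σ) weight ≈ ι (length (concat σ)) * x * weight σ + L (weight σ)
      ∑-weight-modifyCycle m []      _   = begin
        0#                              ≈⟨ D-1 ⟨
        L 1#                            ≈⟨ +-identityˡ _ ⟨
        0# + L 1#                       ≈⟨ +-congʳ (trans (*-congʳ (trans (*-congʳ 0-homo) (zeroˡ x))) (zeroˡ 1#)) ⟨
        ι 0 * x * 1# + L 1#             ∎
      ∑-weight-modifyCycle m (c ∷ σ) <m with ++⁻ c <m
      ... | c<m , σ<m = begin
        ∑ (map (_∷ σ) (insertAfter (mm m) c) ++ map (c ∷_) (modifyCycle m σ)) weight
          ≈⟨ ∑-++ weight (map (_∷ σ) (insertAfter (mm m) c)) _ ⟩
        ∑ (map (_∷ σ) (insertAfter (mm m) c)) weight + ∑ (map (c ∷_) (modifyCycle m σ)) weight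
          ≈⟨ +-cong (∑-map (_∷ σ) weight (insertAfter (mm m) c)) (∑-map (c ∷_) weight (modifyCycle m σ)) ⟩
        ∑ (insertAfter (mm m) c) (λ c → weightC c * weight σ) + ∑ (modifyCycle m σ) (λ σ → weightC c * weight σ)
          ≈⟨ +-cong (trans (∑-cong (insertAfter (mm m) c) (λ _ _ → *-comm _ _)) (∑-*ˡ (weight σ) weightC (insertAfter (mm m) c)))
                    (∑-*ˡ (weightC c) weight (modifyCycle m σ)) ⟩
        weight σ * ∑ (insertAfter (mm m) c) weightC + weightC c * ∑ (modifyCycle m σ) weight
          ≈⟨ +-cong (*-congˡ (∑-weightC m c c<m (cycleShape c))) (*-congˡ (∑-weight-modifyCycle m σ σ<m)) ⟩
        weight σ * (ι (length c) * x * weightC c + L (weightC c)) + weightC c * (ι (length (concat σ)) * x * weight σ + L (weight σ))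
          ≈⟨ solve 7 (λ s n x w dw n′ ds → s :* (n :* x :* w :+ dw) :+ w :* (n′ :* x :* s :+ ds)
               := (n :+ n′) :* x :* (w :* s) :+ (dw :* s :+ w :* ds)) refl
               (weight σ) (ι (length c)) x (weightC c) (L (weightC c)) (ι (length (concat σ))) (L (weight σ)) ⟩
        (ι (length c) + ι (length (concat σ))) * x * (weightC c * weight σ) + (L (weightC c) * weight σ + weightC c * L (weight σ))
          ≈⟨ +-cong (*-congʳ (*-congʳ (trans (≡⇒≈ ι (length-++ c)) (ι-+ (length c) _)))) (leibniz _ _) ⟨
        ι (length (c ++ concat σ)) * x * (weightC c * weight σ) + L (weightC c * weight σ) ∎

      weight-∷ʳ : ∀ σ c → weight (σ ++ c ∷ []) ≈ weight σ * weightC c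
      weight-∷ʳ []      c = *-comm _ _
      weight-∷ʳ (d ∷ σ) c = trans (*-congˡ (weight-∷ʳ σ c)) (sym (*-assoc _ _ _))

      ∑-weight-extend : ∀ m σ → All (_< m) (concat σ) →
        ∑ (extend m σ) weight ≈ (ι (length (concat σ)) * x + q * y) * weight σ + L (weight σ)
      ∑-weight-extend m σ <m = begin
        weight (σ ++ mm m ∷ []) + ∑ (modifyCycle m σ) weight
          ≈⟨ +-cong (trans (weight-∷ʳ σ (mm m)) (*-congˡ (trans (*-identityˡ _) (*-congʳ (trans (≡⇒≈ (pow y) (isFixC-yes m)) (*-identityʳ y))))))
                    (∑-weight-modifyCycle m σ <m) ⟩
        weight σ * (y * q) + (ι (length (concat σ)) * x * weight σ + L (weight σ))
          ≈⟨ solve 6 (λ s y q n x d → s :* (y :* q) :+ (n :* x :* s :+ d) := (n :* x :+ q :* y) :* s :+ d) refl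
               (weight σ) y q (ι (length (concat σ))) x (L (weight σ)) ⟩
        (ι (length (concat σ)) * x + q * y) * weight σ + L (weight σ) ∎

      ∑-linear : {A : Set} (r : Carrier) (f : A → Carrier) (as : List A) →
        ∑ as (λ a → r * f a + L (f a)) ≈ r * ∑ as f + L (∑ as f)
      ∑-linear r f as = trans (∑-+ _ _ as) (+-cong (∑-*ˡ r f as) (sym (D-∑ f as)))

      ∑-weight-step : ∀ m n (Q : List (List (List ℕ))) → (∀ σ → σ ∈ Q → All (_< m) (concat σ)) → (∀ σ → σ ∈ Q → length (concat σ) ≡ n) →
        ∑ (concat (map (extend m) Q)) weight ≈ (ι n * x + q * y) * ∑ Q weight + L (∑ Q weight)
      ∑-weight-step m n Q <m len = begin
        ∑ (concat (map (extend m) Q)) weight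
          ≈⟨ trans (∑-concat weight (map (extend m) Q)) (∑-map (extend m) _ Q) ⟩
        ∑ Q (λ σ → ∑ (extend m σ) weight)
          ≈⟨ ∑-cong Q (λ σ σ∈ → trans (∑-weight-extend m σ (<m σ σ∈)) (+-congʳ (≡⇒≈ (λ n → (ι n * x + q * y) * weight σ) (len σ σ∈)))) ⟩
        ∑ Q (λ σ → (ι n * x + q * y) * weight σ + L (weight σ))
          ≈⟨ ∑-linear _ weight Q ⟩
        (ι n * x + q * y) * ∑ Q weight + L (∑ Q weight) ∎

      desWeight : List ℕ → Carrier
      desWeight π = pow x (des π)

      -- A single insertion sum equals (1 + nx) x^k + k(1 - x) x^k, for length n and k descents. The
      -- last term is half of L(x^k), hence the factor 2 on the left.
      ∑-desWeight-insertAnywhere : ∀ m π → All (_< m) π →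
        ι 2 * ∑ (insertAnywhere (m ∷ []) π) desWeight ≈ (ι 2 + ι 2 * ι (length π) * x) * desWeight π + L (desWeight π)
      ∑-desWeight-insertAnywhere m π <m = begin
        ι 2 * ∑ (insertAnywhere (m ∷ []) π) desWeight
          ≈⟨ *-congˡ (+-moveʳ (∑-des-insertAnywhere m π <m (pow x))) ⟩
        ι 2 * (ι (suc n) * (x * p) + ι (suc k) * p - ι (suc k) * (x * p))
          ≈⟨ *-congˡ (+-cong (+-cong (*-congʳ (ι-suc n)) (*-congʳ (ι-suc k))) (-‿cong (*-congʳ (ι-suc k)))) ⟩
        ι 2 * ((⟪ 1ℚ ⟫ + ι n) * (x * p) + (⟪ 1ℚ ⟫ + ι k) * p - (⟪ 1ℚ ⟫ + ι k) * (x * p))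
          ≈⟨ solve 4 (λ n k x p → 2′ :* ((1′ :+ n) :* (x :* p) :+ (1′ :+ k) :* p :- (1′ :+ k) :* (x :* p))
               := (2′ :+ 2′ :* n :* x) :* p :+ k :* (2′ :* (1′ :- x)) :* p) refl (ι n) (ι k) x p ⟩
        (ι 2 + ι 2 * ι n * x) * p + ι k * (ι 2 * (⟪ 1ℚ ⟫ - x)) * p
          ≈⟨ +-congˡ (*-congʳ (*-congˡ (*-congˡ (+-congʳ 1-homo)))) ⟩
        (ι 2 + ι 2 * ι n * x) * p + ι k * (ι 2 * (1# - x)) * p
          ≈⟨ +-congˡ (L-pow-x k) ⟨
        (ι 2 + ι 2 * ι n * x) * p + L p ∎
        where
        n = length π
        k = des π
        p = pow x k

      ∑-desWeight-step : ∀ m n (S : List (List ℕ)) → (∀ π → π ∈ S → All (_< m) π) → (∀ π → π ∈ S → length π ≡ n) →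
        ι 2 * ∑ (concat (map (insertAnywhere (m ∷ [])) S)) desWeight
          ≈ (ι 2 + ι 2 * ι n * x) * ∑ S desWeight + L (∑ S desWeight)
      ∑-desWeight-step m n S <m len = begin
        ι 2 * ∑ (concat (map (insertAnywhere (m ∷ [])) S)) desWeight
          ≈⟨ *-congˡ (trans (∑-concat desWeight (map (insertAnywhere (m ∷ [])) S)) (∑-map (insertAnywhere (m ∷ [])) _ S)) ⟩
        ι 2 * ∑ S (λ π → ∑ (insertAnywhere (m ∷ []) π) desWeight)
          ≈⟨ ∑-*ˡ (ι 2) _ S ⟨
        ∑ S (λ π → ι 2 * ∑ (insertAnywhere (m ∷ []) π) desWeight)
          ≈⟨ ∑-cong S (λ π π∈ → trans (∑-desWeight-insertAnywhere m π (<m π π∈)) (+-congʳ (≡⇒≈ (λ n → (ι 2 + ι 2 * ι n * x) * desWeight π) (len π π∈)))) ⟩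
        ∑ S (λ π → (ι 2 + ι 2 * ι n * x) * desWeight π + L (desWeight π))
          ≈⟨ ∑-linear _ desWeight S ⟩
        (ι 2 + ι 2 * ι n * x) * ∑ S desWeight + L (∑ S desWeight) ∎

      module Convolution (P B : ℕ → Carrier)
        (P-0 : P 0 ≈ 1#) (P-suc : ∀ n → P (suc n) ≈ (ι (2 ℕ.* n) * x + q * y) * P n + L (P n))
        (B-0 : B 0 ≈ 1#) (B-suc : ∀ m → B (suc m) ≈ (ι 2 + ι (2 ℕ.* m) * x) * B m + L (B m)) where

        S : ℕ → Carrier
        S n = ∑< n (λ k → ι (n C k) * (P k * B (n ∸ k)))

        B-1 : B 1 ≈ ι 2
        B-1 = begin
          B 1                              ≈⟨ B-suc 0 ⟩
          (ι 2 + ι 0 * x) * B 0 + L (B 0)  ≈⟨ +-cong (*-congˡ (trans B-0 (sym 1-homo))) (trans (D-cong B-0) (trans D-1 (sym 0-homo))) ⟩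
          (ι 2 + ι 0 * x) * ⟪ 1ℚ ⟫ + ι 0   ≈⟨ solve 1 (λ x → (2′ :+ con 0ℚ :* x) :* 1′ :+ con 0ℚ := 2′) refl x ⟩
          ι 2                              ∎

        pascal : ∀ n (g : ℕ → Carrier) →
          ∑< (suc n) (λ k → ι (suc n C k) * g k) ≈ ∑< (suc n) (λ k → ι (n C k) * g k) + ∑< n (λ k → ι (n C k) * g (suc k))
        pascal n g = begin
          ∑< (suc n) (λ k → ι (suc n C k) * g k)
            ≈⟨ ∑<-head n _ ⟩
          ι 1 * g 0 + ∑< n (λ k → ι (suc n C suc k) * g (suc k))
            ≈⟨ +-congˡ (trans (∑<-cong n (λ k _ → split k)) (∑<-+ n _ _)) ⟩
          ι 1 * g 0 + (∑< n (λ k → ι (n C suc k) * g (suc k)) + ∑< n (λ k → ι (n C k) * g (suc k)))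
            ≈⟨ +-assoc _ _ _ ⟨
          ι 1 * g 0 + ∑< n (λ k → ι (n C suc k) * g (suc k)) + ∑< n (λ k → ι (n C k) * g (suc k))
            ≈⟨ +-congʳ (∑<-head n (λ k → ι (n C k) * g k)) ⟨
          ∑< (suc n) (λ k → ι (n C k) * g k) + ∑< n (λ k → ι (n C k) * g (suc k)) ∎
          where
          split : ∀ k → ι (suc n C suc k) * g (suc k) ≈ ι (n C suc k) * g (suc k) + ι (n C k) * g (suc k)
          split k = begin
            ι (suc n C suc k) * g (suc k)                          ≈⟨ *-congʳ (≡⇒≈ ι (nCk+nC[k+1]≡[n+1]C[k+1] n k)) ⟨
            ι (n C k ℕ.+ n C suc k) * g (suc k)                    ≈⟨ *-congʳ (trans (ι-+ (n C k) _) (+-comm _ _)) ⟩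
            (ι (n C suc k) + ι (n C k)) * g (suc k)                ≈⟨ distribʳ _ _ _ ⟩
            ι (n C suc k) * g (suc k) + ι (n C k) * g (suc k)      ∎

        -- Of the two halves given by Pascal's rule, the first still has a term k = n, which lies
        -- outside the range of `S n`. It is P n * B 1, the origin of `P n * ι 2`.
        S-suc : ∀ n → S (suc n) ≈ ∑< n (λ k → ι (n C k) * (P k * B (suc (n ∸ k)))) + P n * ι 2
                                  + ∑< n (λ k → ι (n C k) * (P (suc k) * B (n ∸ k)))
        S-suc n = begin
          S (suc n)
            ≈⟨ pascal n (λ k → P k * B (suc n ∸ k)) ⟩
          ∑< n (λ k → ι (n C k) * (P k * B (suc n ∸ k))) + ι (n C n) * (P n * B (suc n ∸ n)) + _
            ≈⟨ +-congʳ (+-cong (∑<-cong n (λ k k<n → *-congˡ (*-congˡ (≡⇒≈ B (ℕ.+-∸-assoc 1 (ℕ.<⇒≤ k<n))))))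
                 (trans (*-cong (trans (≡⇒≈ ι (nCn≡1 n)) 1-homo) (*-congˡ (trans (≡⇒≈ B (ℕ.m+n∸n≡m 1 n)) B-1))) (*-identityˡ _))) ⟩
          ∑< n (λ k → ι (n C k) * (P k * B (suc (n ∸ k)))) + P n * ι 2 + ∑< n (λ k → ι (n C k) * (P (suc k) * B (n ∸ k))) ∎

        -- Solve both recurrences for `L`: applying it to P k raises the index at the price of 2kx +
        -- qy, applying it to B (n - k) does so at the price of 2 + 2(n - k)x. The total price is
        -- independent of k and can be taken out of the sum.
        L-term : ∀ n k → k < n → L (ι (n C k) * (P k * B (n ∸ k))) ≈
          ι (n C k) * (P (suc k) * B (n ∸ k)) + ι (n C k) * (P k * B (suc (n ∸ k)))
          + (- (ι (2 ℕ.* n) * x + q * y + ι 2)) * (ι (n C k) * (P k * B (n ∸ k)))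
        L-term n k k<n = begin
          L (c * (P k * b))
            ≈⟨ D-con* _ _ ⟩
          c * L (P k * b)
            ≈⟨ *-congˡ (leibniz _ _) ⟩
          c * (L (P k) * b + P k * L b)
            ≈⟨ solve 9 (λ c p b dp db i j x o → c :* (dp :* b :+ p :* db)
                 := c :* (((i :* x :+ o) :* p :+ dp) :* b) :+ c :* (p :* ((2′ :+ j :* x) :* b :+ db))
                    :+ (:- ((i :+ j) :* x :+ o :+ 2′)) :* (c :* (p :* b))) refl
                 c (P k) b (L (P k)) (L b) (ι (2 ℕ.* k)) (ι (2 ℕ.* (n ∸ k))) x (q * y) ⟩
          c * (((ι (2 ℕ.* k) * x + q * y) * P k + L (P k)) * b) + c * (P k * ((ι 2 + ι (2 ℕ.* (n ∸ k)) * x) * b + L b))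
            + (- ((ι (2 ℕ.* k) + ι (2 ℕ.* (n ∸ k))) * x + q * y + ι 2)) * (c * (P k * b))
            ≈⟨ +-cong (+-cong (*-congˡ (*-congʳ (P-suc k))) (*-congˡ (*-congˡ (B-suc (n ∸ k)))))
                 (*-congʳ (-‿cong (+-congʳ (+-congʳ (*-congʳ 2n≈))))) ⟨
          c * (P (suc k) * b) + c * (P k * B (suc (n ∸ k))) + (- (ι (2 ℕ.* n) * x + q * y + ι 2)) * (c * (P k * b)) ∎
          where
          c = ι (n C k)
          b = B (n ∸ k)
          2n≈ : ι (2 ℕ.* n) ≈ ι (2 ℕ.* k) + ι (2 ℕ.* (n ∸ k))
          2n≈ = trans (≡⇒≈ ι (≡.trans (≡.cong (2 ℕ.*_) (≡.sym (ℕ.m+[n∸m]≡n (ℕ.<⇒≤ k<n)))) (ℕ.*-distribˡ-+ 2 k (n ∸ k)))) (ι-+ (2 ℕ.* k) _)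

        L-S : ∀ n → L (S n) ≈ S (suc n) - P n * ι 2 - (ι (2 ℕ.* n) * x + q * y + ι 2) * S n
        L-S n = begin
          L (S n)
            ≈⟨ D-∑< n _ ⟩
          ∑< n (λ k → L (ι (n C k) * (P k * B (n ∸ k))))
            ≈⟨ ∑<-cong n (L-term n) ⟩
          ∑< n (λ k → ι (n C k) * (P (suc k) * B (n ∸ k)) + ι (n C k) * (P k * B (suc (n ∸ k)))
                      + (- (ι (2 ℕ.* n) * x + q * y + ι 2)) * (ι (n C k) * (P k * B (n ∸ k))))
            ≈⟨ trans (∑<-+ n _ _) (+-cong (∑<-+ n _ _) (∑<-*ˡ n _ _)) ⟩
          U + V + (- (ι (2 ℕ.* n) * x + q * y + ι 2)) * S n
            ≈⟨ solve 5 (λ u v w s p → u :+ v :+ (:- w) :* s := v :+ p :+ u :- p :- w :* s) refl U V (ι (2 ℕ.* n) * x + q * y + ι 2) (S n) (P n * ι 2) ⟩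
          V + P n * ι 2 + U - P n * ι 2 - (ι (2 ℕ.* n) * x + q * y + ι 2) * S n
            ≈⟨ +-congʳ (+-congʳ (S-suc n)) ⟨
          S (suc n) - P n * ι 2 - (ι (2 ℕ.* n) * x + q * y + ι 2) * S n ∎
          where
          U = ∑< n (λ k → ι (n C k) * (P (suc k) * B (n ∸ k)))
          V = ∑< n (λ k → ι (n C k) * (P k * B (suc (n ∸ k))))

        -- Applying L to the identity for n turns it into the identity for n + 1.
        convolution : ∀ n → P (suc n) ≈ q * y * P n + q * x * S n
        convolution zero    = begin
          P 1                                 ≈⟨ P-suc 0 ⟩
          (ι 0 * x + q * y) * P 0 + L (P 0)   ≈⟨ +-congˡ (trans (D-cong P-0) (trans D-1 (sym 0-homo))) ⟩
          (ι 0 * x + q * y) * P 0 + ι 0       ≈⟨ solve 4 (λ x q y p → (con 0ℚ :* x :+ q :* y) :* p :+ con 0ℚ := q :* y :* p :+ q :* x :* con 0ℚ) refl x q y (P 0) ⟩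
          q * y * P 0 + q * x * ι 0           ≈⟨ +-congˡ (*-congˡ 0-homo) ⟩
          q * y * P 0 + q * x * 0#            ∎
        convolution (suc n) = begin
          P (suc (suc n))
            ≈⟨ P-suc (suc n) ⟩
          (ι (2 ℕ.* suc n) * x + q * y) * P (suc n) + L (P (suc n))
            ≈⟨ +-cong (*-congʳ (+-congʳ (*-congʳ (trans (≡⇒≈ ι (ℕ.*-suc 2 n)) (ι-+ 2 (2 ℕ.* n)))))) (D-cong (convolution n)) ⟩
          ((ι 2 + N) * x + q * y) * P (suc n) + L (q * y * P n + q * x * S n)
            ≈⟨ +-congˡ L-rhs ⟩
          ((ι 2 + N) * x + q * y) * P (suc n) + (q * (ι 2 * x * (⟪ 1ℚ ⟫ - y)) * P n + q * y * (P (suc n) - (N * x + q * y) * P n)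
            + (q * (ι 2 * x * (⟪ 1ℚ ⟫ - x)) * S n + q * x * (S (suc n) - P n * ι 2 - (N * x + q * y + ι 2) * S n)))
            -- Collecting terms leaves the right side for n + 1 and a multiple of the difference
            -- between the two sides for n, which the induction hypothesis annihilates.
            ≈⟨ solve 8 (λ N x q y p p₁ s s₁ →
                 ((2′ :+ N) :* x :+ q :* y) :* p₁ :+ (q :* (2′ :* x :* (1′ :- y)) :* p :+ q :* y :* (p₁ :- (N :* x :+ q :* y) :* p)
                   :+ (q :* (2′ :* x :* (1′ :- x)) :* s :+ q :* x :* (s₁ :- p :* 2′ :- (N :* x :+ q :* y :+ 2′) :* s)))
                 := q :* y :* p₁ :+ q :* x :* s₁ :+ ((2′ :+ N) :* x :+ q :* y) :* (p₁ :- (q :* y :* p :+ q :* x :* s)))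
                 refl N x q y (P n) (P (suc n)) (S n) (S (suc n)) ⟩
          q * y * P (suc n) + q * x * S (suc n) + ((ι 2 + N) * x + q * y) * (P (suc n) - (q * y * P n + q * x * S n))
            ≈⟨ +-congˡ (trans (*-congˡ (trans (+-congʳ (convolution n)) (-‿inverseʳ _))) (zeroʳ _)) ⟩
          q * y * P (suc n) + q * x * S (suc n) + 0#
            ≈⟨ +-identityʳ _ ⟩
          q * y * P (suc n) + q * x * S (suc n) ∎
          where
          N = ι (2 ℕ.* n)
          L-q* : ∀ z → L (q * z) ≈ q * L z
          L-q* z = trans (leibniz q z) (trans (+-congʳ (trans (*-congʳ L-q) (zeroˡ z))) (+-identityˡ _))
          L-P : L (P n) ≈ P (suc n) - (N * x + q * y) * P n
          L-P = +-moveʳ (trans (+-comm _ _) (sym (P-suc n)))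
          1-1′ : ∀ z → 1# - z ≈ ⟪ 1ℚ ⟫ - z
          1-1′ z = +-congʳ (sym 1-homo)
          L-rhs : L (q * y * P n + q * x * S n) ≈ q * (ι 2 * x * (⟪ 1ℚ ⟫ - y)) * P n + q * y * (P (suc n) - (N * x + q * y) * P n)
            + (q * (ι 2 * x * (⟪ 1ℚ ⟫ - x)) * S n + q * x * (S (suc n) - P n * ι 2 - (N * x + q * y + ι 2) * S n))
          L-rhs = trans (D-+ _ _) (+-cong
            (trans (leibniz _ _) (+-cong (*-congʳ (trans (L-q* y) (*-congˡ (trans L-y (*-congˡ (1-1′ y)))))) (*-congˡ L-P)))
            (trans (leibniz _ _) (+-cong (*-congʳ (trans (L-q* x) (*-congˡ (trans L-x (*-congˡ (1-1′ x)))))) (*-congˡ (L-S n)))))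

-- Variables, monomials and partial derivatives.

module PartialDerivatives where
  open import Defs renaming (_≈_ to _≈S_)
  open Rationals
  open PowerSeries
  open SeriesRing
  open import Data.Rational.Solver using (module +-*-Solver)
  open ≡ using (_≡_; _≢_)
  open CommutativeRing seriesRing using (refl; sym; trans; *-comm; *-assoc; *-cong; *-congˡ; *-congʳ; +-cong; +-congˡ; +-congʳ; distribˡ; zeroʳ; zeroˡ; *-identityʳ; reflexive)
  open SA using (IsDerivation)

  mono-≡ : ∀ i j k l → mono i j k l i j k l ≡ 1ℚ
  mono-≡ i j k l with i ℕ.≟ i | j ℕ.≟ j | k ℕ.≟ k | l ℕ.≟ l
  ... | yes _  | yes _  | yes _  | yes _  = ≡.refl
  ... | no i≢i | _      | _      | _      = contradiction ≡.refl i≢i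
  ... | yes _  | no j≢j | _      | _      = contradiction ≡.refl j≢j
  ... | yes _  | yes _  | no k≢k | _      = contradiction ≡.refl k≢k
  ... | yes _  | yes _  | yes _  | no l≢l = contradiction ≡.refl l≢l

  mono-≢ : ∀ i j k l {a b c d} → (i ≡ a → j ≡ b → k ≡ c → l ≡ d → ⊥) → mono i j k l a b c d ≡ 0ℚ
  mono-≢ i j k l {a} {b} {c} {d} ≢ with i ℕ.≟ a | j ℕ.≟ b | k ℕ.≟ c | l ℕ.≟ d
  ... | yes p | yes q | yes r | yes s = contradiction s (≢ p q r)
  ... | no _  | _     | _     | _     = ≡.refl
  ... | yes _ | no _  | _     | _     = ≡.refl
  ... | yes _ | yes _ | no _  | _     = ≡.refl
  ... | yes _ | yes _ | yes _ | no _  = ≡.refl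

  -- Matching on `same` identifies all four exponents at once, and `other` merges the four ways in
  -- which they can differ.
  data SameIndex (i j k l : ℕ) : ℕ → ℕ → ℕ → ℕ → Set where
    same  : SameIndex i j k l i j k l
    other : ∀ {a b c d} → (i ≡ a → j ≡ b → k ≡ c → l ≡ d → ⊥) → SameIndex i j k l a b c d

  sameIndex : ∀ i j k l a b c d → SameIndex i j k l a b c d
  sameIndex i j k l a b c d with i ℕ.≟ a | j ℕ.≟ b | k ℕ.≟ c | l ℕ.≟ d
  ... | yes ≡.refl | yes ≡.refl | yes ≡.refl | yes ≡.refl = same
  ... | no i≢a | _      | _      | _      = other λ p _ _ _ → i≢a p
  ... | yes _  | no j≢b | _      | _      = other λ _ p _ _ → j≢b p
  ... | yes _  | yes _  | no k≢c | _      = other λ _ _ p _ → k≢c p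
  ... | yes _  | yes _  | yes _  | no l≢d = other λ _ _ _ p → l≢d p

  private
    *S-via : ∀ {u u′ : Series} f → u ≈S u′ → u *S f ≈S PS₄.conv u′ f
    *S-via {u} {u′} f u≈u′ a b c d = ≡.trans (at (*-cong (pointwise u≈u′) (refl {f})) a b c d) (≡.sym (conv-*S u′ f a b c d))

    -- In the iterated rings x is the outermost variable and z the innermost. There, multiplication
    -- by a variable is an index shift, while the fourfold sum would have to be searched for its
    -- only nonzero term.
    X-variable : X ≈S PS₄.variable-series
    X-variable zero          b       c       d       = ≡.refl
    X-variable (suc zero)    zero    zero    zero    = ≡.refl
    X-variable (suc zero)    zero    zero    (suc _) = ≡.refl
    X-variable (suc zero)    zero    (suc _) d       = ≡.refl
    X-variable (suc zero)    (suc _) c       d       = ≡.refl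
    X-variable (suc (suc _)) b       c       d       = ≡.refl

    Y-variable : Y ≈S PS₄.constant PS₃.variable-series
    Y-variable zero    zero          c       d       = ≡.refl
    Y-variable zero    (suc zero)    zero    zero    = ≡.refl
    Y-variable zero    (suc zero)    zero    (suc _) = ≡.refl
    Y-variable zero    (suc zero)    (suc _) d       = ≡.refl
    Y-variable zero    (suc (suc _)) c       d       = ≡.refl
    Y-variable (suc _) b             c       d       = ≡.refl

    Q-variable : Qv ≈S PS₄.constant (PS₃.constant PS₂.variable-series)
    Q-variable zero    zero    zero          d       = ≡.refl
    Q-variable zero    zero    (suc zero)    zero    = ≡.refl
    Q-variable zero    zero    (suc zero)    (suc _) = ≡.refl
    Q-variable zero    zero    (suc (suc _)) d       = ≡.refl
    Q-variable zero    (suc _) c             d       = ≡.refl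
    Q-variable (suc _) b       c             d       = ≡.refl

    Z-variable : Z ≈S PS₄.constant (PS₃.constant (PS₂.constant PS₁.variable-series))
    Z-variable zero    zero    zero    zero          = ≡.refl
    Z-variable zero    zero    zero    (suc zero)    = ≡.refl
    Z-variable zero    zero    zero    (suc (suc _)) = ≡.refl
    Z-variable zero    zero    (suc _) d             = ≡.refl
    Z-variable zero    (suc _) c       d             = ≡.refl
    Z-variable (suc _) b       c       d             = ≡.refl

  X*-zero : ∀ f b c d → (X *S f) 0 b c d ≡ 0ℚ
  X*-zero f b c d = ≡.trans (*S-via f X-variable 0 b c d) (PS₄.conv-variable-zero f b c d)

  X*-suc : ∀ f a b c d → (X *S f) (suc a) b c d ≡ f a b c d
  X*-suc f a b c d = ≡.trans (*S-via f X-variable (suc a) b c d) (PS₄.conv-variable-suc a f b c d)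

  private
    Y*-via : ∀ f a b c d → (Y *S f) a b c d ≡ PS₃.conv PS₃.variable-series (f a) b c d
    Y*-via f a b c d = ≡.trans (*S-via f Y-variable a b c d) (PS₄.conv-constantˡ a PS₃.variable-series f b c d)

    Q*-via : ∀ f a b c d → (Qv *S f) a b c d ≡ PS₂.conv PS₂.variable-series (f a b) c d
    Q*-via f a b c d = ≡.trans (*S-via f Q-variable a b c d) (≡.trans (PS₄.conv-constantˡ a (PS₃.constant PS₂.variable-series) f b c d)
      (PS₃.conv-constantˡ b PS₂.variable-series (f a) c d))

    Z*-via : ∀ f a b c d → (Z *S f) a b c d ≡ PS₁.conv PS₁.variable-series (f a b c) d
    Z*-via f a b c d = ≡.trans (*S-via f Z-variable a b c d) (≡.trans (PS₄.conv-constantˡ a (PS₃.constant (PS₂.constant PS₁.variable-series)) f b c d)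
      (≡.trans (PS₃.conv-constantˡ b (PS₂.constant PS₁.variable-series) (f a) c d) (PS₂.conv-constantˡ c PS₁.variable-series (f a b) d)))

  Y*-zero : ∀ f a c d → (Y *S f) a 0 c d ≡ 0ℚ
  Y*-zero f a c d = ≡.trans (Y*-via f a 0 c d) (PS₃.conv-variable-zero (f a) c d)

  Y*-suc : ∀ f a b c d → (Y *S f) a (suc b) c d ≡ f a b c d
  Y*-suc f a b c d = ≡.trans (Y*-via f a (suc b) c d) (PS₃.conv-variable-suc b (f a) c d)

  Q*-zero : ∀ f a b d → (Qv *S f) a b 0 d ≡ 0ℚ
  Q*-zero f a b d = ≡.trans (Q*-via f a b 0 d) (PS₂.conv-variable-zero (f a b) d)

  Q*-suc : ∀ f a b c d → (Qv *S f) a b (suc c) d ≡ f a b c d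
  Q*-suc f a b c d = ≡.trans (Q*-via f a b (suc c) d) (PS₂.conv-variable-suc c (f a b) d)

  Z*-zero : ∀ f a b c → (Z *S f) a b c 0 ≡ 0ℚ
  Z*-zero f a b c = ≡.trans (Z*-via f a b c 0) (PS₁.conv-variable-zero (f a b c))

  Z*-suc : ∀ f a b c d → (Z *S f) a b c (suc d) ≡ f a b c d
  Z*-suc f a b c d = ≡.trans (Z*-via f a b c (suc d)) (PS₁.conv-variable-suc d (f a b c))

  -- If e is the exponent of the variable v, then θ e is v ∂/∂v. Its Leibniz rule involves no index shift,
  -- and that of ∂/∂v follows by cancelling v.
  θ : (ℕ → ℕ → ℕ → ℕ → ℕ) → Series → Series
  θ e f a b c d = ℕ→ℚ (e a b c d) ℚ.* f a b c d

  -- Monomials are eigenvectors of the Euler operators v ∂/∂v; the derivatives of constants and of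
  -- the four variables are read off from their eigenvalues.
  θ-mono : ∀ e i j k l → θ e (mono i j k l) ≋ ℕ→ℚ (e i j k l) ·S mono i j k l
  θ-mono e i j k l = pointwise λ a b c d → lemma (sameIndex i j k l a b c d)
    where
    lemma : ∀ {a b c d} → SameIndex i j k l a b c d → θ e (mono i j k l) a b c d ≡ ℕ→ℚ (e i j k l) ℚ.* mono i j k l a b c d
    lemma same = ≡.refl
    lemma {a} {b} {c} {d} (other ≢) rewrite mono-≢ i j k l ≢ =
      ≡.trans (ℚ.*-zeroʳ (ℕ→ℚ (e a b c d))) (≡.sym (ℚ.*-zeroʳ (ℕ→ℚ (e i j k l))))

  sumTo-+ : ∀ n (f g : ℕ → ℚ) → sumTo n (λ i → f i ℚ.+ g i) ≡ sumTo n f ℚ.+ sumTo n g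
  sumTo-+ zero    f g = ≡.refl
  sumTo-+ (suc n) f g = ≡.trans (≡.cong (ℚ._+ (f (suc n) ℚ.+ g (suc n))) (sumTo-+ n f g))
    (solve 4 (λ a b c d → (a :+ b) :+ (c :+ d) := (a :+ c) :+ (b :+ d)) ≡.refl (sumTo n f) (sumTo n g) (f (suc n)) (g (suc n)))
    where open +-*-Solver

  Additive : (ℕ → ℕ → ℕ → ℕ → ℕ) → Set
  Additive e = ∀ {a b c d i j k l} → i ℕ.≤ a → j ℕ.≤ b → k ℕ.≤ c → l ℕ.≤ d →
    e a b c d ≡ e i j k l ℕ.+ e (a ∸ i) (b ∸ j) (c ∸ k) (d ∸ l)

  -- In each term of the product the exponents of the factors add up to that of the coefficient, so
  -- the multiplier splits term by term. The bounds on the indices make the truncated differences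
  -- genuine ones.
  θ-leibniz : ∀ e → Additive e → ∀ f g → θ e (f *S g) ≋ θ e f *S g +S f *S θ e g
  θ-leibniz e e-+ f g = pointwise λ a b c d →
    let N = ℕ→ℚ (e a b c d)
        T = λ i j k l → f i j k l ℚ.* g (a ∸ i) (b ∸ j) (c ∸ k) (d ∸ l)
        U = λ i j k l → θ e f i j k l ℚ.* g (a ∸ i) (b ∸ j) (c ∸ k) (d ∸ l)
        V = λ i j k l → f i j k l ℚ.* θ e g (a ∸ i) (b ∸ j) (c ∸ k) (d ∸ l)
    in
    distribute a N (λ i → sumTo b λ j → sumTo c λ k → sumTo d λ l → T i j k l)
                   (λ i → sumTo b λ j → sumTo c λ k → sumTo d λ l → U i j k l)
                   (λ i → sumTo b λ j → sumTo c λ k → sumTo d λ l → V i j k l) λ i i≤ →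
    distribute b N (λ j → sumTo c λ k → sumTo d λ l → T i j k l)
                   (λ j → sumTo c λ k → sumTo d λ l → U i j k l)
                   (λ j → sumTo c λ k → sumTo d λ l → V i j k l) λ j j≤ →
    distribute c N (λ k → sumTo d λ l → T i j k l)
                   (λ k → sumTo d λ l → U i j k l)
                   (λ k → sumTo d λ l → V i j k l) λ k k≤ →
    distribute d N (λ l → T i j k l) (λ l → U i j k l) (λ l → V i j k l) λ l l≤ →
    ≡.trans (≡.cong (ℚ._* T i j k l) (≡.trans (≡.cong ℕ→ℚ (e-+ i≤ j≤ k≤ l≤)) (ℕ→ℚ-+ (e i j k l) _)))
      (solve 4 (λ u v p q → (u :+ v) :* (p :* q) := u :* p :* q :+ p :* (v :* q)) ≡.refl
        (ℕ→ℚ (e i j k l)) (ℕ→ℚ (e (a ∸ i) (b ∸ j) (c ∸ k) (d ∸ l))) (f i j k l) (g (a ∸ i) (b ∸ j) (c ∸ k) (d ∸ l)))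
    where
    open +-*-Solver
    distribute : ∀ n r (t u v : ℕ → ℚ) → (∀ i → i ℕ.≤ n → r ℚ.* t i ≡ u i ℚ.+ v i) →
      r ℚ.* sumTo n t ≡ sumTo n u ℚ.+ sumTo n v
    distribute n r t u v h = ≡.trans (≡.sym (sumTo-*ˡ n r t)) (≡.trans (sumTo-cong n h) (sumTo-+ n u v))

  module Variable (v : Series) (∂ : Series → Series) (e : ℕ → ℕ → ℕ → ℕ → ℕ) (e-+ : Additive e)
    (v*-cancel : ∀ {f g} → v *S f ≋ v *S g → f ≋ g)
    (∂-cong : ∀ {f g} → f ≋ g → ∂ f ≋ ∂ g) (∂-+ : ∀ f g → ∂ (f +S g) ≋ ∂ f +S ∂ g)
    (v*∂ : ∀ f → v *S ∂ f ≋ θ e f) (e-0 : e 0 0 0 0 ≡ 0) where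

    open SA using (module Solver; solve; _:=_; _:+_; _:*_)

    v*∂≋θ : ∀ f → v *S ∂ f ≋ θ e f
    v*∂≋θ = v*∂

    ∂-leibniz : ∀ f g → ∂ (f *S g) ≋ ∂ f *S g +S f *S ∂ g
    ∂-leibniz f g = v*-cancel (trans (v*∂ (f *S g)) (trans (θ-leibniz e e-+ f g)
      (trans (+-cong {θ e f *S g} {v *S ∂ f *S g} {f *S θ e g} {f *S (v *S ∂ g)}
               (*-congʳ {g} {θ e f} {v *S ∂ f} (sym (v*∂ f))) (*-congˡ {f} {θ e g} {v *S ∂ g} (sym (v*∂ g))))
        (solve 5 (λ v df g f dg → v :* df :* g :+ f :* (v :* dg) := v :* (df :* g :+ f :* dg)) refl v (∂ f) g f (∂ g)))))

    ∂-con : ∀ r → ∂ (constS r) ≋ zeroS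
    ∂-con r = v*-cancel (trans (v*∂ (constS r)) (trans (pointwise (λ a b c d → lemma a b c d)) (sym (zeroʳ v))))
      where
      open +-*-Solver using () renaming (solve to solveℚ; _:*_ to _⊗_; _:=_ to _⊜_; con to conℚ)
      lemma : ∀ a b c d → θ e (constS r) a b c d ≡ 0ℚ
      lemma a b c d = ≡.trans (solveℚ 3 (λ n r m → n ⊗ (r ⊗ m) ⊜ r ⊗ (n ⊗ m)) ≡.refl (ℕ→ℚ (e a b c d)) r (oneS a b c d))
        (≡.trans (≡.cong (r ℚ.*_) (≡.trans (at (θ-mono e 0 0 0 0) a b c d)
          (≡.trans (≡.cong (λ n → ℕ→ℚ n ℚ.* oneS a b c d) e-0) (ℚ.*-zeroˡ (oneS a b c d))))) (ℚ.*-zeroʳ r))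

    isDerivation : IsDerivation ∂
    isDerivation = record { D-cong = ∂-cong ; D-+ = ∂-+ ; leibniz = ∂-leibniz ; D-con = ∂-con }

    ∂-own : ∀ {i j k l} → mono i j k l ≡ v → e i j k l ≡ 1 → ∂ v ≋ oneS
    ∂-own {i} {j} {k} {l} ≡.refl e≡1 = v*-cancel (trans (v*∂ v) (trans (θ-mono e i j k l)
      (trans (pointwise λ a b c d → ≡.trans (≡.cong (λ n → ℕ→ℚ n ℚ.* v a b c d) e≡1) (ℚ.*-identityˡ (v a b c d)))
        (sym (*-identityʳ v)))))

    ∂-other : ∀ i j k l → e i j k l ≡ 0 → ∂ (mono i j k l) ≋ zeroS
    ∂-other i j k l e≡0 = v*-cancel (trans (v*∂ (mono i j k l)) (trans (θ-mono e i j k l)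
      (trans (pointwise λ a b c d → ≡.trans (≡.cong (λ n → ℕ→ℚ n ℚ.* mono i j k l a b c d) e≡0) (ℚ.*-zeroˡ (mono i j k l a b c d)))
        (sym (zeroʳ v)))))

  ∂z : Series → Series
  ∂z f a b c d = ℕ→ℚ (suc d) ℚ.* f a b c (suc d)

  private
    θ-zero : ∀ r → 0ℚ ≡ ℕ→ℚ 0 ℚ.* r
    θ-zero r = ≡.sym (ℚ.*-zeroˡ r)

  X*-cancel : ∀ {f g} → X *S f ≋ X *S g → f ≋ g
  X*-cancel {f} {g} p = pointwise λ a b c d →
    ≡.trans (≡.sym (X*-suc f a b c d)) (≡.trans (at p (suc a) b c d) (X*-suc g a b c d))

  X*∂x : ∀ f → X *S ∂x f ≋ θ (λ a b c d → a) f
  X*∂x f = pointwise λ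
    { zero b c d → ≡.trans (X*-zero (∂x f) b c d) (θ-zero (f 0 b c d))
    ; (suc a) b c d → X*-suc (∂x f) a b c d }

  Y*-cancel : ∀ {f g} → Y *S f ≋ Y *S g → f ≋ g
  Y*-cancel {f} {g} p = pointwise λ a b c d →
    ≡.trans (≡.sym (Y*-suc f a b c d)) (≡.trans (at p a (suc b) c d) (Y*-suc g a b c d))

  Y*∂y : ∀ f → Y *S ∂y f ≋ θ (λ a b c d → b) f
  Y*∂y f = pointwise λ
    { a zero c d → ≡.trans (Y*-zero (∂y f) a c d) (θ-zero (f a 0 c d))
    ; a (suc b) c d → Y*-suc (∂y f) a b c d }

  Z*-cancel : ∀ {f g} → Z *S f ≋ Z *S g → f ≋ g
  Z*-cancel {f} {g} p = pointwise λ a b c d →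
    ≡.trans (≡.sym (Z*-suc f a b c d)) (≡.trans (at p a b c (suc d)) (Z*-suc g a b c d))

  Z*∂z : ∀ f → Z *S ∂z f ≋ θ (λ a b c d → d) f
  Z*∂z f = pointwise λ
    { a b c zero → ≡.trans (Z*-zero (∂z f) a b c) (θ-zero (f a b c 0))
    ; a b c (suc d) → Z*-suc (∂z f) a b c d }

  module ∂X = Variable X ∂x (λ a b c d → a) (λ p _ _ _ → ≡.sym (ℕ.m+[n∸m]≡n p)) X*-cancel
    (λ p → pointwise λ a b c d → ≡.cong (ℕ→ℚ (suc a) ℚ.*_) (at p (suc a) b c d))
    (λ f g → pointwise λ a b c d → ℚ.*-distribˡ-+ (ℕ→ℚ (suc a)) (f (suc a) b c d) (g (suc a) b c d))
    X*∂x ≡.refl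

  module ∂Y = Variable Y ∂y (λ a b c d → b) (λ _ p _ _ → ≡.sym (ℕ.m+[n∸m]≡n p)) Y*-cancel
    (λ p → pointwise λ a b c d → ≡.cong (ℕ→ℚ (suc b) ℚ.*_) (at p a (suc b) c d))
    (λ f g → pointwise λ a b c d → ℚ.*-distribˡ-+ (ℕ→ℚ (suc b)) (f a (suc b) c d) (g a (suc b) c d))
    Y*∂y ≡.refl

  module ∂Z = Variable Z ∂z (λ a b c d → d) (λ _ _ _ p → ≡.sym (ℕ.m+[n∸m]≡n p)) Z*-cancel
    (λ p → pointwise λ a b c d → ≡.cong (ℕ→ℚ (suc d) ℚ.*_) (at p a b c (suc d)))
    (λ f g → pointwise λ a b c d → ℚ.*-distribˡ-+ (ℕ→ℚ (suc d)) (f a b c (suc d)) (g a b c (suc d)))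
    Z*∂z ≡.refl

  -- A coefficient of a monomial is 1 or 0 according to whether the exponents agree, so equivalence
  -- of the two agreements suffices. Multiplication by a variable raises the same exponent on both
  -- sides.
  mono-via-shift : ∀ {i j k l a b c d} → SameIndex i j k l a b c d → ∀ i′ j′ k′ l′ a′ b′ c′ d′ →
    (i ≡ a → j ≡ b → k ≡ c → l ≡ d → (i′ ≡ a′) × (j′ ≡ b′) × (k′ ≡ c′) × (l′ ≡ d′)) →
    (i′ ≡ a′ → j′ ≡ b′ → k′ ≡ c′ → l′ ≡ d′ → (i ≡ a) × (j ≡ b) × (k ≡ c) × (l ≡ d)) →
    mono i j k l a b c d ≡ mono i′ j′ k′ l′ a′ b′ c′ d′
  mono-via-shift {i} {j} {k} {l} same i′ j′ k′ l′ a′ b′ c′ d′ to from with to ≡.refl ≡.refl ≡.refl ≡.refl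
  ... | ≡.refl , ≡.refl , ≡.refl , ≡.refl = ≡.trans (mono-≡ i j k l) (≡.sym (mono-≡ i′ j′ k′ l′))
  mono-via-shift {i} {j} {k} {l} (other ≢) i′ j′ k′ l′ a′ b′ c′ d′ to from =
    ≡.trans (mono-≢ i j k l ≢) (≡.sym (mono-≢ i′ j′ k′ l′ λ p q r s → let p , q , r , s = from p q r s in ≢ p q r s))

  X*mono : ∀ i j k → X *S mono i j k 0 ≋ mono (suc i) j k 0
  X*mono i j k = pointwise λ
    { zero    b c d → ≡.trans (X*-zero (mono i j k 0) b c d) ≡.refl
    ; (suc a) b c d → ≡.trans (X*-suc (mono i j k 0) a b c d) (mono-via-shift (sameIndex i j k 0 a b c d) (suc i) j k 0 (suc a) b c d
        (λ p q r s → ≡.cong suc p , q , r , s) (λ p q r s → ℕ.suc-injective p , q , r , s)) }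

  Y*mono : ∀ i j k → Y *S mono i j k 0 ≋ mono i (suc j) k 0
  Y*mono i j k = pointwise λ
    { a zero    c d → ≡.trans (Y*-zero (mono i j k 0) a c d) (≡.sym (mono-≢ i (suc j) k 0 {a} {0} {c} {d} λ _ ()))
    ; a (suc b) c d → ≡.trans (Y*-suc (mono i j k 0) a b c d) (mono-via-shift (sameIndex i j k 0 a b c d) i (suc j) k 0 a (suc b) c d
        (λ p q r s → p , ≡.cong suc q , r , s) (λ p q r s → p , ℕ.suc-injective q , r , s)) }

  Q*mono : ∀ i j k → Qv *S mono i j k 0 ≋ mono i j (suc k) 0
  Q*mono i j k = pointwise λ
    { a b zero    d → ≡.trans (Q*-zero (mono i j k 0) a b d) (≡.sym (mono-≢ i j (suc k) 0 {a} {b} {0} {d} λ _ _ ()))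
    ; a b (suc c) d → ≡.trans (Q*-suc (mono i j k 0) a b c d) (mono-via-shift (sameIndex i j k 0 a b c d) i j (suc k) 0 a b (suc c) d
        (λ p q r s → p , q , ≡.cong suc r , s) (λ p q r s → p , q , ℕ.suc-injective r , s)) }

-- Derivatives of the exponential, the logarithm and the geometric series.

module ExpAndLog where
  open import Defs renaming (_≈_ to _≈S_)
  open Rationals
  open PowerSeries
  open SeriesRing
  open import Data.Nat.Solver using () renaming (module +-*-Solver to ℕ-Solver)
  open ≡ using (_≡_; _≢_)
  open SA hiding (zero)

  infix 4 _≈[_]_
  -- This congruence for the ring operations turns a sum cut off at the degree of each coefficient
  -- into one fixed finite sum; agreement for all `N` gives back equality.
  record _≈[_]_ (f : Series) (N : ℕ) (g : Series) : Set where
    constructor truncated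
    field at≤ : ∀ a b c d → deg a b c d ℕ.≤ N → f a b c d ≡ g a b c d
  open _≈[_]_

  ≋⇒≈[] : ∀ {f g N} → f ≋ g → f ≈[ N ] g
  ≋⇒≈[] p = truncated λ a b c d _ → at p a b c d

  ≈[]⇒≋ : ∀ {f g} → (∀ N → f ≈[ N ] g) → f ≋ g
  ≈[]⇒≋ p = pointwise λ a b c d → at≤ (p (deg a b c d)) a b c d ℕ.≤-refl

  ≈[]-trans : ∀ {f g h N} → f ≈[ N ] g → g ≈[ N ] h → f ≈[ N ] h
  ≈[]-trans p q = truncated λ a b c d ≤N → ≡.trans (at≤ p a b c d ≤N) (at≤ q a b c d ≤N)

  ≈[]-sym : ∀ {f g N} → f ≈[ N ] g → g ≈[ N ] f
  ≈[]-sym p = truncated λ a b c d ≤N → ≡.sym (at≤ p a b c d ≤N)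

  ≈[]-weaken : ∀ {f g M N} → M ℕ.≤ N → f ≈[ N ] g → f ≈[ M ] g
  ≈[]-weaken M≤N p = truncated λ a b c d ≤M → at≤ p a b c d (ℕ.≤-trans ≤M M≤N)

  ≈[]-+ : ∀ {f f′ g g′ N} → f ≈[ N ] f′ → g ≈[ N ] g′ → f +S g ≈[ N ] f′ +S g′
  ≈[]-+ p q = truncated λ a b c d ≤N → ≡.cong₂ ℚ._+_ (at≤ p a b c d ≤N) (at≤ q a b c d ≤N)

  ≈[]-neg : ∀ {f f′ N} → f ≈[ N ] f′ → -S f ≈[ N ] -S f′
  ≈[]-neg p = truncated λ a b c d ≤N → ≡.cong ℚ.-_ (at≤ p a b c d ≤N)

  deg-mono-≤ : ∀ {a b c d i j k l} → i ℕ.≤ a → j ℕ.≤ b → k ℕ.≤ c → l ℕ.≤ d → deg i j k l ℕ.≤ deg a b c d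
  deg-mono-≤ p q r s = ℕ.+-mono-≤ (ℕ.+-mono-≤ (ℕ.+-mono-≤ p q) r) s

  *S-cong-≤ : ∀ (f f′ g g′ : Series) a b c d →
    (∀ i j k l → i ℕ.≤ a → j ℕ.≤ b → k ℕ.≤ c → l ℕ.≤ d →
       f i j k l ℚ.* g (a ∸ i) (b ∸ j) (c ∸ k) (d ∸ l) ≡ f′ i j k l ℚ.* g′ (a ∸ i) (b ∸ j) (c ∸ k) (d ∸ l)) →
    (f *S g) a b c d ≡ (f′ *S g′) a b c d
  *S-cong-≤ f f′ g g′ a b c d h = sumTo-cong a λ i i≤ → sumTo-cong b λ j j≤ → sumTo-cong c λ k k≤ → sumTo-cong d λ l l≤ → h i j k l i≤ j≤ k≤ l≤

  ≈[]-* : ∀ {f f′ g g′ N} → f ≈[ N ] f′ → g ≈[ N ] g′ → f *S g ≈[ N ] f′ *S g′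
  ≈[]-* {f} {f′} {g} {g′} p q = truncated λ a b c d ≤N → *S-cong-≤ f f′ g g′ a b c d λ i j k l i≤ j≤ k≤ l≤ → ≡.cong₂ ℚ._*_
    (at≤ p i j k l (ℕ.≤-trans (deg-mono-≤ i≤ j≤ k≤ l≤) ≤N))
    (at≤ q (a ∸ i) (b ∸ j) (c ∸ k) (d ∸ l) (ℕ.≤-trans (deg-mono-≤ (ℕ.m∸n≤m a i) (ℕ.m∸n≤m b j) (ℕ.m∸n≤m c k) (ℕ.m∸n≤m d l)) ≤N))

  record Order≥ (m : ℕ) (f : Series) : Set where
    constructor order
    field vanishes : ∀ a b c d → deg a b c d ℕ.< m → f a b c d ≡ 0ℚ
  open Order≥

  deg-split : ∀ {a b c d i j k l} → i ℕ.≤ a → j ℕ.≤ b → k ℕ.≤ c → l ℕ.≤ d →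
    deg i j k l ℕ.+ deg (a ∸ i) (b ∸ j) (c ∸ k) (d ∸ l) ≡ deg a b c d
  deg-split {a} {b} {c} {d} {i} {j} {k} {l} p q r s = ≡.trans
    (solveℕ 8 (λ i j k l a b c d → i ⊕ j ⊕ k ⊕ l ⊕ (a ⊕ b ⊕ c ⊕ d) ⊜ (i ⊕ a) ⊕ (j ⊕ b) ⊕ (k ⊕ c) ⊕ (l ⊕ d)) ≡.refl i j k l _ _ _ _)
    (≡.cong₂ ℕ._+_ (≡.cong₂ ℕ._+_ (≡.cong₂ ℕ._+_ (ℕ.m+[n∸m]≡n p) (ℕ.m+[n∸m]≡n q)) (ℕ.m+[n∸m]≡n r)) (ℕ.m+[n∸m]≡n s))
    where open ℕ-Solver using () renaming (solve to solveℕ; _:+_ to _⊕_; _:=_ to _⊜_)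

  sumTo-0 : ∀ n {f : ℕ → ℚ} → (∀ i → i ℕ.≤ n → f i ≡ 0ℚ) → sumTo n f ≡ 0ℚ
  sumTo-0 zero    h = h 0 z≤n
  sumTo-0 (suc n) h = ≡.cong₂ ℚ._+_ (sumTo-0 n (λ i i≤ → h i (ℕ.m≤n⇒m≤1+n i≤))) (h (suc n) ℕ.≤-refl)

  -- The degrees of the two factors of each term add up to the total degree; if that is below m + n,
  -- one factor has degree below m or the other below n.
  order-* : ∀ {m n f g} → Order≥ m f → Order≥ n g → Order≥ (m ℕ.+ n) (f *S g)
  order-* {m} {n} {f} {g} p q = order λ a b c d <m+n →
    sumTo-0 a λ i i≤ → sumTo-0 b λ j j≤ → sumTo-0 c λ k k≤ → sumTo-0 d λ l l≤ → term (≡.subst (ℕ._< m ℕ.+ n) (≡.sym (deg-split i≤ j≤ k≤ l≤)) <m+n)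
    where
    term : ∀ {i j k l a b c d} → deg i j k l ℕ.+ deg a b c d ℕ.< m ℕ.+ n → f i j k l ℚ.* g a b c d ≡ 0ℚ
    term {i} {j} {k} {l} {a} {b} {c} {d} h with deg i j k l ℕ.<? m
    ... | yes <m = ≡.trans (≡.cong (ℚ._* g a b c d) (vanishes p i j k l <m)) (ℚ.*-zeroˡ (g a b c d))
    ... | no ≮m  = ≡.trans (≡.cong (f i j k l ℚ.*_) (vanishes q a b c d
                     (ℕ.+-cancelˡ-< m _ _ (ℕ.≤-<-trans (ℕ.+-monoˡ-≤ _ (ℕ.≮⇒≥ ≮m)) h)))) (ℚ.*-zeroʳ (f i j k l))

  order-1 : ∀ {f} → f 0 0 0 0 ≡ 0ℚ → Order≥ 1 f
  order-1 p = order λ { zero zero zero zero _ → p ; (suc _) _ _ _ (s≤s ()) ; zero (suc _) _ _ (s≤s ()) ; zero zero (suc _) _ (s≤s ()) ; zero zero zero (suc _) (s≤s ()) }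

  order-pow : ∀ f → f 0 0 0 0 ≡ 0ℚ → ∀ m → Order≥ m (powS f m)
  order-pow f p zero    = order λ _ _ _ _ ()
  order-pow f p (suc m) = order-* {1} {m} {f} {powS f m} (order-1 {f} p) (order-pow f p m)

  order⇒≈[]0 : ∀ {f N} → Order≥ (suc N) f → f ≈[ N ] zeroS
  order⇒≈[]0 p = truncated λ a b c d ≤N → vanishes p a b c d (s≤s ≤N)

  sumTo-extend : ∀ {n N} → n ℕ.≤ N → (f : ℕ → ℚ) → (∀ m → n ℕ.< m → f m ≡ 0ℚ) → sumTo n f ≡ sumTo N f
  sumTo-extend {n} n≤N f h = extend (ℕ.≤⇒≤′ n≤N)
    where
    extend : ∀ {N} → n ℕ.≤′ N → sumTo n f ≡ sumTo N f
    extend (ℕ.≤′-reflexive ≡.refl) = ≡.refl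
    extend (ℕ.≤′-step {N} n≤N) = ≡.trans (extend n≤N) (≡.trans (≡.sym (ℚ.+-identityʳ (sumTo N f)))
      (≡.cong (sumTo N f ℚ.+_) (≡.sym (h (suc N) (s≤s (ℕ.≤′⇒≤ n≤N))))))

  ∑<-at : ∀ n (F : ℕ → Series) a b c d → ∑< (suc n) F a b c d ≡ sumTo n (λ m → F m a b c d)
  ∑<-at zero    F a b c d = ℚ.+-identityˡ _
  ∑<-at (suc n) F a b c d = ≡.cong (ℚ._+ F (suc n) a b c d) (∑<-at n F a b c d)

  -- Sums Σ F m with F m of order at least m, cut off at the total degree as in expS, logS and invS.
  infiniteSum : (ℕ → Series) → Series
  infiniteSum F a b c d = sumTo (deg a b c d) λ m → F m a b c d

  infiniteSum-≈[] : ∀ F → (∀ m → Order≥ m (F m)) → ∀ N → infiniteSum F ≈[ N ] ∑< (suc N) F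
  infiniteSum-≈[] F ord N = truncated λ a b c d ≤N → ≡.trans
    (sumTo-extend ≤N (λ m → F m a b c d) (λ m <m → vanishes (ord m) a b c d <m))
    (≡.sym (∑<-at N F a b c d))

  powS≡pow : ∀ f n → powS f n ≡ pow f n
  powS≡pow f zero    = ≡.refl
  powS≡pow f (suc n) = ≡.cong (f *S_) (powS≡pow f n)

  -- Such derivations may be applied to the cut-off sums of infiniteSum termwise.
  record DegreeDerivation (D : Series → Series) : Set where
    field
      isDerivation : IsDerivation D
      lowers       : ∀ {f g N} → f ≈[ suc N ] g → D f ≈[ N ] D g
    open IsDerivation isDerivation public

  order-· : ∀ {m f} r → Order≥ m f → Order≥ m (r ·S f)
  order-· r p = order λ a b c d < → ≡.trans (≡.cong (r ℚ.*_) (vanishes p a b c d <)) (ℚ.*-zeroʳ r)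

  order-weaken : ∀ {m f} → Order≥ (suc m) f → Order≥ m f
  order-weaken p = order λ a b c d < → vanishes p a b c d (ℕ.m<n⇒m<1+n <)

  D-· : ∀ {D} → IsDerivation D → ∀ r f → D (r ·S f) ≋ constS r *S D f
  D-· isD r f = trans (D-cong (sym (constS-* r f))) (D-con* r f)
    where open IsDerivation isD

  geometric : Series → Series
  geometric u = infiniteSum (powS u)

  -- The partial sums telescope to 1 - u^(N+1), and the power of u vanishes up to total degree N.
  geometric-inverse : ∀ u → u 0 0 0 0 ≡ 0ℚ → (oneS -S u) *S geometric u ≋ oneS
  geometric-inverse u u₀ = ≈[]⇒≋ λ N → ≈[]-trans
    (≈[]-* {oneS -S u} {oneS -S u} {geometric u} {∑< (suc N) (powS u)} (≋⇒≈[] refl) (infiniteSum-≈[] (powS u) (order-pow u u₀) N))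
    (≈[]-trans (≋⇒≈[] (telescope (suc N)))
      (≈[]-trans (≈[]-+ (≋⇒≈[] (refl {oneS})) (≈[]-neg (order⇒≈[]0 (order-pow u u₀ (suc N)))))
        (≋⇒≈[] (pointwise λ a b c d → ℚ.+-identityʳ _))))
    where
    telescope : ∀ n → (oneS -S u) *S ∑< n (powS u) ≋ oneS -S powS u n
    telescope zero    = trans (zeroʳ (oneS -S u)) (sym (-‿inverseʳ oneS))
    telescope (suc n) = begin
      (oneS -S u) *S (∑< n (powS u) +S powS u n)                     ≈⟨ distribˡ (oneS -S u) (∑< n (powS u)) (powS u n) ⟩
      (oneS -S u) *S ∑< n (powS u) +S (oneS -S u) *S powS u n        ≈⟨ +-cong (telescope n) (distribʳ (powS u n) oneS (-S u)) ⟩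
      oneS -S powS u n +S (oneS *S powS u n +S (-S u) *S powS u n)   ≈⟨ +-congˡ {oneS -S powS u n} (+-congʳ {(-S u) *S powS u n} (*-identityˡ (powS u n))) ⟩
      oneS -S powS u n +S (powS u n +S (-S u) *S powS u n)           ≈⟨ solve 3 (λ o p u → o :- p :+ (p :+ (:- u) :* p) := o :- u :* p) refl oneS (powS u n) u ⟩
      oneS -S u *S powS u n                                          ∎

  module _ {D : Series → Series} (isDD : DegreeDerivation D) where
    open DegreeDerivation isDD

    -- Since `D` costs one degree of agreement, `F` is summed one degree further than `G`. The
    -- offset `i` is 0 for the exponential, where differentiation loses the constant term, and 1 for
    -- the logarithm, whose term of index m already contains u^(m+1).
    D-infiniteSum : ∀ i F G u → (∀ m → Order≥ m (F m)) → (∀ m → Order≥ m (G m)) →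
      (∀ N → D (∑< (suc (suc N)) F) ≋ ∑< (suc (i ℕ.+ N)) G *S D u) → D (infiniteSum F) ≋ infiniteSum G *S D u
    D-infiniteSum i F G u ordF ordG step = ≈[]⇒≋ λ N → ≈[]-trans
      (lowers (infiniteSum-≈[] F ordF (suc N)))
      (≈[]-trans (≋⇒≈[] (step N)) (≈[]-* {∑< (suc (i ℕ.+ N)) G} {infiniteSum G} {D u} {D u} (≈[]-sym (≈[]-weaken (ℕ.m≤n+m N i) (infiniteSum-≈[] G ordG (i ℕ.+ N)))) (≋⇒≈[] refl)))

    D-pow-· : ∀ r u n → D (r ·S powS u (suc n)) ≋ ((r ℚ.* ℕ→ℚ (suc n)) ·S powS u n) *S D u
    D-pow-· r u n = begin
      D (r ·S powS u (suc n))                             ≈⟨ D-· isDerivation r _ ⟩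
      constS r *S D (powS u (suc n))                      ≡⟨ ≡.cong (λ p → constS r *S D p) (powS≡pow u (suc n)) ⟩
      constS r *S D (pow u (suc n))                       ≈⟨ *-congˡ {constS r} (D-pow n u) ⟩
      constS r *S (ι (suc n) *S pow u n *S D u)           ≡⟨ ≡.cong (λ p → constS r *S (ι (suc n) *S p *S D u)) (powS≡pow u n) ⟨
      constS r *S (ι (suc n) *S powS u n *S D u)          ≈⟨ solve 4 (λ r i p d → r :* (i :* p :* d) := r :* i :* p :* d) refl (constS r) (ι (suc n)) (powS u n) (D u) ⟩
      constS r *S ι (suc n) *S powS u n *S D u            ≈⟨ *-congʳ {D u} (*-congʳ {powS u n} (*-homo r (ℕ→ℚ (suc n)))) ⟨
      constS (r ℚ.* ℕ→ℚ (suc n)) *S powS u n *S D u       ≈⟨ *-congʳ {D u} (constS-* (r ℚ.* ℕ→ℚ (suc n)) (powS u n)) ⟩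
      ((r ℚ.* ℕ→ℚ (suc n)) ·S powS u n) *S D u            ∎

    D-expS : ∀ H → H 0 0 0 0 ≡ 0ℚ → D (expS H) ≋ expS H *S D H
    D-expS H H₀ = D-infiniteSum 0 F F H ord ord (λ N → step (suc N))
      where
      F : ℕ → Series
      F m = recip (ℕ→ℚ (m !)) ·S powS H m
      ord : ∀ m → Order≥ m (F m)
      ord m = order-· {f = powS H m} (recip (ℕ→ℚ (m !))) (order-pow H H₀ m)
      step : ∀ n → D (∑< (suc n) F) ≋ ∑< n F *S D H
      step zero    = begin
        D (zeroS +S F 0)       ≈⟨ D-cong (+-identityˡ (F 0)) ⟩
        D (F 0)                ≈⟨ D-con (recip (ℕ→ℚ 1)) ⟩
        zeroS                  ≈⟨ zeroˡ (D H) ⟨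
        zeroS *S D H           ∎
      step (suc n) = begin
        D (∑< (suc n) F +S F (suc n))              ≈⟨ D-+ _ _ ⟩
        D (∑< (suc n) F) +S D (F (suc n))          ≈⟨ +-cong (step n) (D-pow-· (recip (ℕ→ℚ (suc n !))) H n) ⟩
        ∑< n F *S D H +S ((recip (ℕ→ℚ (suc n !)) ℚ.* ℕ→ℚ (suc n)) ·S powS H n) *S D H
                                                   ≡⟨ ≡.cong (λ r → ∑< n F *S D H +S (r ·S powS H n) *S D H) (recip-! n) ⟩
        ∑< n F *S D H +S F n *S D H                ≈⟨ distribʳ (D H) (∑< n F) (F n) ⟨
        (∑< n F +S F n) *S D H                     ∎

    -- The geometric series in 1 - G plays the part of 1/G. The minus sign in front of the logarithm
    -- cancels against that of D(1 - G).
    D-logS : ∀ G → G 0 0 0 0 ≡ 1ℚ → D (logS G) ≋ geometric (oneS -S G) *S D G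
    D-logS G G₀ = begin
      D (-S infiniteSum F)          ≈⟨ D-neg _ ⟩
      -S D (infiniteSum F)          ≈⟨ -‿cong (D-infiniteSum 1 F (powS u) u (λ m → order-weaken (ord m)) (order-pow u u₀) (λ N → step (suc (suc N)))) ⟩
      -S (geometric u *S D u)       ≈⟨ -‿cong (*-congˡ {geometric u} (trans (D-minus oneS G) (+-congʳ {(-S D G)} D-1))) ⟩
      -S (geometric u *S (zeroS -S D G)) ≈⟨ -‿cong (*-congˡ {geometric u} (+-identityˡ (-S D G))) ⟩
      -S (geometric u *S (-S D G))  ≈⟨ solve 2 (λ g d → :- (g :* (:- d)) := g :* d) refl (geometric u) (D G) ⟩
      geometric u *S D G            ∎
      where
      u = oneS -S G
      u₀ : u 0 0 0 0 ≡ 0ℚ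
      u₀ = ≡.cong (λ g → 1ℚ ℚ.- g) G₀
      F : ℕ → Series
      F m = recip (ℕ→ℚ (suc m)) ·S powS u (suc m)
      ord : ∀ m → Order≥ (suc m) (F m)
      ord m = order-· {f = powS u (suc m)} (recip (ℕ→ℚ (suc m))) (order-pow u u₀ (suc m))
      step : ∀ n → D (∑< n F) ≋ ∑< n (powS u) *S D u
      step zero    = trans D-0 (sym (zeroˡ (D u)))
      step (suc n) = begin
        D (∑< n F +S F n)                                       ≈⟨ D-+ _ _ ⟩
        D (∑< n F) +S D (F n)                                   ≈⟨ +-cong (step n) (D-pow-· (recip (ℕ→ℚ (suc n))) u n) ⟩
        ∑< n (powS u) *S D u +S ((recip (ℕ→ℚ (suc n)) ℚ.* ℕ→ℚ (suc n)) ·S powS u n) *S D u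
          ≡⟨ ≡.cong (λ r → ∑< n (powS u) *S D u +S (r ·S powS u n) *S D u) (recip-inverse _ (ℕ→ℚ-suc≢0 n)) ⟩
        ∑< n (powS u) *S D u +S (1ℚ ·S powS u n) *S D u
          ≈⟨ +-congˡ {∑< n (powS u) *S D u} (*-congʳ {D u} (pointwise λ a b c d → ℚ.*-identityˡ (powS u n a b c d))) ⟩
        ∑< n (powS u) *S D u +S powS u n *S D u                 ≈⟨ distribʳ (D u) (∑< n (powS u)) (powS u n) ⟨
        (∑< n (powS u) +S powS u n) *S D u                      ∎

-- The differential equation of the closed form.

module ClosedForm where
  open import Defs renaming (_≈_ to _≈S_)
  open SeriesRing
  open PartialDerivatives
  open ExpAndLog
  open ≡ using (_≡_; _≢_)
  open SA hiding (zero)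
  open DegreeDerivation using (isDerivation)

  scaled : ∀ {D} A → IsDerivation D → IsDerivation (λ f → A *S D f)
  scaled {D} A isD = record
    { D-cong  = λ p → *-congˡ {A} (D-cong p)
    ; D-+     = λ f g → trans (*-congˡ {A} (D-+ f g)) (distribˡ A (D f) (D g))
    ; leibniz = λ f g → trans (*-congˡ {A} (leibniz f g))
        (solve 5 (λ A df g f dg → A :* (df :* g :+ f :* dg) := A :* df :* g :+ f :* (A :* dg)) refl A (D f) g f (D g))
    ; D-con   = λ r → trans (*-congˡ {A} (D-con r)) (zeroʳ A) }
    where open IsDerivation isD

  summed : ∀ {D D′} → IsDerivation D → IsDerivation D′ → IsDerivation (λ f → D f +S D′ f)
  summed {D} {D′} isD isD′ = record
    { D-cong  = λ p → +-cong (M.D-cong p) (M′.D-cong p)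
    ; D-+     = λ f g → trans (+-cong (M.D-+ f g) (M′.D-+ f g))
        (solve 4 (λ a b c d → a :+ b :+ (c :+ d) := a :+ c :+ (b :+ d)) refl (D f) (D g) (D′ f) (D′ g))
    ; leibniz = λ f g → trans (+-cong (M.leibniz f g) (M′.leibniz f g))
        (solve 6 (λ a b f g c d → a :* g :+ f :* b :+ (c :* g :+ f :* d) := (a :+ c) :* g :+ f :* (b :+ d)) refl (D f) (D g) f g (D′ f) (D′ g))
    ; D-con   = λ r → trans (+-cong (M.D-con r) (M′.D-con r)) (+-identityʳ zeroS) }
    where
    module M = IsDerivation isD
    module M′ = IsDerivation isD′

  scaled-degree : ∀ {D} A → DegreeDerivation D → DegreeDerivation (λ f → A *S D f)
  scaled-degree {D} A isD = record
    { isDerivation = scaled A (isDerivation isD)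
    ; lowers = λ {f} {g} p → ≈[]-* {A} {A} {D f} {D g} (≋⇒≈[] refl) (DegreeDerivation.lowers isD p) }

  summed-degree : ∀ {D D′} → DegreeDerivation D → DegreeDerivation D′ → DegreeDerivation (λ f → D f +S D′ f)
  summed-degree isD isD′ = record
    { isDerivation = summed (isDerivation isD) (isDerivation isD′)
    ; lowers = λ p → ≈[]-+ (DegreeDerivation.lowers isD p) (DegreeDerivation.lowers isD′ p) }

  ∂x-degree : DegreeDerivation ∂x
  ∂x-degree = record { isDerivation = ∂X.isDerivation
    ; lowers = λ p → truncated λ a b c d ≤N → ≡.cong (ℕ→ℚ (suc a) ℚ.*_) (_≈[_]_.at≤ p (suc a) b c d (s≤s ≤N)) }

  ∂y-degree : DegreeDerivation ∂y
  ∂y-degree = record { isDerivation = ∂Y.isDerivation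
    ; lowers = λ {_} {_} {N} p → truncated λ a b c d ≤N → ≡.cong (ℕ→ℚ (suc b) ℚ.*_) (_≈[_]_.at≤ p a (suc b) c d
        (≡.subst (ℕ._≤ suc N) (≡.cong (λ n → n ℕ.+ c ℕ.+ d) (≡.sym (ℕ.+-suc a b))) (s≤s ≤N))) }

  ∂z-degree : DegreeDerivation ∂z
  ∂z-degree = record { isDerivation = ∂Z.isDerivation
    ; lowers = λ {_} {_} {N} p → truncated λ a b c d ≤N → ≡.cong (ℕ→ℚ (suc d) ℚ.*_) (_≈[_]_.at≤ p a b c (suc d)
        (≡.subst (ℕ._≤ suc N) (≡.sym (ℕ.+-suc (a ℕ.+ b ℕ.+ c) d)) (s≤s ≤N))) }

  Ax Ay : Series
  Ax = ι 2 *S X *S (oneS -S X)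
  Ay = ι 2 *S X *S (oneS -S Y)

  L : Series → Series
  L f = Ax *S ∂x f +S Ay *S ∂y f

  L-derivation : IsDerivation L
  L-derivation = summed (scaled Ax ∂X.isDerivation) (scaled Ay ∂Y.isDerivation)

  private
    1·0 : ∀ A B → A *S oneS +S B *S zeroS ≋ A
    1·0 A B = trans (+-cong (*-identityʳ A) (zeroʳ B)) (+-identityʳ A)

    0·1 : ∀ A B → A *S zeroS +S B *S oneS ≋ B
    0·1 A B = trans (+-cong (zeroʳ A) (*-identityʳ B)) (+-identityˡ B)

    0·0 : ∀ A B → A *S zeroS +S B *S zeroS ≋ zeroS
    0·0 A B = trans (+-cong (zeroʳ A) (zeroʳ B)) (+-identityˡ zeroS)

  L-X : L X ≋ ι 2 *S X *S (oneS -S X)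
  L-X = trans (+-cong (*-congˡ {Ax} (∂X.∂-own {1} {0} {0} {0} ≡.refl ≡.refl)) (*-congˡ {Ay} (∂Y.∂-other 1 0 0 0 ≡.refl))) (1·0 Ax Ay)

  L-Y : L Y ≋ ι 2 *S X *S (oneS -S Y)
  L-Y = trans (+-cong (*-congˡ {Ax} (∂X.∂-other 0 1 0 0 ≡.refl)) (*-congˡ {Ay} (∂Y.∂-own {0} {1} {0} {0} ≡.refl ≡.refl))) (0·1 Ax Ay)

  L-Q : L Qv ≋ zeroS
  L-Q = trans (+-cong (*-congˡ {Ax} (∂X.∂-other 0 0 1 0 ≡.refl)) (*-congˡ {Ay} (∂Y.∂-other 0 0 1 0 ≡.refl))) (0·0 Ax Ay)

  L-Z : L Z ≋ zeroS
  L-Z = trans (+-cong (*-congˡ {Ax} (∂X.∂-other 0 0 0 1 ≡.refl)) (*-congˡ {Ay} (∂Y.∂-other 0 0 0 1 ≡.refl))) (0·0 Ax Ay)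

  -- The recurrence for the P n says that their exponential generating function F satisfies Δ F = q y F.
  Az : Series
  Az = oneS -S ι 2 *S X *S Z

  Δ : Series → Series
  Δ f = Az *S ∂z f +S (-S oneS) *S L f

  Δ-degree : DegreeDerivation Δ
  Δ-degree = summed-degree (scaled-degree Az ∂z-degree)
    (scaled-degree (-S oneS) (summed-degree (scaled-degree Ax ∂x-degree) (scaled-degree Ay ∂y-degree)))

  private
    Δ-free : ∀ v w → ∂z v ≋ zeroS → L v ≋ w → Δ v ≋ -S w
    Δ-free v w ∂v Lv = begin
      Az *S ∂z v +S (-S oneS) *S L v   ≈⟨ +-cong (*-congˡ {Az} ∂v) (*-congˡ { -S oneS} Lv) ⟩
      Az *S zeroS +S (-S oneS) *S w    ≈⟨ +-cong (zeroʳ Az) (*-congʳ {w} (-‿cong (sym 1-homo))) ⟩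
      zeroS +S (-S ⟪ 1ℚ ⟫) *S w        ≈⟨ +-identityˡ _ ⟩
      (-S ⟪ 1ℚ ⟫) *S w                 ≈⟨ solve 1 (λ w → (:- 1′) :* w := :- w) refl w ⟩
      -S w                             ∎

  open DegreeDerivation Δ-degree using (D-cong; D-+; D-minus; leibniz; D-con*; D-1)

  private
    one : ∀ f → oneS -S f ≋ ⟪ 1ℚ ⟫ -S f
    one f = +-congʳ { -S f} (sym 1-homo)

    one′ : ∀ f → f -S oneS ≋ f -S ⟪ 1ℚ ⟫
    one′ f = +-congˡ {f} (-‿cong (sym 1-homo))

  Δ-X : Δ X ≋ -S (ι 2 *S X *S (⟪ 1ℚ ⟫ -S X))
  Δ-X = trans (Δ-free X (ι 2 *S X *S (oneS -S X)) (∂Z.∂-other 1 0 0 0 ≡.refl) L-X) (-‿cong (*-congˡ {ι 2 *S X} (one X)))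

  Δ-Y : Δ Y ≋ -S (ι 2 *S X *S (⟪ 1ℚ ⟫ -S Y))
  Δ-Y = trans (Δ-free Y (ι 2 *S X *S (oneS -S Y)) (∂Z.∂-other 0 1 0 0 ≡.refl) L-Y) (-‿cong (*-congˡ {ι 2 *S X} (one Y)))

  Δ-Q : Δ Qv ≋ ⟪ 0ℚ ⟫
  Δ-Q = trans (Δ-free Qv zeroS (∂Z.∂-other 0 0 1 0 ≡.refl) L-Q) (trans (pointwise λ _ _ _ _ → ≡.refl) (sym 0-homo))

  Δ-Z : Δ Z ≋ ⟪ 1ℚ ⟫ -S ι 2 *S X *S Z
  Δ-Z = begin
    Az *S ∂z Z +S (-S oneS) *S L Z       ≈⟨ +-cong (*-congˡ {Az} (∂Z.∂-own {0} {0} {0} {1} ≡.refl ≡.refl)) (*-congˡ { -S oneS} L-Z) ⟩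
    Az *S oneS +S (-S oneS) *S zeroS     ≈⟨ 1·0 Az (-S oneS) ⟩
    Az                                   ≈⟨ one (ι 2 *S X *S Z) ⟩
    ⟪ 1ℚ ⟫ -S ι 2 *S X *S Z              ∎

  Δ-minus-1 : ∀ f → Δ (f -S oneS) ≋ Δ f
  Δ-minus-1 f = trans (D-minus f oneS) (trans (+-congˡ {Δ f} (-‿cong D-1)) (pointwise λ a b c d → ℚ.+-identityʳ (Δ f a b c d)))

  W E V U H₁ H₂ : Series
  W = ℕ→ℚ 2 ·S Z *S (X -S oneS)
  E = expS W
  V = X -S E
  U = (X -S oneS) *S invS V
  H₁ = Qv *S Z *S (Y -S oneS)
  H₂ = (recip (ℕ→ℚ 2) ·S Qv) *S logS U

  -- The derivation multiplies x - 1 by 2x and sends z to 1 - 2xz, so the terms with z cancel in the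
  -- product. The same cancellation occurs in `Δ-H₁`, because y - 1 is multiplied by 2x as well.
  Δ-W : Δ W ≋ ι 2 *S (X -S ⟪ 1ℚ ⟫)
  Δ-W = begin
    Δ W
      ≈⟨ D-cong (*-cong (sym (constS-* (ℕ→ℚ 2) Z)) (refl {X -S oneS})) ⟩
    Δ (ι 2 *S Z *S (X -S oneS))
      ≈⟨ leibniz (ι 2 *S Z) (X -S oneS) ⟩
    Δ (ι 2 *S Z) *S (X -S oneS) +S ι 2 *S Z *S Δ (X -S oneS)
      ≈⟨ +-cong (*-cong (trans (D-con* (ℕ→ℚ 2) Z) (*-congˡ {ι 2} Δ-Z)) (one′ X)) (*-congˡ {ι 2 *S Z} (trans (Δ-minus-1 X) Δ-X)) ⟩
    ι 2 *S (⟪ 1ℚ ⟫ -S ι 2 *S X *S Z) *S (X -S ⟪ 1ℚ ⟫) +S ι 2 *S Z *S (-S (ι 2 *S X *S (⟪ 1ℚ ⟫ -S X)))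
      ≈⟨ solve 2 (λ x z → 2′ :* (1′ :- 2′ :* x :* z) :* (x :- 1′) :+ 2′ :* z :* (:- (2′ :* x :* (1′ :- x))) := 2′ :* (x :- 1′)) refl X Z ⟩
    ι 2 *S (X -S ⟪ 1ℚ ⟫) ∎

  -- Both x and E have the logarithmic derivative 2(x - 1) under `Δ`, and hence so does their
  -- difference.
  Δ-V : Δ V ≋ ι 2 *S (X -S ⟪ 1ℚ ⟫) *S V
  Δ-V = begin
    Δ (X -S E)
      ≈⟨ D-minus X E ⟩
    Δ X -S Δ E
      ≈⟨ +-cong Δ-X (-‿cong (trans (D-expS Δ-degree W ≡.refl) (*-congˡ {E} Δ-W))) ⟩
    -S (ι 2 *S X *S (⟪ 1ℚ ⟫ -S X)) -S E *S (ι 2 *S (X -S ⟪ 1ℚ ⟫))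
      ≈⟨ solve 2 (λ x e → :- (2′ :* x :* (1′ :- x)) :- e :* (2′ :* (x :- 1′)) := 2′ :* (x :- 1′) :* (x :- e)) refl X E ⟩
    ι 2 *S (X -S ⟪ 1ℚ ⟫) *S V ∎

  -- The hypothesis says that scaling by `recip` normalises the constant term to 1, which also
  -- excludes the default value of `recip` at 0. For `V`, with constant term -1, it holds by
  -- computation.
  invS-inverse : ∀ G → (oneS -S (recip (G 0 0 0 0) ·S G)) 0 0 0 0 ≡ 0ℚ → G *S invS G ≋ oneS
  invS-inverse G u₀ = begin
    G *S (r ·S geometric u)               ≈⟨ *-congˡ {G} (sym (constS-* r (geometric u))) ⟩
    G *S (constS r *S geometric u)        ≈⟨ solve 3 (λ g r u → g :* (r :* u) := r :* g :* u) refl G (constS r) (geometric u) ⟩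
    constS r *S G *S geometric u          ≈⟨ *-congʳ {geometric u} (constS-* r G) ⟩
    (r ·S G) *S geometric u               ≈⟨ *-congʳ {geometric u} (solve 2 (λ o g → g := o :- (o :- g)) refl oneS (r ·S G)) ⟩
    (oneS -S u) *S geometric u            ≈⟨ geometric-inverse u u₀ ⟩
    oneS                                  ∎
    where
    r = recip (G 0 0 0 0)
    u = oneS -S (r ·S G)

  -- Logarithmic derivatives subtract in the quotient: x - 1 contributes 2x and V contributes 2(x -
  -- 1), leaving 2.
  Δ-U : Δ U ≋ ι 2 *S U
  Δ-U = begin
    Δ ((X -S oneS) *S I)
      ≈⟨ leibniz (X -S oneS) I ⟩
    Δ (X -S oneS) *S I +S (X -S oneS) *S Δ I
      ≈⟨ +-cong (*-congʳ {I} (trans (Δ-minus-1 X) Δ-X)) (*-cong (one′ X) Δ-I) ⟩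
    (-S (ι 2 *S X *S (⟪ 1ℚ ⟫ -S X))) *S I +S (X -S ⟪ 1ℚ ⟫) *S (-S (ι 2 *S (X -S ⟪ 1ℚ ⟫) *S I))
      ≈⟨ solve 2 (λ x i → (:- (2′ :* x :* (1′ :- x))) :* i :+ (x :- 1′) :* (:- (2′ :* (x :- 1′) :* i)) := 2′ :* ((x :- 1′) :* i)) refl X I ⟩
    ι 2 *S ((X -S ⟪ 1ℚ ⟫) *S I)
      ≈⟨ *-congˡ {ι 2} (*-congʳ {I} (one′ X)) ⟨
    ι 2 *S U ∎
    where
    I = invS V
    V*I : V *S I ≋ ⟪ 1ℚ ⟫
    V*I = trans (invS-inverse V ≡.refl) (sym 1-homo)
    Δ-V*I : Δ V *S I +S V *S Δ I ≋ ⟪ 0ℚ ⟫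
    Δ-V*I = trans (sym (leibniz V I)) (trans (D-cong V*I) (trans (D-con 1ℚ) (sym 0-homo)))
      where open DegreeDerivation Δ-degree using (D-con)
    Δ-I : Δ I ≋ -S (ι 2 *S (X -S ⟪ 1ℚ ⟫) *S I)
    Δ-I = begin
      Δ I
        -- The claimed value is completed to Δ I by multiples of three quantities that are known:
        -- Δ(V I) = 0, ΔV - 2(x - 1)V = 0 and V I - 1 = 0. No division by V is involved.
        ≈⟨ solve 5 (λ x i v dv di → di := i :* (dv :* i :+ v :* di) :- (i :* i :* (dv :- 2′ :* (x :- 1′) :* v))
                      :- (v :* i :- 1′) :* (di :+ 2′ :* (x :- 1′) :* i) :- 2′ :* (x :- 1′) :* i) refl X I V (Δ V) (Δ I) ⟩
      I *S (Δ V *S I +S V *S Δ I) -S (I *S I *S (Δ V -S ι 2 *S (X -S ⟪ 1ℚ ⟫) *S V))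
        -S (V *S I -S ⟪ 1ℚ ⟫) *S (Δ I +S ι 2 *S (X -S ⟪ 1ℚ ⟫) *S I) -S ι 2 *S (X -S ⟪ 1ℚ ⟫) *S I
        ≈⟨ +-congʳ { -S (ι 2 *S (X -S ⟪ 1ℚ ⟫) *S I)} (+-cong (+-cong (*-congˡ {I} Δ-V*I)
             (-‿cong (*-congˡ {I *S I} (+-congʳ { -S (ι 2 *S (X -S ⟪ 1ℚ ⟫) *S V)} Δ-V))))
             (-‿cong (*-congʳ {Δ I +S ι 2 *S (X -S ⟪ 1ℚ ⟫) *S I} (+-congʳ { -S ⟪ 1ℚ ⟫} V*I)))) ⟩
      I *S ⟪ 0ℚ ⟫ -S (I *S I *S (ι 2 *S (X -S ⟪ 1ℚ ⟫) *S V -S ι 2 *S (X -S ⟪ 1ℚ ⟫) *S V))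
        -S (⟪ 1ℚ ⟫ -S ⟪ 1ℚ ⟫) *S (Δ I +S ι 2 *S (X -S ⟪ 1ℚ ⟫) *S I) -S ι 2 *S (X -S ⟪ 1ℚ ⟫) *S I
        ≈⟨ solve 4 (λ x i v di → i :* con 0ℚ :- (i :* i :* (2′ :* (x :- 1′) :* v :- 2′ :* (x :- 1′) :* v))
                      :- (1′ :- 1′) :* (di :+ 2′ :* (x :- 1′) :* i) :- 2′ :* (x :- 1′) :* i := :- (2′ :* (x :- 1′) :* i)) refl X I V (Δ I) ⟩
      -S (ι 2 *S (X -S ⟪ 1ℚ ⟫) *S I) ∎

  -- The geometric series in 1 - U inverts U, so the factor U of `Δ U` drops out.
  Δ-log-U : Δ (logS U) ≋ ι 2
  Δ-log-U = begin
    Δ (logS U)                                      ≈⟨ D-logS Δ-degree U ≡.refl ⟩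
    geometric (oneS -S U) *S Δ U                    ≈⟨ *-congˡ {geometric (oneS -S U)} Δ-U ⟩
    geometric (oneS -S U) *S (ι 2 *S U)             ≈⟨ solve 3 (λ g o u → g :* (2′ :* u) := 2′ :* ((o :- (o :- u)) :* g)) refl (geometric (oneS -S U)) oneS U ⟩
    ι 2 *S ((oneS -S (oneS -S U)) *S geometric (oneS -S U))
                                                    ≈⟨ *-congˡ {ι 2} (geometric-inverse (oneS -S U) ≡.refl) ⟩
    ι 2 *S oneS                                     ≈⟨ *-identityʳ (ι 2) ⟩
    ι 2                                             ∎

  ½ : ℚ
  ½ = recip (ℕ→ℚ 2)

  Δ-H₁ : Δ H₁ ≋ Qv *S (Y -S ⟪ 1ℚ ⟫)
  Δ-H₁ = begin
    Δ (Qv *S Z *S (Y -S oneS))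
      ≈⟨ leibniz (Qv *S Z) (Y -S oneS) ⟩
    Δ (Qv *S Z) *S (Y -S oneS) +S Qv *S Z *S Δ (Y -S oneS)
      ≈⟨ +-cong (*-cong (trans (leibniz Qv Z) (+-cong (*-congʳ {Z} Δ-Q) (*-congˡ {Qv} Δ-Z))) (one′ Y)) (*-congˡ {Qv *S Z} (trans (Δ-minus-1 Y) Δ-Y)) ⟩
    (⟪ 0ℚ ⟫ *S Z +S Qv *S (⟪ 1ℚ ⟫ -S ι 2 *S X *S Z)) *S (Y -S ⟪ 1ℚ ⟫) +S Qv *S Z *S (-S (ι 2 *S X *S (⟪ 1ℚ ⟫ -S Y)))
      ≈⟨ solve 4 (λ x y z q → (con 0ℚ :* z :+ q :* (1′ :- 2′ :* x :* z)) :* (y :- 1′) :+ q :* z :* (:- (2′ :* x :* (1′ :- y))) := q :* (y :- 1′)) refl X Y Z Qv ⟩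
    Qv *S (Y -S ⟪ 1ℚ ⟫) ∎

  Δ-H₂ : Δ H₂ ≋ Qv
  Δ-H₂ = begin
    Δ ((½ ·S Qv) *S logS U)
      ≈⟨ D-cong (*-congʳ {logS U} (sym (constS-* ½ Qv))) ⟩
    Δ (⟪ ½ ⟫ *S Qv *S logS U)
      ≈⟨ leibniz (⟪ ½ ⟫ *S Qv) (logS U) ⟩
    Δ (⟪ ½ ⟫ *S Qv) *S logS U +S ⟪ ½ ⟫ *S Qv *S Δ (logS U)
      ≈⟨ +-cong (*-congʳ {logS U} (trans (D-con* ½ Qv) (*-congˡ {⟪ ½ ⟫} Δ-Q))) (*-congˡ {⟪ ½ ⟫ *S Qv} Δ-log-U) ⟩
    ⟪ ½ ⟫ *S ⟪ 0ℚ ⟫ *S logS U +S ⟪ ½ ⟫ *S Qv *S ι 2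
      ≈⟨ solve 2 (λ q l → con ½ :* con 0ℚ :* l :+ con ½ :* q :* 2′ := q) refl Qv (logS U) ⟩
    Qv ∎

  Δ-closedForm : Δ closedForm ≋ Qv *S Y *S closedForm
  Δ-closedForm = begin
    Δ (expS H₁ *S expS H₂)
      ≈⟨ leibniz (expS H₁) (expS H₂) ⟩
    Δ (expS H₁) *S expS H₂ +S expS H₁ *S Δ (expS H₂)
      ≈⟨ +-cong (*-congʳ {expS H₂} (trans (D-expS Δ-degree H₁ ≡.refl) (*-congˡ {expS H₁} Δ-H₁)))
                (*-congˡ {expS H₁} (trans (D-expS Δ-degree H₂ H₂-0) (*-congˡ {expS H₂} Δ-H₂))) ⟩
    expS H₁ *S (Qv *S (Y -S ⟪ 1ℚ ⟫)) *S expS H₂ +S expS H₁ *S (expS H₂ *S Qv)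
      ≈⟨ solve 4 (λ q y e f → e :* (q :* (y :- 1′)) :* f :+ e :* (f :* q) := q :* y :* (e :* f)) refl Qv Y (expS H₁) (expS H₂) ⟩
    Qv *S Y *S closedForm ∎
    where
    H₂-0 : H₂ 0 0 0 0 ≡ 0ℚ
    H₂-0 = ℚ.*-zeroˡ (logS U 0 0 0 0)

-- Uniqueness of the solution and the generating function.

module GeneratingFunction where
  open import Defs renaming (_≈_ to _≈S_)
  open Rationals
  open PowerSeries
  open SeriesRing
  open PartialDerivatives
  open ExpAndLog
  open ClosedForm
  open ≡ using (_≡_; _≢_)
  open SA hiding (zero)

  -- This is Δ f = qy f solved for ∂f/∂z. The term -2xz ∂f/∂z turns into 2x times the Euler operator
  -- in z, which only multiplies the coefficient of z^d by d. Thus `Φ` preserves the exponent of z,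
  -- and the equation can be solved one power of z at a time.
  Φ : Series → Series
  Φ f = Qv *S Y *S f +S ι 2 *S X *S θ (λ a b c d → d) f +S Ax *S ∂x f +S Ay *S ∂y f

  Δ⇒Φ : ∀ f → Δ f ≋ Qv *S Y *S f → ∂z f ≋ Φ f
  Δ⇒Φ f p = begin
    ∂z f
      ≈⟨ *-identityˡ (∂z f) ⟨
    oneS *S ∂z f
      ≈⟨ *-congʳ {∂z f} (sym 1-homo) ⟩
    ⟪ 1ℚ ⟫ *S ∂z f
      ≈⟨ solve 4 (λ x z dz l → 1′ :* dz := (1′ :- 2′ :* x :* z) :* dz :+ (:- 1′) :* l :+ 2′ :* x :* (z :* dz) :+ l) refl X Z (∂z f) (L f) ⟩
    (⟪ 1ℚ ⟫ -S ι 2 *S X *S Z) *S ∂z f +S (-S ⟪ 1ℚ ⟫) *S L f +S ι 2 *S X *S (Z *S ∂z f) +S L f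
      ≈⟨ +-congʳ {L f} (+-cong (+-cong (*-congʳ {∂z f} (+-congʳ { -S (ι 2 *S X *S Z)} 1-homo)) (*-congʳ {L f} (-‿cong 1-homo)))
           (*-congˡ {ι 2 *S X} (∂Z.v*∂≋θ f))) ⟩
    Δ f +S ι 2 *S X *S θ (λ a b c d → d) f +S L f
      ≈⟨ +-congʳ {L f} (+-congʳ {ι 2 *S X *S θ (λ a b c d → d) f} p) ⟩
    Qv *S Y *S f +S ι 2 *S X *S θ (λ a b c d → d) f +S L f
      ≈⟨ +-assoc (Qv *S Y *S f +S ι 2 *S X *S θ (λ a b c d → d) f) (Ax *S ∂x f) (Ay *S ∂y f) ⟨
    Φ f ∎

  infix 4 _≈z[_]_
  record _≈z[_]_ (f : Series) (n : ℕ) (g : Series) : Set where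
    constructor upTo-z
    field at≤ : ∀ a b c d → d ℕ.≤ n → f a b c d ≡ g a b c d
  open _≈z[_]_

  ≈z-* : ∀ A {f g n} → f ≈z[ n ] g → A *S f ≈z[ n ] A *S g
  ≈z-* A {f} {g} p = upTo-z λ a b c d d≤n → *S-cong-≤ A A f g a b c d λ i j k l _ _ _ _ →
    ≡.cong (A i j k l ℚ.*_) (at≤ p (a ∸ i) (b ∸ j) (c ∸ k) (d ∸ l) (ℕ.≤-trans (ℕ.m∸n≤m d l) d≤n))

  ≈z-+ : ∀ {f f′ g g′ n} → f ≈z[ n ] f′ → g ≈z[ n ] g′ → f +S g ≈z[ n ] f′ +S g′
  ≈z-+ p q = upTo-z λ a b c d d≤n → ≡.cong₂ ℚ._+_ (at≤ p a b c d d≤n) (at≤ q a b c d d≤n)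

  Φ-cong : ∀ f g n → f ≈z[ n ] g → Φ f ≈z[ n ] Φ g
  Φ-cong f g n p = ≈z-+ (≈z-+ (≈z-+ (≈z-* (Qv *S Y) p)
    (≈z-* (ι 2 *S X) (upTo-z λ a b c d d≤n → ≡.cong (ℕ→ℚ d ℚ.*_) (at≤ p a b c d d≤n))))
    (≈z-* Ax (upTo-z λ a b c d d≤n → ≡.cong (ℕ→ℚ (suc a) ℚ.*_) (at≤ p (suc a) b c d d≤n))))
    (≈z-* Ay (upTo-z λ a b c d d≤n → ≡.cong (ℕ→ℚ (suc b) ℚ.*_) (at≤ p a (suc b) c d d≤n)))

  ≈z-trans : ∀ {f g h n} → f ≈z[ n ] g → g ≈z[ n ] h → f ≈z[ n ] h
  ≈z-trans p q = upTo-z λ a b c d d≤n → ≡.trans (at≤ p a b c d d≤n) (at≤ q a b c d d≤n)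

  ≋⇒≈z : ∀ {f g n} → f ≋ g → f ≈z[ n ] g
  ≋⇒≈z p = upTo-z λ a b c d _ → at p a b c d

  *-cancelˡ-≢0 : ∀ r {p q} → r ≢ 0ℚ → r ℚ.* p ≡ r ℚ.* q → p ≡ q
  *-cancelˡ-≢0 r {p} {q} r≢0 eq = ≡.trans (≡.sym (undo p)) (≡.trans (≡.cong (recip r ℚ.*_) eq) (undo q))
    where
    undo : ∀ s → recip r ℚ.* (r ℚ.* s) ≡ s
    undo s = ≡.trans (≡.sym (ℚ.*-assoc (recip r) r s)) (≡.trans (≡.cong (ℚ._* s) (recip-inverse r r≢0)) (ℚ.*-identityˡ s))

  -- The coefficient of z^(d+1) is that of z^d in `Φ f` divided by d + 1, so the initial value at z
  -- = 0 determines everything.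
  Φ-unique : ∀ f g → ∂z f ≋ Φ f → ∂z g ≋ Φ g → (∀ a b c → f a b c 0 ≡ g a b c 0) → f ≋ g
  Φ-unique f g ∂f ∂g f₀≡g₀ = pointwise λ a b c d → at≤ (agree d) a b c d ℕ.≤-refl
    where
    agree : ∀ n → f ≈z[ n ] g
    agree zero    = upTo-z λ { a b c zero z≤n → f₀≡g₀ a b c }
    agree (suc n) = upTo-z λ
      { a b c zero    _         → f₀≡g₀ a b c
      ; a b c (suc d) (s≤s d≤n) → *-cancelˡ-≢0 (ℕ→ℚ (suc d)) (ℕ→ℚ-suc≢0 d)
          (≡.trans (at ∂f a b c d) (≡.trans (at≤ (Φ-cong f g n (agree n)) a b c d d≤n) (≡.sym (at ∂g a b c d)))) }

  record ZFree (A : Series) : Set where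
    constructor zfree
    field no-z : ∀ a b c d → A a b c (suc d) ≡ 0ℚ
  open ZFree

  zfree-mono : ∀ i j k → ZFree (mono i j k 0)
  zfree-mono i j k = zfree λ a b c d → mono-≢ i j k 0 {a} {b} {c} {suc d} λ _ _ _ ()

  zfree-* : ∀ {A B} → ZFree A → ZFree B → ZFree (A *S B)
  zfree-* {A} {B} p q = zfree λ a b c d → sumTo-0 a λ i _ → sumTo-0 b λ j _ → sumTo-0 c λ k _ → sumTo-0 (suc d) λ
    { zero    _ → ≡.trans (≡.cong (A i j k 0 ℚ.*_) (no-z q (a ∸ i) (b ∸ j) (c ∸ k) d)) (ℚ.*-zeroʳ (A i j k 0))
    ; (suc l) _ → ≡.trans (≡.cong (ℚ._* B (a ∸ i) (b ∸ j) (c ∸ k) (suc d ∸ suc l)) (no-z p i j k l)) (ℚ.*-zeroˡ (B (a ∸ i) (b ∸ j) (c ∸ k) (suc d ∸ suc l))) }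

  zfree-minus : ∀ {A B} → ZFree A → ZFree B → ZFree (A -S B)
  zfree-minus p q = zfree λ a b c d → ≡.cong₂ ℚ._-_ (no-z p a b c d) (no-z q a b c d)

  zfree-con : ∀ r → ZFree (constS r)
  zfree-con r = zfree λ a b c d → ≡.trans (≡.cong (r ℚ.*_) (no-z (zfree-mono 0 0 0) a b c d)) (ℚ.*-zeroʳ r)

  sumTo-zeros : ∀ n (f : ℕ → ℚ) → (∀ i → f (suc i) ≡ 0ℚ) → sumTo n f ≡ f 0
  sumTo-zeros zero    f h = ≡.refl
  sumTo-zeros (suc n) f h = ≡.trans (≡.cong₂ ℚ._+_ (sumTo-zeros n f h) (h n)) (ℚ.+-identityʳ (f 0))

  -- The polynomial `P n` sits at exponent 0 of z, its copy in the generating function at exponent n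
  -- with the factor 1/n!. A multiplier free of z commutes with this relocation.
  *S-slice : ∀ A f g n r → ZFree A → (∀ a b c → f a b c n ≡ r ℚ.* g a b c 0) → ∀ a b c →
    (A *S f) a b c n ≡ r ℚ.* (A *S g) a b c 0
  *S-slice A f g n r A-z f≡ a b c = ≡.trans
    (sumTo-cong a λ i _ → sumTo-cong b λ j _ → sumTo-cong c λ k _ → ≡.trans
      (sumTo-zeros n _ λ l → ≡.trans (≡.cong (ℚ._* f (a ∸ i) (b ∸ j) (c ∸ k) (n ∸ suc l)) (no-z A-z i j k l)) (ℚ.*-zeroˡ (f (a ∸ i) (b ∸ j) (c ∸ k) (n ∸ suc l))))
      (≡.cong (A i j k 0 ℚ.*_) (f≡ (a ∸ i) (b ∸ j) (c ∸ k))))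
    (at (*-scale r) a b c 0)
    where
    *-scale : ∀ r → A *S (r ·S g) ≋ r ·S (A *S g)
    *-scale r = trans (*-congˡ {A} (sym (constS-* r g)))
      (trans (solve 3 (λ r a g → a :* (r :* g) := r :* (a :* g)) refl (constS r) A g) (constS-* r (A *S g)))

  ≈z-*0 : ∀ A f → f ≈z[ 0 ] zeroS → A *S f ≈z[ 0 ] zeroS
  ≈z-*0 A f p = ≈z-trans (≈z-* A p) (≋⇒≈z (zeroʳ A))

  ≈z-0* : ∀ f A → f ≈z[ 0 ] zeroS → f *S A ≈z[ 0 ] zeroS
  ≈z-0* f A p = ≈z-trans (≋⇒≈z (*-comm f A)) (≈z-*0 A f p)

  Z*≈0 : ∀ f → Z *S f ≈z[ 0 ] zeroS
  Z*≈0 f = upTo-z λ { a b c zero z≤n → Z*-zero f a b c }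

  powS-suc≈0 : ∀ f m → f ≈z[ 0 ] zeroS → powS f (suc m) ≈z[ 0 ] zeroS
  powS-suc≈0 f m p = ≈z-0* f (powS f m) p

  expS≈1 : ∀ H → H ≈z[ 0 ] zeroS → expS H ≈z[ 0 ] oneS
  expS≈1 H p = upTo-z λ a b c d d≤0 → ≡.trans
    (sumTo-zeros (deg a b c d) _ λ m → ≡.trans (≡.cong (recip (ℕ→ℚ (suc m !)) ℚ.*_) (at≤ (powS-suc≈0 H m p) a b c d d≤0)) (ℚ.*-zeroʳ (recip (ℕ→ℚ (suc m !)))))
    (ℚ.*-identityˡ (oneS a b c d))

  logS≈0 : ∀ G → G ≈z[ 0 ] oneS → logS G ≈z[ 0 ] zeroS
  logS≈0 G p = upTo-z λ a b c d d≤0 → ≡.cong ℚ.-_ (sumTo-0 (deg a b c d) λ m _ →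
    ≡.trans (≡.cong (recip (ℕ→ℚ (suc m)) ℚ.*_) (at≤ (powS-suc≈0 (oneS -S G) m u≈0) a b c d d≤0)) (ℚ.*-zeroʳ (recip (ℕ→ℚ (suc m)))))
    where
    u≈0 : oneS -S G ≈z[ 0 ] zeroS
    u≈0 = upTo-z λ a b c d d≤0 → ≡.trans (≡.cong (λ r → oneS a b c d ℚ.- r) (at≤ p a b c d d≤0)) (ℚ.+-inverseʳ (oneS a b c d))

  -- Both W and H₁ are multiples of z. At z = 0 this gives E = 1 and V = x - 1, hence U = 1 and log
  -- U = 0, and both exponentials become 1.
  closedForm≈1 : closedForm ≈z[ 0 ] oneS
  closedForm≈1 = ≈z-trans (≈z-* (expS H₁) (expS≈1 H₂ H₂≈0)) (≈z-trans (≋⇒≈z (*-identityʳ (expS H₁))) (expS≈1 H₁ H₁≈0))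
    where
    I = invS V
    H₁≈0 : H₁ ≈z[ 0 ] zeroS
    H₁≈0 = ≈z-trans (≋⇒≈z (solve 3 (λ q z y → q :* z :* y := z :* (q :* y)) refl Qv Z (Y -S oneS))) (Z*≈0 (Qv *S (Y -S oneS)))
    W≈0 : W ≈z[ 0 ] zeroS
    W≈0 = ≈z-trans (≋⇒≈z (trans (*-congʳ {X -S oneS} (sym (constS-* (ℕ→ℚ 2) Z)))
      (solve 3 (λ t z y → t :* z :* y := z :* (t :* y)) refl (ι 2) Z (X -S oneS)))) (Z*≈0 (ι 2 *S (X -S oneS)))
    V≈X-1 : X -S oneS ≈z[ 0 ] V
    V≈X-1 = upTo-z λ a b c d d≤0 → ≡.cong (λ r → X a b c d ℚ.- r) (≡.sym (at≤ (expS≈1 W W≈0) a b c d d≤0))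
    U≈1 : U ≈z[ 0 ] oneS
    U≈1 = ≈z-trans (≋⇒≈z (*-comm (X -S oneS) I)) (≈z-trans (≈z-* I V≈X-1) (≋⇒≈z (trans (*-comm I V) (invS-inverse V ≡.refl))))
    H₂≈0 : H₂ ≈z[ 0 ] zeroS
    H₂≈0 = ≈z-*0 (½ ·S Qv) (logS U) (logS≈0 U U≈1)

  module _ (P : ℕ → Series) (P-suc : ∀ n → P (suc n) ≋ (ι (2 ℕ.* n) *S X +S Qv *S Y) *S P n +S L (P n)) where

    F : Series
    F a b c n = recip (ℕ→ℚ (n !)) ℚ.* P n a b c 0

    -- At z^n the left side is P (n + 1) / n!, and the recurrence expands it into the four summands
    -- of `Φ`. The summand 2nx P n is the one that the Euler operator in z produces.
    ∂z-F : ∂z F ≋ Φ F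
    ∂z-F = pointwise λ a b c n → let r = recip (ℕ→ℚ (n !)) in
      ≡.trans (lower n (P (suc n) a b c 0))
      (≡.trans (≡.cong (r ℚ.*_) (at (P-suc′ n) a b c 0))
      (≡.trans (≡.trans (ℚ.*-distribˡ-+ r (V₃ n a b c 0) (S₃ n a b c 0)) (≡.cong (ℚ._+ r ℚ.* S₃ n a b c 0)
        (≡.trans (ℚ.*-distribˡ-+ r (V₂ n a b c 0) (S₂ n a b c 0)) (≡.cong (ℚ._+ r ℚ.* S₂ n a b c 0)
        (ℚ.*-distribˡ-+ r (S₁ n a b c 0) (T₁ n a b c 0))))))
      (≡.sym (≡.cong₂ ℚ._+_ (≡.cong₂ ℚ._+_ (≡.cong₂ ℚ._+_
        (*S-slice (Qv *S Y) F (P n) n r (zfree-* (zfree-mono 0 0 1) (zfree-mono 0 1 0)) (λ _ _ _ → ≡.refl) a b c)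
        (*S-slice (ι 2 *S X) (θ (λ a b c d → d) F) (ℕ→ℚ n ·S P n) n r zfree-2X (λ a b c → swap (ℕ→ℚ n) r (P n a b c 0)) a b c))
        (*S-slice Ax (∂x F) (∂x (P n)) n r (zfree-* zfree-2X (zfree-minus (zfree-mono 0 0 0) (zfree-mono 1 0 0))) (λ a b c → swap (ℕ→ℚ (suc a)) r (P n (suc a) b c 0)) a b c))
        (*S-slice Ay (∂y F) (∂y (P n)) n r (zfree-* zfree-2X (zfree-minus (zfree-mono 0 0 0) (zfree-mono 0 1 0))) (λ a b c → swap (ℕ→ℚ (suc b)) r (P n a (suc b) c 0)) a b c)))))
      where
      S₁ T₁ S₂ S₃ V₂ V₃ : ℕ → Series
      S₁ n = Qv *S Y *S P n
      T₁ n = ι 2 *S X *S (ℕ→ℚ n ·S P n)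
      S₂ n = Ax *S ∂x (P n)
      S₃ n = Ay *S ∂y (P n)
      V₂ n = S₁ n +S T₁ n
      V₃ n = V₂ n +S S₂ n
      zfree-2X : ZFree (ι 2 *S X)
      zfree-2X = zfree-* (zfree-con (ℕ→ℚ 2)) (zfree-mono 1 0 0)
      swap : ∀ p q s → p ℚ.* (q ℚ.* s) ≡ q ℚ.* (p ℚ.* s)
      swap p q s = ≡.trans (≡.sym (ℚ.*-assoc p q s)) (≡.trans (≡.cong (ℚ._* s) (ℚ.*-comm p q)) (ℚ.*-assoc q p s))
      lower : ∀ n s → ℕ→ℚ (suc n) ℚ.* (recip (ℕ→ℚ (suc n !)) ℚ.* s) ≡ recip (ℕ→ℚ (n !)) ℚ.* s
      lower n s = ≡.trans (≡.sym (ℚ.*-assoc (ℕ→ℚ (suc n)) (recip (ℕ→ℚ (suc n !))) s))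
        (≡.cong (ℚ._* s) (≡.trans (ℚ.*-comm (ℕ→ℚ (suc n)) (recip (ℕ→ℚ (suc n !)))) (recip-! n)))
      P-suc′ : ∀ n → P (suc n) ≋ S₁ n +S T₁ n +S S₂ n +S S₃ n
      P-suc′ n = begin
        P (suc n)
          ≈⟨ P-suc n ⟩
        (ι (2 ℕ.* n) *S X +S Qv *S Y) *S P n +S (S₂ n +S S₃ n)
          ≈⟨ +-congʳ {S₂ n +S S₃ n} (*-congʳ {P n} (+-congʳ {Qv *S Y} (*-congʳ {X} (ι-* 2 n)))) ⟩
        (ι 2 *S ι n *S X +S Qv *S Y) *S P n +S (S₂ n +S S₃ n)
          ≈⟨ solve 7 (λ i x q y p b c → (2′ :* i :* x :+ q :* y) :* p :+ (b :+ c) := q :* y :* p :+ 2′ :* x :* (i :* p) :+ b :+ c) refl (ι n) X Qv Y (P n) (S₂ n) (S₃ n) ⟩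
        S₁ n +S ι 2 *S X *S (ι n *S P n) +S S₂ n +S S₃ n
          ≈⟨ +-congʳ {S₃ n} (+-congʳ {S₂ n} (+-congˡ {S₁ n} (*-congˡ {ι 2 *S X} (constS-* (ℕ→ℚ n) (P n))))) ⟩
        S₁ n +S T₁ n +S S₂ n +S S₃ n ∎

    egf-closedForm : (∀ a b c → P 0 a b c 0 ≡ oneS a b c 0) → F ≋ closedForm
    egf-closedForm P-0 = Φ-unique F closedForm ∂z-F (Δ⇒Φ closedForm Δ-closedForm) λ a b c →
      ≡.trans (ℚ.*-identityˡ (P 0 a b c 0)) (≡.trans (P-0 a b c) (≡.sym (at≤ closedForm≈1 a b c 0 z≤n)))

-- Exhaustive enumeration by insertion, and permutations.

module Insertions where
  open import Defs using (Enumerates; IsPerm; range)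
  open Words
  open import Data.List.Relation.Binary.Permutation.Propositional.Properties using (All-resp-↭; ∈-resp-↭; drop-mid; shift; ++-comm; ↭-length)
  open import Relation.Binary.PropositionalEquality using (_≡_; _≢_; refl; sym; trans; cong; cong₂; subst)

  data InsertAfter (B : List ℕ) : List ℕ → List ℕ → Set where
    here  : ∀ {a w} → InsertAfter B (a ∷ w) (a ∷ B ++ w)
    there : ∀ {a w v} → InsertAfter B w v → InsertAfter B (a ∷ w) (a ∷ v)

  insertAfter⁻ : ∀ B w {v} → v ∈ insertAfter B w → InsertAfter B w v
  insertAfter⁻ B (a ∷ w) (here refl) = here
  insertAfter⁻ B (a ∷ w) (there v∈) with ∈-map⁻ (a ∷_) v∈
  ... | v′ , v′∈ , refl = there (insertAfter⁻ B w v′∈)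

  insertAfter⁺ : ∀ {B w v} → InsertAfter B w v → v ∈ insertAfter B w
  insertAfter⁺ here      = here refl
  insertAfter⁺ (there p) = there (∈-map⁺ _ (insertAfter⁺ p))

  insertAfter-split : ∀ {B} a u v → InsertAfter B (a ∷ u ++ v) (a ∷ u ++ B ++ v)
  insertAfter-split a []      v = here
  insertAfter-split a (b ∷ u) v = there (insertAfter-split b u v)

  InsertAfter-↭ : ∀ {B w v} → InsertAfter B w v → v ↭ B ++ w
  InsertAfter-↭ {B} (here {a} {w})  = ↭-sym (shift a B w)
  InsertAfter-↭ {B} (there {a} {w} p) = ↭-trans (prep a (InsertAfter-↭ p)) (↭-sym (shift a B w))

  _≢?_ : (m a : ℕ) → _
  m ≢? a = ¬? (a ℕ.≟ m)

  remove : ℕ → List ℕ → List ℕ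
  remove m = filter (m ≢?_)

  <⇒≢-all : ∀ {m w} → All (_< m) w → All (_≢ m) w
  <⇒≢-all = All.map ℕ.<⇒≢

  remove-InsertAfter : ∀ {m B w v} → All (_≡ m) B → All (_< m) w → InsertAfter B w v → remove m v ≡ w
  remove-InsertAfter {m} {B} B≡m (a<m ∷ w<m) (here {a} {w}) = trans (filter-accept (m ≢?_) (ℕ.<⇒≢ a<m)) (cong (a ∷_)
    (trans (filter-++ (m ≢?_) B w) (cong₂ _++_ (filter-none (m ≢?_) (All.map (λ p q → q p) B≡m)) (filter-all (m ≢?_) (<⇒≢-all w<m)))))
  remove-InsertAfter {m} B≡m (a<m ∷ w<m) (there {a} p) =
    trans (filter-accept (m ≢?_) (ℕ.<⇒≢ a<m)) (cong (a ∷_) (remove-InsertAfter B≡m w<m p))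

  insertAfter-head : ∀ {m B w u v} → InsertAfter B w v → All (_≢ m) w → m ∷ u ≢ v
  insertAfter-head here      (a≢m ∷ _) eq = a≢m (sym (∷-injectiveˡ eq))
  insertAfter-head (there _) (a≢m ∷ _) eq = a≢m (sym (∷-injectiveˡ eq))

  -- The insertion right after the head has m in second place, whereas all later ones keep a letter
  -- of `w` there.
  insertAfter-unique : ∀ {m} B w → All (_≢ m) w → Unique (insertAfter (m ∷ B) w)
  insertAfter-unique     B []      _           = []
  insertAfter-unique {m} B (a ∷ w) (a≢m ∷ w≢m) = All.tabulate fresh ∷ Unique.map⁺ ∷-injectiveʳ (insertAfter-unique B w w≢m)
    where
    fresh : ∀ {v} → v ∈ map (a ∷_) (insertAfter (m ∷ B) w) → a ∷ m ∷ B ++ w ≢ v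
    fresh v∈ eq with ∈-map⁻ (a ∷_) v∈
    ... | v′ , v′∈ , refl = insertAfter-head (insertAfter⁻ (m ∷ B) w v′∈) w≢m (∷-injectiveʳ eq)

  insertAnywhere-unique : ∀ {m} B w → All (_≢ m) w → Unique (insertAnywhere (m ∷ B) w)
  insertAnywhere-unique {m} B w w≢m =
    All.tabulate (λ v∈ → insertAfter-head (insertAfter⁻ (m ∷ B) w v∈) w≢m) ∷ insertAfter-unique B w w≢m

  -- Lists without repetitions and with the same members are rearrangements of each other. This
  -- carries sums over a given enumeration to the one built by insertion.
  enumerations-↭ : {A : Set} {P : A → Set} {xs ys : List A} → Enumerates P xs → Enumerates P ys → xs ↭ ys
  enumerations-↭ (xs! , xs⊆ , ⊆xs) (ys! , ys⊆ , ⊆ys) =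
    ∼bag⇒↭ (unique∧set⇒bag xs! ys! (mk⇔ (λ a∈ → ⊆ys _ (xs⊆ _ a∈)) (λ a∈ → ⊆xs _ (ys⊆ _ a∈))))

  -- The left inverse `restrict` recovers the object that was extended. Extensions of different
  -- objects are therefore disjoint, and their concatenation has no repetitions.
  record Extension {A : Set} (P P′ : A → Set) (extensions : A → List A) (restrict : A → A) : Set where
    field
      unique     : ∀ {a} → P a → Unique (extensions a)
      sound      : ∀ {a b} → P a → b ∈ extensions a → P′ b
      restricts  : ∀ {a b} → P a → b ∈ extensions a → restrict b ≡ a
      exhaustive : ∀ {b} → P′ b → ∃[ a ] (P a × b ∈ extensions a)

  enumerate-extensions : {A : Set} {P P′ : A → Set} {extensions : A → List A} {restrict : A → A} →
    Extension P P′ extensions restrict → ∀ {xs} → Enumerates P xs → Enumerates P′ (concat (map extensions xs))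
  enumerate-extensions {P = P} {P′} {extensions} {restrict} E {xs} (xs! , xs⊆ , ⊆xs) =
    Unique.concat⁺ (All.map⁺ (All.tabulate λ a∈ → unique (xs⊆ _ a∈))) (AllPairs.map⁺ (disjoint xs xs! xs⊆)) ,
    (λ b b∈ → let ys , b∈ys , ys∈ = ∈-concat⁻′ (map extensions xs) b∈
                  a , a∈ , ys≡ = ∈-map⁻ extensions ys∈
              in sound (xs⊆ a a∈) (subst (b ∈_) ys≡ b∈ys)) ,
    (λ b pb → let a , pa , b∈ = exhaustive pb in ∈-concat⁺′ b∈ (∈-map⁺ extensions (⊆xs a pa)))
    where
    open Extension E
    disjoint : ∀ xs → Unique xs → (∀ a → a ∈ xs → P a) → AllPairs (λ a a′ → Disjoint (extensions a) (extensions a′)) xs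
    disjoint []       _            _ = []
    disjoint (a ∷ xs) (a∉xs ∷ xs!) p =
      All.tabulate (λ a′∈ (b∈ , b∈′) → All.lookup a∉xs a′∈ (trans (sym (restricts (p a (here refl)) b∈)) (restricts (p _ (there a′∈)) b∈′)))
      ∷ disjoint xs xs! (λ a a∈ → p a (there a∈))

  range-suc : ∀ m → range (suc m) ≡ range m ++ [ suc m ]
  range-suc m = trans (cong (map suc) (sym (upTo-∷ʳ m))) (map-++ suc (upTo m) [ m ])

  range-≤ : ∀ m → All (_≤ m) (range m)
  range-≤ zero    = []
  range-≤ (suc m) = subst (All (_≤ suc m)) (sym (range-suc m)) (All.++⁺ (All.map ℕ.m≤n⇒m≤1+n (range-≤ m)) (ℕ.≤-refl ∷ []))

  perm-< : ∀ {m π} → IsPerm m π → All (_< suc m) π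
  perm-< {m} π↭ = All-resp-↭ (↭-sym π↭) (All.map s≤s (range-≤ m))

  perm-length : ∀ {m π} → IsPerm m π → length π ≡ m
  perm-length {m} π↭ = trans (↭-length π↭) (trans (length-map suc (upTo m)) (length-upTo m))

  range-suc-↭ : ∀ m → range (suc m) ↭ suc m ∷ range m
  range-suc-↭ m = ↭-trans (↭-reflexive (range-suc m)) (++-comm (range m) [ suc m ])

  perm-extension : ∀ m → Extension (IsPerm m) (IsPerm (suc m)) (insertAnywhere [ suc m ]) (remove (suc m))
  perm-extension m = record
    { unique     = λ π↭ → insertAnywhere-unique [] _ (<⇒≢-all (perm-< π↭))
    ; sound      = λ π↭ ρ∈ → ↭-trans (inserted ρ∈) (↭-trans (prep (suc m) π↭) (↭-sym (range-suc-↭ m)))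
    ; restricts  = λ π↭ ρ∈ → removed (perm-< π↭) ρ∈
    ; exhaustive = found }
    where
    inserted : ∀ {π ρ} → ρ ∈ insertAnywhere [ suc m ] π → ρ ↭ suc m ∷ π
    inserted (here refl) = ↭-refl
    inserted (there ρ∈)  = InsertAfter-↭ (insertAfter⁻ _ _ ρ∈)
    removed : ∀ {π ρ} → All (_< suc m) π → ρ ∈ insertAnywhere [ suc m ] π → remove (suc m) ρ ≡ π
    removed π< (here refl) = trans (filter-reject (suc m ≢?_) (λ m≢m → m≢m refl)) (filter-all (suc m ≢?_) (<⇒≢-all π<))
    removed π< (there ρ∈) = remove-InsertAfter (refl ∷ []) π< (insertAfter⁻ _ _ ρ∈)
    found : ∀ {ρ} → IsPerm (suc m) ρ → ∃[ π ] (IsPerm m π × ρ ∈ insertAnywhere [ suc m ] π)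
    found ρ↭ with ∈-∃++ (∈-resp-↭ (↭-sym (↭-trans ρ↭ (range-suc-↭ m))) (here refl))
    ... | []    , v , refl = v , drop-mid [] [] (↭-trans ρ↭ (range-suc-↭ m)) , here refl
    ... | a ∷ u , v , refl = a ∷ u ++ v , drop-mid (a ∷ u) [] (↭-trans ρ↭ (range-suc-↭ m)) ,
                             there (insertAfter⁺ (insertAfter-split a u v))

-- Stirling words, reduction and standard cycle form.

module StirlingCycles where
  open import Defs using (IsStirling; IsQ2; HeadIsMin; firstEntry; red; doubled; range)
  open Insertions
  open import Data.Nat.DivMod using (m*n/n≡m)
  open import Data.Fin as Fin using (Fin; zero; suc)
  open import Data.List.Membership.DecPropositional ℕ._≟_ using (_∈?_)
  open import Data.List.Relation.Binary.Permutation.Propositional.Properties using (∈-resp-↭; ↭-length; filter-↭)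
    renaming (map⁺ to ↭-map⁺)
  open import Data.List.Relation.Unary.Any.Properties using (lookup-index)
  open import Data.List.Relation.Unary.Unique.DecPropositional.Properties ℕ._≟_ using (deduplicate-!)
  open import Relation.Binary using (tri<; tri≈; tri>)
  open import Relation.Binary.PropositionalEquality using (_≡_; _≢_; refl; sym; trans; cong; cong₂; subst; subst₂)

  -- The condition for an `a` standing to the left of the word: only entries that still have an `a`
  -- to their right are constrained.
  data Between (a : ℕ) : List ℕ → Set where
    []  : Between a []
    _∷_ : ∀ {b w} → (a ∈ w → a < b) → Between a w → Between a (b ∷ w)

  -- The Stirling condition, without lookups and not requiring the values to be 1, …, k.
  data Stirling : List ℕ → Set where
    []  : Stirling []
    _∷_ : ∀ {a w} → Between a w → Stirling w → Stirling (a ∷ w)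

  IndexBetween : ℕ → List ℕ → Set
  IndexBetween a w = ∀ (j l : Fin (length w)) → j Fin.< l → a ≡ lookup w l → a < lookup w j

  IndexStirling : List ℕ → Set
  IndexStirling w = ∀ (i j l : Fin (length w)) → i Fin.< j → j Fin.< l →
    lookup w i ≡ lookup w l → lookup w i < lookup w j

  between⁺ : ∀ {a} w → IndexBetween a w → Between a w
  between⁺ []      h = []
  between⁺ (b ∷ w) h = (λ a∈w → h zero (suc (index a∈w)) (s≤s z≤n) (lookup-index a∈w)) ∷ between⁺ w (λ j l j<l → h (suc j) (suc l) (s≤s j<l))

  between⁻ : ∀ {a w} → Between a w → IndexBetween a w
  between⁻ {w = b ∷ w} (h ∷ _) zero    (suc l) _         a≡ = h (subst (_∈ w) (sym a≡) (∈-lookup l))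
  between⁻             (_ ∷ h) (suc j) (suc l) (s≤s j<l) a≡ = between⁻ h j l j<l a≡

  stirling⁺ : ∀ w → IndexStirling w → Stirling w
  stirling⁺ []      h = []
  stirling⁺ (a ∷ w) h = between⁺ w (λ j l j<l → h zero (suc j) (suc l) (s≤s z≤n) (s≤s j<l))
    ∷ stirling⁺ w (λ i j l i<j j<l → h (suc i) (suc j) (suc l) (s≤s i<j) (s≤s j<l))

  stirling⁻ : ∀ {w} → Stirling w → IndexStirling w
  stirling⁻ (h ∷ _) zero    (suc j) (suc l) _         (s≤s j<l) = between⁻ h j l j<l
  stirling⁻ (_ ∷ h) (suc i) (suc j) (suc l) (s≤s i<j) (s≤s j<l) = stirling⁻ h i j l i<j j<l

  StrictlyMonotoneOn : List ℕ → (ℕ → ℕ) → Set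
  StrictlyMonotoneOn w g = ∀ {u v} → u ∈ w → v ∈ w → u < v → g u < g v

  module _ {w : List ℕ} {g : ℕ → ℕ} (mono : StrictlyMonotoneOn w g) where

    mono-injective : ∀ {u v} → u ∈ w → v ∈ w → g u ≡ g v → u ≡ v
    mono-injective {u} {v} u∈ v∈ eq with ℕ.<-cmp u v
    ... | tri< u<v _ _ = contradiction eq (ℕ.<⇒≢ (mono u∈ v∈ u<v))
    ... | tri≈ _ u≡v _ = u≡v
    ... | tri> _ _ v<u = contradiction (sym eq) (ℕ.<⇒≢ (mono v∈ u∈ v<u))

    mono-reflects : ∀ {u v} → u ∈ w → v ∈ w → g u < g v → u < v
    mono-reflects {u} {v} u∈ v∈ gu<gv with ℕ.<-cmp u v
    ... | tri< u<v _ _  = u<v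
    ... | tri≈ _ refl _ = contradiction gu<gv (ℕ.<-irrefl refl)
    ... | tri> _ _ v<u  = contradiction (mono v∈ u∈ v<u) (ℕ.<-asym gu<gv)

    between-map⁺ : ∀ {a v} → a ∈ w → All (_∈ w) v → Between a v → Between (g a) (map g v)
    between-map⁺ a∈ []        []      = []
    between-map⁺ {a} {b ∷ v} a∈ (b∈ ∷ v⊆) (h ∷ hs) = (λ ga∈ → let u , u∈v , eq = ∈-map⁻ g ga∈ in
        mono a∈ b∈ (h (subst (_∈ v) (sym (mono-injective a∈ (All.lookup v⊆ u∈v) eq)) u∈v))) ∷ between-map⁺ a∈ v⊆ hs

    between-map⁻ : ∀ {a v} → a ∈ w → All (_∈ w) v → Between (g a) (map g v) → Between a v
    between-map⁻ a∈ []        []       = []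
    between-map⁻ a∈ (b∈ ∷ v⊆) (h ∷ hs) = (λ a∈v → mono-reflects a∈ b∈ (h (∈-map⁺ g a∈v))) ∷ between-map⁻ a∈ v⊆ hs

    -- The condition involves only equality and order of entries, so a relabelling that is strictly
    -- monotone on them preserves and reflects it. Reduction is such a relabelling.
    stirling-map⁺ : ∀ {v} → All (_∈ w) v → Stirling v → Stirling (map g v)
    stirling-map⁺ []        []       = []
    stirling-map⁺ (a∈ ∷ v⊆) (h ∷ hs) = between-map⁺ a∈ v⊆ h ∷ stirling-map⁺ v⊆ hs

    stirling-map⁻ : ∀ {v} → All (_∈ w) v → Stirling (map g v) → Stirling v
    stirling-map⁻ []        []       = []
    stirling-map⁻ (a∈ ∷ v⊆) (h ∷ hs) = between-map⁻ a∈ v⊆ h ∷ stirling-map⁻ v⊆ hs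

  double : List ℕ → List ℕ
  double []      = []
  double (a ∷ s) = a ∷ a ∷ double s

  double-++ : ∀ s t → double (s ++ t) ≡ double s ++ double t
  double-++ []      t = refl
  double-++ (a ∷ s) t = cong (λ u → a ∷ a ∷ u) (double-++ s t)

  double-map : ∀ g s → map g (double s) ≡ double (map g s)
  double-map g []      = refl
  double-map g (a ∷ s) = cong (λ u → g a ∷ g a ∷ u) (double-map g s)

  double-filter : ∀ {P : ℕ → Set} (P? : ∀ a → Dec (P a)) s → filter P? (double s) ≡ double (filter P? s)
  double-filter P? []      = refl
  double-filter P? (a ∷ s) with P? a
  ... | yes pa = cong (a ∷_) (trans (filter-accept P? pa) (cong (a ∷_) (double-filter P? s)))
  ... | no ¬pa = trans (filter-reject P? ¬pa) (double-filter P? s)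

  ∈-double⁺ : ∀ {v s} → v ∈ s → v ∈ double s
  ∈-double⁺ (here p)   = here p
  ∈-double⁺ (there v∈) = there (there (∈-double⁺ v∈))

  ∈-double⁻ : ∀ {v} s → v ∈ double s → v ∈ s
  ∈-double⁻ (a ∷ s) (here p)           = here p
  ∈-double⁻ (a ∷ s) (there (here p))   = here p
  ∈-double⁻ (a ∷ s) (there (there v∈)) = there (∈-double⁻ s v∈)

  length-double : ∀ s → length (double s) ≡ length s ℕ.* 2
  length-double []      = refl
  length-double (a ∷ s) = cong (λ k → suc (suc k)) (length-double s)

  doubled≡double-range : ∀ n → doubled n ≡ double (range n)
  doubled≡double-range zero    = refl
  doubled≡double-range (suc n) = trans (cong (_++ (suc n ∷ suc n ∷ [])) (doubled≡double-range n))
    (trans (sym (double-++ (range n) [ suc n ])) (cong double (sym (range-suc n))))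

  range-∷ : ∀ n → range (suc n) ≡ 1 ∷ map suc (range n)
  range-∷ n = cong (λ u → 1 ∷ map suc u) (sym (map-upTo suc n))

  Increasing : List ℕ → Set
  Increasing = AllPairs _<_

  range-increasing : ∀ n → Increasing (range n)
  range-increasing zero    = []
  range-increasing (suc n) = subst Increasing (sym (range-∷ n))
    (All.map⁺ (All.tabulate (λ v∈ → let u , _ , v≡ = ∈-map⁻ suc v∈ in s≤s (subst (0 <_) (sym v≡) z<s)))
     ∷ AllPairs.map⁺ (AllPairs.map s≤s (range-increasing n)))

  count : ℕ → List ℕ → ℕ
  count v s = length (filter (_<? v) s)

  -- For an increasing list `s` of the distinct values of a word, this is the value that `red`
  -- assigns, without deduplication.
  rank : List ℕ → ℕ → ℕ
  rank s v = suc (count v s)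

  count-∷-< : ∀ {v a} s → a < v → count v (a ∷ s) ≡ suc (count v s)
  count-∷-< {v} s a<v = cong length (filter-accept (_<? v) {xs = s} a<v)

  count-∷-≮ : ∀ {v a} s → ¬ a < v → count v (a ∷ s) ≡ count v s
  count-∷-≮ {v} s a≮v = cong length (filter-reject (_<? v) {xs = s} a≮v)

  count-≤ : ∀ {u v} s → u ≤ v → count u s ≤ count v s
  count-≤ []      u≤v = z≤n
  count-≤ {u} {v} (a ∷ s) u≤v = by-cases (a <? u) (a <? v)
    where
    by-cases : Dec (a < u) → Dec (a < v) → count u (a ∷ s) ≤ count v (a ∷ s)
    by-cases (yes a<u) (yes a<v) = subst₂ _≤_ (sym (count-∷-< s a<u)) (sym (count-∷-< s a<v)) (s≤s (count-≤ s u≤v))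
    by-cases (yes a<u) (no a≮v)  = contradiction (ℕ.<-≤-trans a<u u≤v) a≮v
    by-cases (no a≮u)  (yes a<v) = subst₂ _≤_ (sym (count-∷-≮ s a≮u)) (sym (count-∷-< s a<v)) (ℕ.m≤n⇒m≤1+n (count-≤ s u≤v))
    by-cases (no a≮u)  (no a≮v)  = subst₂ _≤_ (sym (count-∷-≮ s a≮u)) (sym (count-∷-≮ s a≮v)) (count-≤ s u≤v)

  -- The entry u itself is counted below v but not below u.
  count-< : ∀ {u v s} → u ∈ s → u < v → count u s < count v s
  count-< {u} {v} {a ∷ s} (here refl) u<v =
    subst₂ _<_ (sym (count-∷-≮ s (ℕ.<-irrefl {u} refl))) (sym (count-∷-< s u<v)) (s≤s (count-≤ s (ℕ.<⇒≤ u<v)))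
  count-< {u} {v} {a ∷ s} (there u∈) u<v = by-cases (a <? u) (a <? v)
    where
    by-cases : Dec (a < u) → Dec (a < v) → count u (a ∷ s) < count v (a ∷ s)
    by-cases (yes a<u) (yes a<v) = subst₂ _<_ (sym (count-∷-< s a<u)) (sym (count-∷-< s a<v)) (s≤s (count-< u∈ u<v))
    by-cases (yes a<u) (no a≮v)  = contradiction (ℕ.<-trans a<u u<v) a≮v
    by-cases (no a≮u)  (yes a<v) = subst₂ _<_ (sym (count-∷-≮ s a≮u)) (sym (count-∷-< s a<v)) (ℕ.m<n⇒m<1+n (count-< u∈ u<v))
    by-cases (no a≮u)  (no a≮v)  = subst₂ _<_ (sym (count-∷-≮ s a≮u)) (sym (count-∷-≮ s a≮v)) (count-< u∈ u<v)

  ranks : ∀ s → Increasing s → map (rank s) s ≡ range (length s)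
  ranks []      _           = refl
  ranks (a ∷ s) (a<s ∷ s<) = trans (cong₂ _∷_ (cong suc first) (trans (map-cong-local (All.map later a<s))
      (trans (map-∘ s) (cong (map suc) (ranks s s<))))) (sym (range-∷ (length s)))
    where
    first : count a (a ∷ s) ≡ 0
    first = cong length (filter-none (_<? a) (ℕ.<-irrefl refl ∷ All.map ℕ.<-asym a<s))
    later : ∀ {v} → a < v → rank (a ∷ s) v ≡ suc (rank s v)
    later a<v = cong (suc ∘ length) (filter-accept (_<? _) a<v)

  module _ {c s : List ℕ} (s< : Increasing s) (c↭ : c ↭ double s) where

    private
      s! : Unique s
      s! = AllPairs.map ℕ.<⇒≢ s<

      ∈c⇒∈s : ∀ {v} → v ∈ c → v ∈ s
      ∈c⇒∈s v∈ = ∈-double⁻ s (∈-resp-↭ c↭ v∈)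

    distinct-below : ∀ v → length (deduplicate ℕ._≟_ (filter (_<? v) c)) ≡ count v s
    distinct-below v = ↭-length (∼bag⇒↭ (unique∧set⇒bag (deduplicate-! _) (Unique.filter⁺ (_<? v) s!) (mk⇔
      (λ u∈ → let u∈c , u<v = ∈-filter⁻ (_<? v) {xs = c} (∈-deduplicate⁻ ℕ._≟_ _ u∈) in ∈-filter⁺ (_<? v) (∈c⇒∈s u∈c) u<v)
      (λ u∈ → let u∈s , u<v = ∈-filter⁻ (_<? v) {xs = s} u∈ in
         ∈-deduplicate⁺ ℕ._≟_ (∈-filter⁺ (_<? v) (∈-resp-↭ (↭-sym c↭) (∈-double⁺ u∈s)) u<v)))))

    red≡ : red c ≡ map (rank s) c
    red≡ = map-cong (λ v → cong suc (distinct-below v)) c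

    red-↭ : red c ↭ doubled (length s)
    red-↭ = ↭-trans (↭-reflexive red≡) (↭-trans (↭-map⁺ (rank s) c↭) (↭-reflexive
      (trans (double-map (rank s) s) (trans (cong double (ranks s s<)) (sym (doubled≡double-range (length s)))))))

    half-length : length c ℕ./ 2 ≡ length s
    half-length = trans (cong (ℕ._/ 2) (trans (↭-length c↭) (length-double s))) (m*n/n≡m (length s) 2)

    rank-mono : StrictlyMonotoneOn c (rank s)
    rank-mono u∈ _ u<v = s≤s (count-< (∈c⇒∈s u∈) u<v)

    -- That `red c` rearranges 1, 1, ..., k, k already follows from `c ↭ double s`; the order
    -- condition passes from `c` to `red c` by monotonicity of the rank.
    isStirling⁺ : Stirling c → IsStirling (length c ℕ./ 2) (red c)
    isStirling⁺ h = subst (λ k → red c ↭ doubled k) (sym half-length) red-↭ ,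
      stirling⁻ (subst Stirling (sym red≡) (stirling-map⁺ rank-mono (All.tabulate (λ v∈ → v∈)) h))

    isStirling⁻ : IsStirling (length c ℕ./ 2) (red c) → Stirling c
    isStirling⁻ (_ , h) = stirling-map⁻ rank-mono (All.tabulate (λ v∈ → v∈)) (subst Stirling red≡ (stirling⁺ (red c) h))

  Separated : List ℕ → List ℕ → Set
  Separated c d = Disjoint c d × firstEntry c < firstEntry d

  -- Membership in 𝒬_n^2 for all n ≥ 0, where n = 0 gives the empty list of cycles only.
  record Q² (n : ℕ) (σ : List (List ℕ)) : Set where
    field
      entries   : concat σ ↭ doubled n
      separated : AllPairs Separated σ
      headIsMin : All HeadIsMin σ
      stirling  : All Stirling σ

  module _ {n σ} (entries : concat σ ↭ doubled n) (disjoint : AllPairs Disjoint σ) where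

    private
      filter-concat : ∀ {c} σ → AllPairs Disjoint σ → c ∈ σ → filter (_∈? c) (concat σ) ≡ c
      filter-concat {c} (d ∷ σ) (d∥σ ∷ σ∥) (here refl) = trans (filter-++ (_∈? c) d (concat σ))
        (trans (cong₂ _++_ (filter-all (_∈? c) (All.tabulate (λ v∈ → v∈)))
          (filter-none (_∈? c) (All.tabulate (λ v∈σ v∈c → let e , v∈e , e∈σ = ∈-concat⁻′ σ v∈σ in All.lookup d∥σ e∈σ (v∈c , v∈e)))))
          (++-identityʳ c))
      filter-concat {c} (d ∷ σ) (d∥σ ∷ σ∥) (there c∈) = trans (filter-++ (_∈? c) d (concat σ))
        (cong₂ _++_ (filter-none (_∈? c) (All.tabulate (λ v∈d v∈c → All.lookup d∥σ c∈ (v∈d , v∈c)))) (filter-concat σ σ∥ c∈))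

    -- Restricting the list of all entries to the members of `c` leaves `c` itself, as the other
    -- cycles are disjoint from it. Restricting 1, 1, ..., n, n in the same way leaves a doubled
    -- increasing list.
    cycle-↭-double : ∀ {c} → c ∈ σ → ∃[ s ] (Increasing s × c ↭ double s)
    cycle-↭-double {c} c∈ = filter (_∈? c) (range n) , AllPairs.filter⁺ (_∈? c) (range-increasing n) ,
      ↭-trans (↭-reflexive (sym (filter-concat σ disjoint c∈))) (↭-trans (filter-↭ (_∈? c) entries)
        (↭-reflexive (trans (cong (filter (_∈? c)) (doubled≡double-range n)) (double-filter (_∈? c) (range n)))))

  all-lookup⁺ : {A : Set} {P : A → Set} (xs : List A) → (∀ i → P (lookup xs i)) → All P xs
  all-lookup⁺ []       h = []
  all-lookup⁺ (a ∷ xs) h = h zero ∷ all-lookup⁺ xs (λ i → h (suc i))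

  allPairs-lookup⁺ : {A : Set} {R : A → A → Set} (xs : List A) → (∀ i j → i Fin.< j → R (lookup xs i) (lookup xs j)) → AllPairs R xs
  allPairs-lookup⁺ []       h = []
  allPairs-lookup⁺ (a ∷ xs) h = all-lookup⁺ xs (λ i → h zero (suc i) (s≤s z≤n)) ∷ allPairs-lookup⁺ xs (λ i j i<j → h (suc i) (suc j) (s≤s i<j))

  allPairs-lookup⁻ : {A : Set} {R : A → A → Set} {xs : List A} → AllPairs R xs → ∀ i j → i Fin.< j → R (lookup xs i) (lookup xs j)
  allPairs-lookup⁻ (h ∷ _) zero    (suc j) _         = All.lookup h (∈-lookup j)
  allPairs-lookup⁻ (_ ∷ h) (suc i) (suc j) (s≤s i<j) = allPairs-lookup⁻ h i j i<j

  isQ2⇒Q² : ∀ {n σ} → IsQ2 n σ → Q² n σ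
  isQ2⇒Q² {n} {σ} (_ , entries , disjoint , headIsMin , increasing , stirling) = record
    { entries   = entries
    ; separated = AllPairs.zip (disjoint′ , allPairs-lookup⁺ σ increasing)
    ; headIsMin = headIsMin
    ; stirling  = All.tabulate (λ c∈ → let s , s< , c↭ = cycle-↭-double {n} entries disjoint′ c∈ in isStirling⁻ s< c↭ (All.lookup stirling c∈)) }
    where
    disjoint′ : AllPairs Disjoint σ
    disjoint′ = allPairs-lookup⁺ σ (λ i j i<j (v∈i , v∈j) → Fin.<⇒≢ i<j (disjoint i j _ v∈i v∈j))

  -- The index is a successor because `IsQ2` asks for at least one cycle, and the entry 1 provides
  -- it.
  Q²⇒isQ2 : ∀ {n σ} → Q² (suc n) σ → IsQ2 (suc n) σ
  Q²⇒isQ2 {n} {σ} q = nonempty σ entries , entries , disjoint , headIsMin , allPairs-lookup⁻ (AllPairs.map proj₂ separated) ,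
    All.tabulate (λ c∈ → let s , s< , c↭ = cycle-↭-double {suc n} entries (AllPairs.map proj₁ separated) c∈ in isStirling⁺ s< c↭ (All.lookup stirling c∈))
    where
    open Q² q
    nonempty : ∀ σ → concat σ ↭ doubled (suc n) → 0 < length σ
    nonempty []      p = contradiction (∈-resp-↭ (↭-sym p) (subst (1 ∈_) (sym (trans (doubled≡double-range (suc n)) (cong double (range-∷ n)))) (here refl))) λ ()
    nonempty (_ ∷ _) _ = z<s
    disjoint : ∀ (i j : Fin (length σ)) v → v ∈ lookup σ i → v ∈ lookup σ j → i ≡ j
    disjoint i j v v∈i v∈j with Fin.<-cmp i j
    ... | tri< i<j _ _ = contradiction (v∈i , v∈j) (proj₁ (allPairs-lookup⁻ separated i j i<j))
    ... | tri≈ _ i≡j _ = i≡j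
    ... | tri> _ _ j<i = contradiction (v∈j , v∈i) (proj₁ (allPairs-lookup⁻ separated j i j<i))

-- Extending lists of cycles by a new largest value.

module CycleInsertions where
  open import Defs using (HeadIsMin; firstEntry; doubled; range)
  open Words
  open Insertions
  open StirlingCycles
  open import Data.List.Relation.Binary.Permutation.Propositional.Properties using (All-resp-↭; ∈-resp-↭; ↭-length; drop-∷; drop-mid; shifts; ++-comm; ++⁺ˡ; ++⁺ʳ)
  open import Relation.Binary.PropositionalEquality using (_≡_; _≢_; refl; sym; trans; cong; cong₂; subst)

  module _ (m : ℕ) where

    private
      mm : List ℕ
      mm = m ∷ m ∷ []

    data Modify : List (List ℕ) → List (List ℕ) → Set where
      here  : ∀ {c c′ σ} → InsertAfter mm c c′ → Modify (c ∷ σ) (c′ ∷ σ)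
      there : ∀ {c σ τ} → Modify σ τ → Modify (c ∷ σ) (c ∷ τ)

    modify⁻ : ∀ σ {τ} → τ ∈ modifyCycle m σ → Modify σ τ
    modify⁻ (c ∷ σ) τ∈ with ∈-++⁻ (map (_∷ σ) (insertAfter mm c)) τ∈
    ... | inj₁ τ∈ˡ with ∈-map⁻ (_∷ σ) τ∈ˡ
    ...   | c′ , c′∈ , refl = here (insertAfter⁻ mm c c′∈)
    modify⁻ (c ∷ σ) τ∈ | inj₂ τ∈ʳ with ∈-map⁻ (c ∷_) τ∈ʳ
    ...   | τ′ , τ′∈ , refl = there (modify⁻ σ τ′∈)

    modify⁺ : ∀ {σ τ} → Modify σ τ → τ ∈ modifyCycle m σ
    modify⁺ (here {σ = σ} p)    = ∈-++⁺ˡ (∈-map⁺ (_∷ σ) (insertAfter⁺ p))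
    modify⁺ (there {c} {σ} p)   = ∈-++⁺ʳ (map (_∷ σ) (insertAfter mm c)) (∈-map⁺ (c ∷_) (modify⁺ p))

    inserted-∈ : ∀ {a w v} → InsertAfter mm w v → a ≢ m → a ∈ v → a ∈ w
    inserted-∈ p a≢m a∈v with ∈-resp-↭ (InsertAfter-↭ p) a∈v
    ... | here a≡m          = contradiction a≡m a≢m
    ... | there (here a≡m)  = contradiction a≡m a≢m
    ... | there (there a∈w) = a∈w

    inserted-⊆ : ∀ {a w v} → InsertAfter mm w v → a ∈ w → a ∈ v
    inserted-⊆ p a∈w = ∈-resp-↭ (↭-sym (InsertAfter-↭ p)) (there (there a∈w))

    -- The new letters exceed `a`, and they are no further occurrences of `a` that could impose
    -- conditions on earlier entries.
    between-insert⁺ : ∀ {a w v} → InsertAfter mm w v → a < m → Between a w → Between a v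
    between-insert⁺ here a<m (h ∷ hs) =
      (λ a∈ → h (after a∈)) ∷ (λ _ → a<m) ∷ (λ _ → a<m) ∷ hs
      where
      after : ∀ {w} → _ ∈ m ∷ m ∷ w → _ ∈ w
      after (here a≡m)          = contradiction a≡m (ℕ.<⇒≢ a<m)
      after (there (here a≡m))  = contradiction a≡m (ℕ.<⇒≢ a<m)
      after (there (there a∈w)) = a∈w
    between-insert⁺ (there p) a<m (h ∷ hs) = (λ a∈ → h (inserted-∈ p (ℕ.<⇒≢ a<m) a∈)) ∷ between-insert⁺ p a<m hs

    between-insert⁻ : ∀ {a w v} → InsertAfter mm w v → Between a v → Between a w
    between-insert⁻ here      (h ∷ _ ∷ _ ∷ hs) = (λ a∈ → h (there (there a∈))) ∷ hs
    between-insert⁻ (there p) (h ∷ hs)         = (λ a∈ → h (inserted-⊆ p a∈)) ∷ between-insert⁻ p hs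

    <⇒∉ : ∀ {w} → All (_< m) w → m ∉ w
    <⇒∉ w<m m∈w = ℕ.<-irrefl refl (All.lookup w<m m∈w)

    between-max : ∀ {w} → All (_< m) w → Between m w
    between-max []          = []
    between-max (_ ∷ w<m)   = (λ m∈w → contradiction m∈w (<⇒∉ w<m)) ∷ between-max w<m

    -- The two copies of m are adjacent, so nothing lies between them, and m exceeds every value
    -- whose two occurrences it may separate.
    stirling-insert⁺ : ∀ {w v} → InsertAfter mm w v → All (_< m) w → Stirling w → Stirling v
    stirling-insert⁺ here (a<m ∷ w<m) (h ∷ hs) =
      ((λ _ → a<m) ∷ (λ _ → a<m) ∷ h) ∷ ((λ m∈w → contradiction m∈w (<⇒∉ w<m)) ∷ between-max w<m) ∷ between-max w<m ∷ hs
    stirling-insert⁺ (there p) (a<m ∷ w<m) (h ∷ hs) = between-insert⁺ p a<m h ∷ stirling-insert⁺ p w<m hs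

    stirling-insert⁻ : ∀ {w v} → InsertAfter mm w v → Stirling v → Stirling w
    stirling-insert⁻ here      ((_ ∷ _ ∷ h) ∷ _ ∷ _ ∷ hs) = h ∷ hs
    stirling-insert⁻ (there p) (h ∷ hs)                   = between-insert⁻ p h ∷ stirling-insert⁻ p hs

    headIsMin-insert⁺ : ∀ {c c′} → InsertAfter mm c c′ → All (_< m) c → HeadIsMin c → HeadIsMin c′
    headIsMin-insert⁺ (here {a} {w}) (a<m ∷ _) (.a , .w , refl , a≤w) = a , m ∷ m ∷ w , refl , ℕ.<⇒≤ a<m ∷ ℕ.<⇒≤ a<m ∷ a≤w
    headIsMin-insert⁺ (there {a} {w} {v} p) (a<m ∷ _) (.a , .w , refl , a≤w) =
      a , v , refl , All-resp-↭ (↭-sym (InsertAfter-↭ p)) (ℕ.<⇒≤ a<m ∷ ℕ.<⇒≤ a<m ∷ a≤w)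

    headIsMin-insert⁻ : ∀ {c c′} → InsertAfter mm c c′ → HeadIsMin c′ → HeadIsMin c
    headIsMin-insert⁻ (here {a} {w}) (.a , _ , refl , _ ∷ _ ∷ a≤w) = a , w , refl , a≤w
    headIsMin-insert⁻ (there {a} {w} {v} p) (.a , .v , refl , a≤v) = a , w , refl , All.tail (All.tail (All-resp-↭ (InsertAfter-↭ p) a≤v))

    firstEntry-insert : ∀ {c c′} → InsertAfter mm c c′ → firstEntry c ≡ firstEntry c′
    firstEntry-insert here      = refl
    firstEntry-insert (there _) = refl

    separatedˡ⁺ : ∀ {c c′ d} → InsertAfter mm c c′ → All (_< m) d → Separated c d → Separated c′ d
    separatedˡ⁺ p d<m (c∥d , c<d) =
      (λ (v∈c′ , v∈d) → c∥d (inserted-∈ p (ℕ.<⇒≢ (All.lookup d<m v∈d)) v∈c′ , v∈d)) , subst (_< _) (firstEntry-insert p) c<d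

    separatedʳ⁺ : ∀ {c c′ d} → InsertAfter mm c c′ → All (_< m) d → Separated d c → Separated d c′
    separatedʳ⁺ p d<m (d∥c , d<c) =
      (λ (v∈d , v∈c′) → d∥c (v∈d , inserted-∈ p (ℕ.<⇒≢ (All.lookup d<m v∈d)) v∈c′)) , subst (_ <_) (firstEntry-insert p) d<c

    separatedˡ⁻ : ∀ {c c′ d} → InsertAfter mm c c′ → Separated c′ d → Separated c d
    separatedˡ⁻ p (c∥d , c<d) = (λ (v∈c , v∈d) → c∥d (inserted-⊆ p v∈c , v∈d)) , subst (_< _) (sym (firstEntry-insert p)) c<d

    separatedʳ⁻ : ∀ {c c′ d} → InsertAfter mm c c′ → Separated d c′ → Separated d c
    separatedʳ⁻ p (d∥c , d<c) = (λ (v∈d , v∈c) → d∥c (v∈d , inserted-⊆ p v∈c)) , subst (_ <_) (sym (firstEntry-insert p)) d<c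

    all-separated⁺ : ∀ {d σ τ} → Modify σ τ → All (_< m) d → All (Separated d) σ → All (Separated d) τ
    all-separated⁺ (here p)  d<m (s ∷ ss) = separatedʳ⁺ p d<m s ∷ ss
    all-separated⁺ (there q) d<m (s ∷ ss) = s ∷ all-separated⁺ q d<m ss

    all-separated⁻ : ∀ {d σ τ} → Modify σ τ → All (Separated d) τ → All (Separated d) σ
    all-separated⁻ (here p)  (s ∷ ss) = separatedʳ⁻ p s ∷ ss
    all-separated⁻ (there q) (s ∷ ss) = s ∷ all-separated⁻ q ss

    separated-modify⁺ : ∀ {σ τ} → Modify σ τ → All (All (_< m)) σ → AllPairs Separated σ → AllPairs Separated τ
    separated-modify⁺ (here p)  (_ ∷ σ<m)   (s ∷ ss) = All.zipWith (λ (d<m , s) → separatedˡ⁺ p d<m s) (σ<m , s) ∷ ss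
    separated-modify⁺ (there q) (c<m ∷ σ<m) (s ∷ ss) = all-separated⁺ q c<m s ∷ separated-modify⁺ q σ<m ss

    separated-modify⁻ : ∀ {σ τ} → Modify σ τ → AllPairs Separated τ → AllPairs Separated σ
    separated-modify⁻ (here p)  (s ∷ ss) = All.map (separatedˡ⁻ p) s ∷ ss
    separated-modify⁻ (there q) (s ∷ ss) = all-separated⁻ q s ∷ separated-modify⁻ q ss

    all-modify⁺ : ∀ {P : List ℕ → Set} → (∀ {c c′} → InsertAfter mm c c′ → All (_< m) c → P c → P c′) →
      ∀ {σ τ} → Modify σ τ → All (All (_< m)) σ → All P σ → All P τ
    all-modify⁺ f (here p)  (c<m ∷ _)  (h ∷ hs) = f p c<m h ∷ hs
    all-modify⁺ f (there q) (_ ∷ σ<m)  (h ∷ hs) = h ∷ all-modify⁺ f q σ<m hs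

    all-modify⁻ : ∀ {P : List ℕ → Set} → (∀ {c c′} → InsertAfter mm c c′ → P c′ → P c) → ∀ {σ τ} → Modify σ τ → All P τ → All P σ
    all-modify⁻ f (here p)  (h ∷ hs) = f p h ∷ hs
    all-modify⁻ f (there q) (h ∷ hs) = h ∷ all-modify⁻ f q hs

    concat-modify : ∀ {σ τ} → Modify σ τ → concat τ ↭ m ∷ m ∷ concat σ
    concat-modify (here {σ = σ} p)  = ++⁺ʳ (concat σ) (InsertAfter-↭ p)
    concat-modify (there {c} q)     = ↭-trans (++⁺ˡ c (concat-modify q)) (shifts c mm)

    concat-∷ʳ : ∀ σ → concat (σ ++ [ mm ]) ↭ m ∷ m ∷ concat σ
    concat-∷ʳ σ = ↭-trans (↭-reflexive (sym (concat-++ σ [ mm ]))) (++-comm (concat σ) mm)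

    length-modify : ∀ {σ τ} → Modify σ τ → length τ ≡ length σ
    length-modify (here _)  = refl
    length-modify (there q) = cong suc (length-modify q)

    modifyCycle-unique : ∀ σ → All (All (_< m)) σ → Unique (modifyCycle m σ)
    modifyCycle-unique []      _           = []
    modifyCycle-unique (c ∷ σ) (c<m ∷ σ<m) = Unique.++⁺
      (Unique.map⁺ ∷-injectiveˡ (insertAfter-unique [ m ] c (<⇒≢-all c<m)))
      (Unique.map⁺ ∷-injectiveʳ (modifyCycle-unique σ σ<m))
      -- A list in the first group starts with a cycle longer than `c` by two, a list in the second
      -- group with `c` itself.
      λ (τ∈ˡ , τ∈ʳ) → let c′ , c′∈ , τ≡ = ∈-map⁻ (_∷ σ) τ∈ˡ
                          _ , _ , τ≡′ = ∈-map⁻ (c ∷_) τ∈ʳ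
                      in ℕ.m≢1+n+m (length c) (trans (cong length (∷-injectiveˡ (trans (sym τ≡′) τ≡))) (length-insertAfter mm c c′∈))

    -- The number of cycles tells the new cycle apart from the modifications, which keep it.
    extend-unique : ∀ σ → All (All (_< m)) σ → Unique (extend m σ)
    extend-unique σ σ<m = All.tabulate (λ τ∈ σ≡ → ℕ.1+n≢n (trans (sym (trans (length-++ σ) (ℕ.+-comm (length σ) 1)))
        (trans (cong length σ≡) (length-modify (modify⁻ σ τ∈))))) ∷ modifyCycle-unique σ σ<m

    -- Deleting m empties a cycle `m m`, and the filter then drops it.
    restrict : List (List ℕ) → List (List ℕ)
    restrict τ = filter (λ c → 0 <? length c) (map (remove m) τ)

    module _ {σ} (σ<m : All (All (_< m)) σ) (nonempty : All (λ c → 0 < length c) σ) where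

      private
        map-remove : ∀ σ → All (All (_< m)) σ → map (remove m) σ ≡ σ
        map-remove []      _           = refl
        map-remove (c ∷ σ) (c<m ∷ σ<m) = cong₂ _∷_ (filter-all (m ≢?_) (<⇒≢-all c<m)) (map-remove σ σ<m)

        map-remove-modify : ∀ {σ τ} → Modify σ τ → All (All (_< m)) σ → map (remove m) τ ≡ σ
        map-remove-modify (here p)  (c<m ∷ σ<m) = cong₂ _∷_ (remove-InsertAfter (refl ∷ refl ∷ []) c<m p) (map-remove _ σ<m)
        map-remove-modify (there q) (c<m ∷ σ<m) = cong₂ _∷_ (filter-all (m ≢?_) (<⇒≢-all c<m)) (map-remove-modify q σ<m)

        keep-nonempty : filter (λ c → 0 <? length c) σ ≡ σ
        keep-nonempty = filter-all (λ c → 0 <? length c) nonempty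

      restrict-extend : ∀ {τ} → τ ∈ extend m σ → restrict τ ≡ σ
      restrict-extend (here refl) = trans (cong (filter (λ c → 0 <? length c)) (trans (map-++ (remove m) σ [ mm ])
          (cong₂ _++_ (map-remove σ σ<m) (cong [_] (filter-none (m ≢?_) {xs = mm} ((λ p → p refl) ∷ (λ p → p refl) ∷ []))))))
        (trans (filter-++ (λ c → 0 <? length c) σ [ [] ]) (trans (++-identityʳ _) keep-nonempty))
      restrict-extend (there τ∈) = trans (cong (filter (λ c → 0 <? length c)) (map-remove-modify (modify⁻ σ τ∈) σ<m)) keep-nonempty

    double-max : ∀ s → Increasing s → All (_≤ m) s → m ∈ s → ∃[ d ] (double s ↭ m ∷ m ∷ d × All (_< m) d)
    double-max (a ∷ [])    _            _           (here refl) = [] , ↭-refl , []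
    double-max (a ∷ b ∷ s) ((a<b ∷ _) ∷ _) (_ ∷ b≤m ∷ _) (here refl) = contradiction a<b (ℕ.≤⇒≯ b≤m)
    double-max (a ∷ s)     (a<s ∷ s<)   (_ ∷ s≤m)   (there m∈s) with double-max s s< s≤m m∈s
    ... | d , s↭ , d<m = a ∷ a ∷ d , ↭-trans (++⁺ˡ (a ∷ a ∷ []) s↭) (shifts (a ∷ a ∷ []) mm) , All.lookup a<s m∈s ∷ All.lookup a<s m∈s ∷ d<m

    -- An entry between the two copies of the maximum would have to exceed it.
    adjacent : ∀ w {d} → Between m w → w ↭ m ∷ d → All (_< m) d → ∃[ v ] (w ≡ m ∷ v × All (_< m) v)
    adjacent [] _ w↭ _ with ∈-resp-↭ (↭-sym w↭) (here refl)
    ... | ()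
    adjacent (b ∷ v) (h ∷ _) w↭ d<m with ∈-resp-↭ (↭-sym w↭) (here refl)
    ... | here refl = v , refl , All-resp-↭ (↭-sym (drop-∷ w↭)) d<m
    ... | there m∈v = contradiction (h m∈v)
      (ℕ.≤⇒≯ (All.lookup (ℕ.≤-refl ∷ All.map ℕ.<⇒≤ d<m) (∈-resp-↭ w↭ (here refl))))

    -- If the word starts with m, the other m comes next by `adjacent`. Any other first letter is
    -- split off and deleted from `d`, and the induction continues with the rest.
    maximum-adjacent : ∀ w {d} → Stirling w → w ↭ m ∷ m ∷ d → All (_< m) d → ∃[ u ] ∃[ v ] (w ≡ u ++ m ∷ m ∷ v × All (_< m) (u ++ v))
    maximum-adjacent [] _ w↭ _ with ∈-resp-↭ (↭-sym w↭) (here refl)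
    ... | ()
    maximum-adjacent (a ∷ w) (h ∷ hs) w↭ d<m with ∈-resp-↭ w↭ (here refl)
    ... | here refl          = let v , w≡ , v<m = adjacent w h (drop-∷ w↭) d<m in [] , v , cong (m ∷_) w≡ , v<m
    ... | there (here refl)  = let v , w≡ , v<m = adjacent w h (drop-∷ w↭) d<m in [] , v , cong (m ∷_) w≡ , v<m
    ... | there (there a∈d) with ∈-∃++ a∈d
    ...   | d₁ , d₂ , refl with maximum-adjacent w hs (drop-mid [] (m ∷ m ∷ d₁) w↭) (All.++⁺ (All.++⁻ˡ d₁ d<m) (All.tail (All.++⁻ʳ d₁ d<m)))
    ...     | u , v , refl , uv<m = a ∷ u , v , refl , All.lookup d<m a∈d ∷ uv<m

    -- The facts about one cycle from which m can be removed, m being the largest value overall. The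
    -- field `twice` expresses that the two copies of m share a cycle.
    record Cycle (c : List ℕ) : Set where
      field
        headIsMin : HeadIsMin c
        stirling  : Stirling c
        bounded   : All (_≤ m) c
        twice     : m ∈ c → ∃[ d ] (c ↭ m ∷ m ∷ d × All (_< m) d)

    -- If a letter precedes the two copies of m, they were inserted after it. Otherwise the cycle
    -- starts with m, and as its head is minimal, no smaller letter can follow.
    shrink : ∀ {c} → Cycle c → m ∈ c → c ≡ mm ⊎ ∃[ d ] InsertAfter mm d c
    shrink {c} C m∈c with Cycle.twice C m∈c
    ... | d , c↭ , d<m with maximum-adjacent c (Cycle.stirling C) c↭ d<m
    ...   | a ∷ u , v , refl , _    = inj₂ (a ∷ u ++ v , insertAfter-split a u v)
    ...   | []    , [] , refl , _   = inj₁ refl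
    ...   | []    , b ∷ v , refl , b<m ∷ _ with Cycle.headIsMin C
    ...     | _ , _ , refl , _ ∷ m≤b ∷ _ = contradiction b<m (ℕ.≤⇒≯ m≤b)

    -- A cycle `m m` must be the last one, since the first entry of a later cycle would exceed m.
    locate : ∀ τ → All Cycle τ → AllPairs Separated τ → m ∈ concat τ → ∃[ σ ] (τ ≡ σ ++ [ mm ] ⊎ Modify σ τ)
    locate (c ∷ τ) (C ∷ Cs) (s ∷ ss) m∈ with ∈-++⁻ c m∈
    ... | inj₂ m∈τ with locate τ Cs ss m∈τ
    ...   | σ , inj₁ refl = c ∷ σ , inj₁ refl
    ...   | σ , inj₂ q    = c ∷ σ , inj₂ (there q)
    locate (c ∷ τ) (C ∷ Cs) (s ∷ ss) m∈ | inj₁ m∈c with shrink C m∈c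
    ... | inj₂ (d , p) = d ∷ τ , inj₂ (here p)
    ... | inj₁ refl    with τ | Cs | s
    ...   | []    | _      | _           = [] , inj₁ refl
    ...   | d ∷ _ | D ∷ _  | (_ , m<d) ∷ _ with Cycle.headIsMin D | Cycle.bounded D
    ...     | _ , _ , refl , _ | h≤m ∷ _ = contradiction m<d (ℕ.≤⇒≯ h≤m)

  doubled-suc-↭ : ∀ n → doubled (suc n) ↭ suc n ∷ suc n ∷ doubled n
  doubled-suc-↭ n = ++-comm (doubled n) _

  doubled-≤ : ∀ n → All (_≤ n) (doubled n)
  doubled-≤ zero    = []
  doubled-≤ (suc n) = All-resp-↭ (↭-sym (doubled-suc-↭ n)) (ℕ.≤-refl ∷ ℕ.≤-refl ∷ All.map ℕ.m≤n⇒m≤1+n (doubled-≤ n))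

  module _ {n σ} (q : Q² n σ) where
    open Q² q

    concat-< : All (_< suc n) (concat σ)
    concat-< = All.map s≤s (All-resp-↭ (↭-sym entries) (doubled-≤ n))

    cycles-< : All (All (_< suc n)) σ
    cycles-< = All.concat⁻ concat-<

    nonempty : All (λ c → 0 < length c) σ
    nonempty = All.map (λ { (_ , _ , refl , _) → z<s }) headIsMin

    length-concat : length (concat σ) ≡ 2 ℕ.* n
    length-concat = trans (↭-length entries) (trans (cong length (doubled≡double-range n)) (trans (length-double (range n))
      (trans (cong (ℕ._* 2) (perm-length {n} ↭-refl)) (ℕ.*-comm n 2))))

  Q²-0 : ∀ {σ} → Q² 0 σ → σ ≡ []
  Q²-0 {[]}    _ = refl
  Q²-0 {c ∷ σ} q with Q².headIsMin q
  ... | (_ , _ , refl , _) ∷ _ = contradiction (∈-resp-↭ (Q².entries q) (here refl)) λ ()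

  extend-sound : ∀ {n σ τ} → Q² n σ → τ ∈ extend (suc n) σ → Q² (suc n) τ
  extend-sound {n} {σ} q (here refl) = record
    { entries   = ↭-trans (concat-∷ʳ (suc n) σ) (↭-trans (++⁺ˡ (suc n ∷ suc n ∷ []) entries) (↭-sym (doubled-suc-↭ n)))
    ; separated = AllPairs.++⁺ separated ([] ∷ []) (All.zipWith (λ (c<m , h) → last c<m h ∷ []) (cycles-< q , headIsMin))
    ; headIsMin = All.++⁺ headIsMin ((suc n , [ suc n ] , refl , ℕ.≤-refl ∷ []) ∷ [])
    ; stirling  = All.++⁺ stirling ((((λ ()) ∷ []) ∷ [] ∷ []) ∷ []) }
    where
    open Q² q
    last : ∀ {c} → All (_< suc n) c → HeadIsMin c → Separated c (suc n ∷ suc n ∷ [])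
    last c<m@(a<m ∷ _) (_ , _ , refl , _) = (λ { (v∈c , here refl) → <⇒∉ (suc n) c<m v∈c ; (v∈c , there (here refl)) → <⇒∉ (suc n) c<m v∈c }) , a<m
  extend-sound {n} {σ} q (there τ∈) = record
    { entries   = ↭-trans (concat-modify (suc n) p) (↭-trans (++⁺ˡ (suc n ∷ suc n ∷ []) entries) (↭-sym (doubled-suc-↭ n)))
    ; separated = separated-modify⁺ (suc n) p (cycles-< q) separated
    ; headIsMin = all-modify⁺ (suc n) (headIsMin-insert⁺ (suc n)) p (cycles-< q) headIsMin
    ; stirling  = all-modify⁺ (suc n) (stirling-insert⁺ (suc n)) p (cycles-< q) stirling }
    where
    open Q² q
    p = modify⁻ (suc n) σ τ∈

  extend-exhaustive : ∀ {n τ} → Q² (suc n) τ → ∃[ σ ] (Q² n σ × τ ∈ extend (suc n) σ)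
  extend-exhaustive {n} {τ} q with locate (suc n) τ cycles separated (∈-resp-↭ (↭-sym (↭-trans entries (doubled-suc-↭ n))) (here refl))
    where
    open Q² q
    cycles : All (Cycle (suc n)) τ
    cycles = All.tabulate λ c∈ → let s , s< , c↭ = cycle-↭-double {suc n} entries (AllPairs.map proj₁ separated) c∈
                                     c≤ = All.map ℕ.≤-pred (All.lookup (cycles-< q) c∈) in record
      { headIsMin = All.lookup headIsMin c∈
      ; stirling  = All.lookup stirling c∈
      ; bounded   = c≤
      ; twice     = λ m∈c → let d , s↭ , d<m = double-max (suc n) s s<
                                      (All.tabulate (λ v∈s → All.lookup c≤ (∈-resp-↭ (↭-sym c↭) (∈-double⁺ v∈s))))
                                      (∈-double⁻ s (∈-resp-↭ c↭ m∈c))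
                            in d , ↭-trans c↭ s↭ , d<m }
  ... | σ , inj₁ refl = σ , record
      { entries   = drop-∷ (drop-∷ (↭-trans (↭-sym (concat-∷ʳ (suc n) σ)) (↭-trans entries (doubled-suc-↭ n))))
      ; separated = allPairs-++⁻ˡ σ separated
      ; headIsMin = All.++⁻ˡ σ headIsMin
      ; stirling  = All.++⁻ˡ σ stirling } , here refl
    where
    open Q² q
    allPairs-++⁻ˡ : ∀ σ {τ} → AllPairs Separated (σ ++ τ) → AllPairs Separated σ
    allPairs-++⁻ˡ []      _        = []
    allPairs-++⁻ˡ (c ∷ σ) (s ∷ ss) = All.++⁻ˡ σ s ∷ allPairs-++⁻ˡ σ ss
  ... | σ , inj₂ p = σ , record
      { entries   = drop-∷ (drop-∷ (↭-trans (↭-sym (concat-modify (suc n) p)) (↭-trans entries (doubled-suc-↭ n))))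
      ; separated = separated-modify⁻ (suc n) p separated
      ; headIsMin = all-modify⁻ (suc n) (headIsMin-insert⁻ (suc n)) p headIsMin
      ; stirling  = all-modify⁻ (suc n) (stirling-insert⁻ (suc n)) p stirling } , there (modify⁺ (suc n) p)
    where open Q² q

  Q²-extension : ∀ n → Extension (Q² n) (Q² (suc n)) (extend (suc n)) (restrict (suc n))
  Q²-extension n = record
    { unique     = λ {σ} q → extend-unique (suc n) σ (cycles-< q)
    ; sound      = extend-sound
    ; restricts  = λ q τ∈ → restrict-extend (suc n) (cycles-< q) (nonempty q) τ∈
    ; exhaustive = extend-exhaustive }

-- From the given enumerations to the three identities.

module Assembly where
  open import Defs
  open SeriesRing
  open PartialDerivatives
  open ClosedForm
  open GeneratingFunction
  open Words
  open WeightRecurrences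
  open Insertions
  open StirlingCycles
  open CycleInsertions
  open import Data.Nat using (_^_; _*_)
  open import Data.Nat.Combinatorics using (_C_)
  open import Data.List.Relation.Binary.Permutation.Propositional.Properties using (↭-empty-inv)
  open ≡ using (_≡_)

  private
    module 𝓡 = Recurrences.Weighted seriesRing constant-homomorphism X Y Qv L L-derivation L-X L-Y L-Q

  open SA using (refl; sym; trans; reflexive; +-cong; +-congˡ; +-congʳ; *-cong; *-congˡ; *-congʳ; ι; pow; ∑; ∑<; ≡⇒≈; ⟪_⟫; solve; _:=_; _:+_; _:*_; 1′; con; begin_; step-≈-⟩; step-≈-⟨; _∎; step-≡-⟩; step-≡-⟨)

  pow-X-mono : ∀ i i′ j k → pow X i *S mono i′ j k 0 ≋ mono (i ℕ.+ i′) j k 0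
  pow-X-mono zero    i′ j k = SA.*-identityˡ (mono i′ j k 0)
  pow-X-mono (suc i) i′ j k = trans (SA.*-assoc X (pow X i) (mono i′ j k 0)) (trans (*-congˡ {X} (pow-X-mono i i′ j k)) (X*mono (i ℕ.+ i′) j k))

  pow-Y-mono : ∀ j i j′ k → pow Y j *S mono i j′ k 0 ≋ mono i (j ℕ.+ j′) k 0
  pow-Y-mono zero    i j′ k = SA.*-identityˡ (mono i j′ k 0)
  pow-Y-mono (suc j) i j′ k = trans (SA.*-assoc Y (pow Y j) (mono i j′ k 0)) (trans (*-congˡ {Y} (pow-Y-mono j i j′ k)) (Y*mono i (j ℕ.+ j′) k))

  -- The statement adds up monomials given by their coefficients. As products of powers over the
  -- cycles they fall under the abstract weighted recurrence.
  mono-weight : ∀ σ → mono (cap σ) (fix σ) (cyc σ) 0 ≋ 𝓡.weight σ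
  mono-weight []      = refl
  mono-weight (c ∷ σ) = sym (begin
    pow X i *S (pow Y j *S Qv) *S 𝓡.weight σ       ≈⟨ *-congˡ {pow X i *S (pow Y j *S Qv)} (sym (mono-weight σ)) ⟩
    pow X i *S (pow Y j *S Qv) *S M                ≈⟨ solve 4 (λ x y q m → x :* (y :* q) :* m := x :* (y :* (q :* m))) refl (pow X i) (pow Y j) Qv M ⟩
    pow X i *S (pow Y j *S (Qv *S M))              ≈⟨ *-congˡ {pow X i} (trans (*-congˡ {pow Y j} (Q*mono (cap σ) (fix σ) (cyc σ))) (pow-Y-mono j (cap σ) (fix σ) (suc (cyc σ)))) ⟩
    pow X i *S mono (cap σ) (j ℕ.+ fix σ) (suc (cyc σ)) 0 ≈⟨ pow-X-mono i (cap σ) (j ℕ.+ fix σ) (suc (cyc σ)) ⟩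
    mono (i ℕ.+ cap σ) (j ℕ.+ fix σ) (suc (cyc σ)) 0      ∎)
    where
    i = capC c
    j = isFixC c
    M = mono (cap σ) (fix σ) (cyc σ) 0

  mono-desWeight : ∀ π → mono (des π) 0 0 0 ≋ 𝓡.desWeight π
  mono-desWeight π = trans (sym (trans (pow-X-mono (des π) 0 0 0) (reflexive (≡.cong (λ n → mono n 0 0 0) (ℕ.+-identityʳ (des π))))))
    (SA.*-identityʳ (pow X (des π)))

  module _ (Q2 : ℕ → List (List (List ℕ))) (Q2-enum : ∀ n → 1 ≤ n → Enumerates (IsQ2 n) (Q2 n))
           (Perms : ℕ → List (List ℕ)) (Perms-enum : ∀ m → Enumerates (IsPerm m) (Perms m)) where

    -- At 0 the given list is replaced by the one with the empty list of cycles alone. Its weight is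
    -- 1, in accordance with P_0 = 1, and the insertion recurrence can start there.
    Q : ℕ → List (List (List ℕ))
    Q zero    = [ [] ]
    Q (suc n) = Q2 (suc n)

    Q-enum : ∀ n → Enumerates (Q² n) (Q n)
    Q-enum zero    = [] ∷ [] ,
      (λ { _ (here ≡.refl) → record { entries = ↭-refl ; separated = [] ; headIsMin = [] ; stirling = [] } }) ,
      λ σ q → here (Q²-0 q)
    Q-enum (suc n) = let unique , sound , complete = Q2-enum (suc n) (s≤s z≤n) in
      unique , (λ σ σ∈ → isQ2⇒Q² (sound σ σ∈)) , λ σ q → complete σ (Q²⇒isQ2 q)

    Pn : ℕ → Series
    Pn n = ∑ (Q n) 𝓡.weight

    P≋ : ∀ n → P Q2 n ≋ Pn n
    P≋ zero    = sym (SA.+-identityʳ oneS)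
    P≋ (suc n) = SA.∑-cong (Q2 (suc n)) (λ σ _ → mono-weight σ)

    Pn-0 : Pn 0 ≋ oneS
    Pn-0 = SA.+-identityʳ oneS

    Pn-suc : ∀ n → Pn (suc n) ≋ (ι (2 * n) *S X +S Qv *S Y) *S Pn n +S L (Pn n)
    Pn-suc n = let _ , sound , _ = Q-enum n in
      trans (SA.∑-↭ 𝓡.weight (enumerations-↭ (Q-enum (suc n)) (enumerate-extensions (Q²-extension n) (Q-enum n))))
        (𝓡.∑-weight-step (suc n) (2 * n) (Q n) (λ σ σ∈ → concat-< (sound σ σ∈)) (λ σ σ∈ → length-concat (sound σ σ∈)))

    An : ℕ → Series
    An m = ∑ (Perms m) 𝓡.desWeight

    Eulerian≋ : ∀ m → Eulerian (Perms m) ≋ An m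
    Eulerian≋ m = SA.∑-cong (Perms m) (λ π _ → mono-desWeight π)

    Bn : ℕ → Series
    Bn m = ι (2 ^ m) *S An m

    Bn-0 : Bn 0 ≋ oneS
    Bn-0 = trans (*-cong SA.1-homo (trans (SA.∑-↭ 𝓡.desWeight (enumerations-↭ (Perms-enum 0) empty-enum)) (SA.+-identityʳ oneS))) (SA.*-identityʳ oneS)
      where
      empty-enum : Enumerates (IsPerm 0) [ [] ]
      empty-enum = [] ∷ [] , (λ { _ (here ≡.refl) → ↭-refl }) , λ π π↭ → here (↭-empty-inv π↭)

    -- One factor of 2^(m+1) is absorbed by the doubled insertion sum of `∑-desWeight-step`; the
    -- remaining constant 2^m commutes with `L`.
    Bn-suc : ∀ m → Bn (suc m) ≋ (ι 2 +S ι (2 * m) *S X) *S Bn m +S L (Bn m)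
    Bn-suc m = let _ , sound , _ = Perms-enum m in begin
      ι (2 * 2 ^ m) *S An (suc m)
        ≈⟨ *-cong (SA.ι-* 2 (2 ^ m)) (SA.∑-↭ 𝓡.desWeight (enumerations-↭ (Perms-enum (suc m)) (enumerate-extensions (perm-extension m) (Perms-enum m)))) ⟩
      ι 2 *S t *S A′
        ≈⟨ solve 3 (λ u t a → u :* t :* a := t :* (u :* a)) refl (ι 2) t A′ ⟩
      t *S (ι 2 *S A′)
        ≈⟨ *-congˡ {t} (𝓡.∑-desWeight-step (suc m) m (Perms m) (λ π π∈ → perm-< (sound π π∈)) (λ π π∈ → perm-length {m} (sound π π∈))) ⟩
      t *S ((ι 2 +S ι 2 *S ι m *S X) *S An m +S L (An m))
        ≈⟨ solve 6 (λ t u i x a l → t :* ((u :+ u :* i :* x) :* a :+ l) := (u :+ (u :* i) :* x) :* (t :* a) :+ t :* l) refl t (ι 2) (ι m) X (An m) (L (An m)) ⟩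
      (ι 2 +S (ι 2 *S ι m) *S X) *S Bn m +S t *S L (An m)
        ≈⟨ +-cong (*-congʳ {Bn m} (+-congˡ {ι 2} (*-congʳ {X} (SA.ι-* 2 m)))) (SA.IsDerivation.D-con* L-derivation (ℕ→ℚ (2 ^ m)) (An m)) ⟨
      (ι 2 +S ι (2 * m) *S X) *S Bn m +S L (Bn m) ∎
      where
      t = ι (2 ^ m)
      A′ = ∑ (concat (map (insertAnywhere [ suc m ]) (Perms m))) 𝓡.desWeight

    module 𝓒 = 𝓡.Convolution Pn Bn Pn-0 Pn-suc Bn-0 Bn-suc

    -- The value is read off from the convolution at n = 0, where the sum is empty, instead of from
    -- a list of the cycle structures on 1, 1.
    P-1 : P Q2 1 ≋ Y *S Qv
    P-1 = begin
      P Q2 1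
        ≈⟨ P≋ 1 ⟩
      Pn 1
        ≈⟨ 𝓒.convolution 0 ⟩
      Qv *S Y *S Pn 0 +S Qv *S X *S zeroS
        ≈⟨ +-cong (*-cong {Qv *S Y} {Y *S Qv} {Pn 0} {oneS} (SA.*-comm Qv Y) Pn-0) (SA.zeroʳ (Qv *S X)) ⟩
      Y *S Qv *S oneS +S zeroS
        ≈⟨ trans (SA.+-identityʳ _) (SA.*-identityʳ (Y *S Qv)) ⟩
      Y *S Qv ∎

    P-convolution : ∀ n → P Q2 (suc n) ≋ Qv *S Y *S P Q2 n
      +S Qv *S X *S ΣS< n (λ k → ℕ→ℚ ((n C k) * 2 ^ (n ∸ k)) ·S (P Q2 k *S Eulerian (Perms (n ∸ k))))
    P-convolution n = begin
      P Q2 (suc n)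
        ≈⟨ P≋ (suc n) ⟩
      Pn (suc n)
        ≈⟨ 𝓒.convolution n ⟩
      Qv *S Y *S Pn n +S Qv *S X *S 𝓒.S n
        ≈⟨ +-cong (*-congˡ {Qv *S Y} (sym (P≋ n))) (*-congˡ {Qv *S X} (trans (SA.∑<-cong n (λ k _ → term k)) (sym (ΣS<≋∑< n _)))) ⟩
      Qv *S Y *S P Q2 n +S Qv *S X *S ΣS< n (λ k → ℕ→ℚ ((n C k) * 2 ^ (n ∸ k)) ·S (P Q2 k *S Eulerian (Perms (n ∸ k)))) ∎
      where
      ΣS<≋∑< : ∀ n F → ΣS< n F ≋ ∑< n F
      ΣS<≋∑< zero    F = refl
      ΣS<≋∑< (suc n) F = pointwise λ a b c d → ≡.cong (ℚ._+ F n a b c d) (at (ΣS<≋∑< n F) a b c d)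
      term : ∀ k → ι (n C k) *S (Pn k *S Bn (n ∸ k)) ≋ ℕ→ℚ ((n C k) * 2 ^ (n ∸ k)) ·S (P Q2 k *S Eulerian (Perms (n ∸ k)))
      term k = begin
        ι (n C k) *S (Pn k *S (ι (2 ^ (n ∸ k)) *S An (n ∸ k)))
          ≈⟨ solve 4 (λ c p t a → c :* (p :* (t :* a)) := c :* t :* (p :* a)) refl (ι (n C k)) (Pn k) (ι (2 ^ (n ∸ k))) (An (n ∸ k)) ⟩
        ι (n C k) *S ι (2 ^ (n ∸ k)) *S (Pn k *S An (n ∸ k))
          ≈⟨ *-cong (SA.ι-* (n C k) (2 ^ (n ∸ k))) (*-cong (P≋ k) (Eulerian≋ (n ∸ k))) ⟨
        ι ((n C k) * 2 ^ (n ∸ k)) *S (P Q2 k *S Eulerian (Perms (n ∸ k)))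
          ≈⟨ constS-* (ℕ→ℚ ((n C k) * 2 ^ (n ∸ k))) (P Q2 k *S Eulerian (Perms (n ∸ k))) ⟩
        ℕ→ℚ ((n C k) * 2 ^ (n ∸ k)) ·S (P Q2 k *S Eulerian (Perms (n ∸ k))) ∎

    P-recurrence : ∀ n → P Q2 (suc n) ≋ (ℕ→ℚ (2 * n) ·S X +S Qv *S Y) *S P Q2 n
      +S ℕ→ℚ 2 ·S X *S (oneS -S X) *S ∂x (P Q2 n)
      +S ℕ→ℚ 2 ·S X *S (oneS -S Y) *S ∂y (P Q2 n)
    P-recurrence n = begin
      P Q2 (suc n)
        ≈⟨ P≋ (suc n) ⟩
      Pn (suc n)
        ≈⟨ Pn-suc n ⟩
      (ι (2 * n) *S X +S Qv *S Y) *S Pn n +S L (Pn n)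
        ≈⟨ +-cong (*-congˡ {ι (2 * n) *S X +S Qv *S Y} (P≋ n)) (SA.IsDerivation.D-cong L-derivation (P≋ n)) ⟨
      (ι (2 * n) *S X +S Qv *S Y) *S p +S (Ax *S ∂x p +S Ay *S ∂y p)
        ≈⟨ SA.+-assoc ((ι (2 * n) *S X +S Qv *S Y) *S p) (Ax *S ∂x p) (Ay *S ∂y p) ⟨
      (ι (2 * n) *S X +S Qv *S Y) *S p +S Ax *S ∂x p +S Ay *S ∂y p
        ≈⟨ +-cong (+-cong (*-congʳ {p} (+-congʳ {Qv *S Y} (constS-* (ℕ→ℚ (2 * n)) X)))
             (*-congʳ {∂x p} (*-congʳ {oneS -S X} (constS-* (ℕ→ℚ 2) X)))) (*-congʳ {∂y p} (*-congʳ {oneS -S Y} (constS-* (ℕ→ℚ 2) X))) ⟩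
      (ℕ→ℚ (2 * n) ·S X +S Qv *S Y) *S p +S ℕ→ℚ 2 ·S X *S (oneS -S X) *S ∂x p +S ℕ→ℚ 2 ·S X *S (oneS -S Y) *S ∂y p ∎
      where p = P Q2 n

    EGF≋closedForm : EGF Q2 ≋ closedForm
    EGF≋closedForm = trans (pointwise λ a b c n → ≡.cong (recip (ℕ→ℚ (n ℕ.!)) ℚ.*_) (at (P≋ n) a b c 0))
      (egf-closedForm Pn Pn-suc (λ a b c → at Pn-0 a b c 0))

open import Defs
open import Data.Nat using (_^_; _*_)
open import Data.Nat.Combinatorics using (_C_)
open SeriesRing using (at)
open Assembly

theorem14 : (Q2 : ℕ → List (List (List ℕ))) →
    (∀ n → 1 ≤ n → Enumerates (IsQ2 n) (Q2 n)) →
    (Perms : ℕ → List (List ℕ)) →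
    (∀ m → Enumerates (IsPerm m) (Perms m)) →
    (P Q2 1 ≈ Y *S Qv) ×
    (∀ n → 1 ≤ n →
    P Q2 (suc n) ≈
    Qv *S Y *S P Q2 n
    +S Qv *S X *S ΣS< n (λ k →
    ℕ→ℚ ((n C k) * 2 ^ (n ∸ k)) ·S (P Q2 k *S Eulerian (Perms (n ∸ k))))) ×
    (∀ n → 1 ≤ n →
    P Q2 (suc n) ≈
    (ℕ→ℚ (2 * n) ·S X +S Qv *S Y) *S P Q2 n
    +S ℕ→ℚ 2 ·S X *S (oneS -S X) *S ∂x (P Q2 n)
    +S ℕ→ℚ 2 ·S X *S (oneS -S Y) *S ∂y (P Q2 n)) ×
    (EGF Q2 ≈ closedForm)
theorem14 Q2 Q2-enum Perms Perms-enum =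
  at (P-1 Q2 Q2-enum Perms Perms-enum) ,
  (λ n _ → at (P-convolution Q2 Q2-enum Perms Perms-enum n)) ,
  (λ n _ → at (P-recurrence Q2 Q2-enum Perms Perms-enum n)) ,
  at (EGF≋closedForm Q2 Q2-enum Perms Perms-enum)
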